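{- For each integer $n\ge 3$, let $\{G_m\}_{0\le m\le\binom n2}$ be the random graph process on the vertex set $[n]=\{1,\dots,n\}$, and let $\tau=\tau_2$ be the smallest $m$ such that the minimum degree satisfies $\delta(G_m)\ge 2$. Then, with high probability (i.e. with probability tending to $1$ as $n\to\infty$), the graph $G_\tau$ is globally rigid in $\mathbb{R}$.
   Context: Random graph process: $G_0$ is the empty graph on $[n]$, and for each $i\ge 1$, $G_i$ is obtained from $G_{i-1}$ by adding one new edge chosen uniformly at random among the pairs of vertices not yet joined by an edge. Global rigidity in $\mathbb{R}$ (injective version): a simple graph $G=(V,E)$ is globally rigid in $\mathbb{R}$ if for every two injective functions $f,g:V\to\mathbb{R}$ satisfying $|f(x)-f(y)|=|g(x)-g(y)|$ for every edge $xy\in E$, we also have $|f(x)-f(y)|=|g(x)-g(y)|$ for every pair $x,y\in V$. -}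

module Defs where

open import Level using (Level; 0ℓ)
open import Data.Bool using (Bool; T)
open import Data.Empty using (⊥)
open import Data.Fin as Fin using (Fin)
import Data.Fin.Properties as Fin
open import Data.Integer using (+_)
open import Data.List as List using (List; []; _∷_)
open import Data.List.Extrema.Nat using (min)
import Data.Maybe as Maybe
open import Data.Nat as ℕ using (ℕ; zero; suc; _⊔_)
import Data.Nat.Properties as ℕ
open import Data.Nat.Combinatorics using (_C_)
open import Data.Product using (Σ-syntax; ∃-syntax; _×_; _,_; proj₁; proj₂)
open import Data.Rational as ℚ using (ℚ; 0ℚ; 1ℚ; ½)
import Data.Rational.Properties as ℚ
import Data.Rational.Solver as ℚ-Solver
open import Data.Sum using (_⊎_; inj₁; inj₂)
open import Data.Vec using (Vec; []; _∷_; lookup)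
open import Function using (_∘_)
open import Function.Definitions using (Injective)
open import Relation.Binary using (Rel; Decidable; Symmetric; Irreflexive)
open import Relation.Binary.PropositionalEquality
open import Relation.Nullary using (¬_; no)
open import Relation.Nullary.Decidable using (¬?; _×-dec_; _⊎-dec_; dec⇒maybe)

private variable
  a : Level
  A B : Set a
  n : ℕ

------------------------------------------------------------------------
-- Real numbers: Cauchy sequences of rationals, with the setoid equality
-- "the difference tends to 0".

record ℝ : Set where
  constructor mkℝ
  field
    seq    : ℕ → ℚ
    cauchy : ∀ ε → 0ℚ ℚ.< ε →
             ∃[ N ] (∀ i j → N ℕ.≤ i → N ℕ.≤ j → ℚ.∣ seq i ℚ.- seq j ∣ ℚ.< ε)
open ℝ public

infix 4 _≃_
_≃_ : Rel ℝ 0ℓ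
x ≃ y = ∀ ε → 0ℚ ℚ.< ε → ∃[ N ] (∀ i → N ℕ.≤ i → ℚ.∣ seq x i ℚ.- seq y i ∣ ℚ.< ε)

private
  half-pos : ∀ {ε} → 0ℚ ℚ.< ε → 0ℚ ℚ.< ½ ℚ.* ε
  half-pos {ε} 0<ε = subst (ℚ._< ½ ℚ.* ε) (ℚ.*-zeroʳ ½) (ℚ.*-monoʳ-<-pos ½ 0<ε)

  half+half : ∀ ε → ½ ℚ.* ε ℚ.+ ½ ℚ.* ε ≡ ε
  half+half ε = trans (sym (ℚ.*-distribʳ-+ ε ½ ½)) (ℚ.*-identityˡ ε)

  regroup : ∀ p q r s → (p ℚ.- q) ℚ.- (r ℚ.- s) ≡ (p ℚ.- r) ℚ.- (q ℚ.- s)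
  regroup = solve 4 (λ p q r s → (p :- q) :- (r :- s) := (p :- r) :- (q :- s)) refl
    where open ℚ-Solver.+-*-Solver

  cancel : ∀ p q → (p ℚ.- q) ℚ.+ q ≡ p
  cancel = solve 2 (λ p q → (p :- q) :+ q := p) refl
    where open ℚ-Solver.+-*-Solver

  add-sub : ∀ p q → (p ℚ.+ q) ℚ.- q ≡ p
  add-sub = solve 2 (λ p q → (p :+ q) :- q := p) refl
    where open ℚ-Solver.+-*-Solver

  neg-sub : ∀ p q → ℚ.- (p ℚ.- q) ≡ q ℚ.- p
  neg-sub = solve 2 (λ p q → :- (p :- q) := q :- p) refl
    where open ℚ-Solver.+-*-Solver

  ∣p∣-∣q∣≤∣p-q∣ : ∀ p q → ℚ.∣ p ∣ ℚ.- ℚ.∣ q ∣ ℚ.≤ ℚ.∣ p ℚ.- q ∣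
  ∣p∣-∣q∣≤∣p-q∣ p q = begin
    ℚ.∣ p ∣ ℚ.- ℚ.∣ q ∣                       ≡⟨ cong (λ t → ℚ.∣ t ∣ ℚ.- ℚ.∣ q ∣) (cancel p q) ⟨
    ℚ.∣ (p ℚ.- q) ℚ.+ q ∣ ℚ.- ℚ.∣ q ∣         ≤⟨ ℚ.+-monoˡ-≤ (ℚ.- ℚ.∣ q ∣) (ℚ.∣p+q∣≤∣p∣+∣q∣ (p ℚ.- q) q) ⟩
    (ℚ.∣ p ℚ.- q ∣ ℚ.+ ℚ.∣ q ∣) ℚ.- ℚ.∣ q ∣   ≡⟨ add-sub ℚ.∣ p ℚ.- q ∣ ℚ.∣ q ∣ ⟩
    ℚ.∣ p ℚ.- q ∣                             ∎
    where open ℚ.≤-Reasoning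

  ∣p-q∣≡∣q-p∣ : ∀ p q → ℚ.∣ p ℚ.- q ∣ ≡ ℚ.∣ q ℚ.- p ∣
  ∣p-q∣≡∣q-p∣ p q = trans (sym (ℚ.∣-p∣≡∣p∣ (p ℚ.- q))) (cong ℚ.∣_∣ (neg-sub p q))

  ∣∣p∣-∣q∣∣≤∣p-q∣ : ∀ p q → ℚ.∣ ℚ.∣ p ∣ ℚ.- ℚ.∣ q ∣ ∣ ℚ.≤ ℚ.∣ p ℚ.- q ∣
  ∣∣p∣-∣q∣∣≤∣p-q∣ p q with ℚ.∣p∣≡p∨∣p∣≡-p (ℚ.∣ p ∣ ℚ.- ℚ.∣ q ∣)
  ... | inj₁ eq = ℚ.≤-trans (ℚ.≤-reflexive eq) (∣p∣-∣q∣≤∣p-q∣ p q)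
  ... | inj₂ eq = ℚ.≤-trans (ℚ.≤-reflexive (trans eq (neg-sub ℚ.∣ p ∣ ℚ.∣ q ∣)))
                    (ℚ.≤-trans (∣p∣-∣q∣≤∣p-q∣ q p) (ℚ.≤-reflexive (∣p-q∣≡∣q-p∣ q p)))

infixl 6 _-_
_-_ : ℝ → ℝ → ℝ
seq    (x - y) i = seq x i ℚ.- seq y i
cauchy (x - y) ε 0<ε = N₁ ⊔ N₂ , λ i j N≤i N≤j → begin-strict
    ℚ.∣ (seq x i ℚ.- seq y i) ℚ.- (seq x j ℚ.- seq y j) ∣
      ≡⟨ cong ℚ.∣_∣ (regroup (seq x i) (seq y i) (seq x j) (seq y j)) ⟩
    ℚ.∣ (seq x i ℚ.- seq x j) ℚ.- (seq y i ℚ.- seq y j) ∣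
      ≤⟨ ℚ.∣p-q∣≤∣p∣+∣q∣ (seq x i ℚ.- seq x j) (seq y i ℚ.- seq y j) ⟩
    ℚ.∣ seq x i ℚ.- seq x j ∣ ℚ.+ ℚ.∣ seq y i ℚ.- seq y j ∣
      <⟨ ℚ.+-mono-< (h₁ i j (ℕ.m⊔n≤o⇒m≤o N₁ N₂ N≤i) (ℕ.m⊔n≤o⇒m≤o N₁ N₂ N≤j))
                    (h₂ i j (ℕ.m⊔n≤o⇒n≤o N₁ N₂ N≤i) (ℕ.m⊔n≤o⇒n≤o N₁ N₂ N≤j)) ⟩
    ½ ℚ.* ε ℚ.+ ½ ℚ.* ε
      ≡⟨ half+half ε ⟩
    ε ∎
  where
  open ℚ.≤-Reasoning
  cx = cauchy x (½ ℚ.* ε) (half-pos 0<ε)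
  cy = cauchy y (½ ℚ.* ε) (half-pos 0<ε)
  N₁ = proj₁ cx
  N₂ = proj₁ cy
  h₁ = proj₂ cx
  h₂ = proj₂ cy

∣_∣ : ℝ → ℝ
seq    ∣ x ∣ i = ℚ.∣ seq x i ∣
cauchy ∣ x ∣ ε 0<ε with cauchy x ε 0<ε
... | N , h = N , λ i j N≤i N≤j →
  ℚ.≤-<-trans (∣∣p∣-∣q∣∣≤∣p-q∣ (seq x i) (seq x j)) (h i j N≤i N≤j)

------------------------------------------------------------------------
-- Finite simple graphs and global rigidity on the line

record SimpleGraph (V : Set) : Set₁ where
  field
    _~_    : Rel V 0ℓ
    _~?_   : Decidable _~_
    symm   : Symmetric _~_
    irrefl : Irreflexive _≡_ _~_

GloballyRigid : {V : Set} → SimpleGraph V → Set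
GloballyRigid {V} G =
  (f g : V → ℝ) → Injective _≡_ _≃_ f → Injective _≡_ _≃_ g →
  (∀ x y → x ~ y → ∣ f x - f y ∣ ≃ ∣ g x - g y ∣) →
  ∀ x y → ∣ f x - f y ∣ ≃ ∣ g x - g y ∣
  where open SimpleGraph G

Graph : ℕ → Set₁
Graph n = SimpleGraph (Fin n)

degree : Graph n → Fin n → ℕ
degree {n} G v = List.length (List.filter (v ~?_) (List.allFin n))
  where open SimpleGraph G

-- All degrees are below n, so the default n of the list minimum is only
-- ever attained for n = 0.
δ : Graph n → ℕ
δ {n} G = min n (List.map (degree G) (List.allFin n))

------------------------------------------------------------------------
-- Finite probability: a finitely supported distribution is a list of
-- weighted outcomes.

Dist : Set a → Set a
Dist A = List (ℚ × A)

return : A → Dist A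
return x = (1ℚ , x) ∷ []

infixl 1 _>>=_
_>>=_ : Dist A → (A → Dist B) → Dist B
d >>= f = List.concatMap (λ (p , x) → List.map (λ (q , y) → p ℚ.* q , y) (f x)) d

-- There is no uniform distribution on no outcomes; that case yields total
-- mass 0.
uniform : List A → Dist A
uniform []       = []
uniform (x ∷ xs) = List.map (λ y → + 1 ℚ./ suc (List.length xs) , y) (x ∷ xs)

Pr : Dist A → (A → Bool) → ℚ
Pr d b = List.foldr ℚ._+_ 0ℚ (List.map proj₁ (List.filterᵇ (b ∘ proj₂) d))

-- "The event E has probability at least p", for an event E that is not
-- given with a decision procedure: some Boolean event contained in E has
-- probability at least p.  Classically E itself is Boolean, and this says
-- exactly p ≤ Pr(E).
Pr[_∣_]≥_ : {A : Set a} → Dist A → (A → Set) → ℚ → Set a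
Pr[_∣_]≥_ {A = A} d E p =
  Σ[ b ∈ (A → Bool) ] ((∀ ω → T (b ω) → E ω) × p ℚ.≤ Pr d b)

------------------------------------------------------------------------
-- The random graph process

emptyGraph : ∀ n → Graph n
emptyGraph n = record
  { _~_    = λ _ _ → ⊥
  ; _~?_   = λ _ _ → no λ ()
  ; symm   = λ ()
  ; irrefl = λ _ ()
  }

-- An unordered pair of distinct vertices, listed with the smaller one first.
Pair : ℕ → Set
Pair n = Σ[ (u , v) ∈ Fin n × Fin n ] u Fin.< v

pairs : ∀ n → List (Pair n)
pairs n = List.mapMaybe (λ (u , v) → Maybe.map ((u , v) ,_) (dec⇒maybe (u Fin.<? v)))
            (List.cartesianProduct (List.allFin n) (List.allFin n))

addEdge : Graph n → Pair n → Graph n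
addEdge G ((u , v) , u<v) = record
  { _~_    = λ x y → x ~ y ⊎ (x ≡ u × y ≡ v) ⊎ (x ≡ v × y ≡ u)
  ; _~?_   = λ x y → (x ~? y) ⊎-dec ((x Fin.≟ u) ×-dec (y Fin.≟ v))
                              ⊎-dec ((x Fin.≟ v) ×-dec (y Fin.≟ u))
  ; symm   = λ where
      (inj₁ x~y)               → inj₁ (symm x~y)
      (inj₂ (inj₁ (x≡u , y≡v))) → inj₂ (inj₂ (y≡v , x≡u))
      (inj₂ (inj₂ (x≡v , y≡u))) → inj₂ (inj₁ (y≡u , x≡v))
  ; irrefl = λ where
      x≡y  (inj₁ x~y)                → irrefl x≡y x~y
      refl (inj₂ (inj₁ (refl , u≡v))) → Fin.<⇒≢ u<v u≡v
      refl (inj₂ (inj₂ (refl , v≡u))) → Fin.<⇒≢ u<v (sym v≡u)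
  }
  where open SimpleGraph G

nonEdges : Graph n → List (Pair n)
nonEdges {n} G = List.filter (λ ((u , v) , _) → ¬? (u ~? v)) (pairs n)
  where open SimpleGraph G

-- The trajectory (G , G₁ , … , G_k) of k steps started at G, each step adding
-- a uniformly random non-edge of the current graph.
processFrom : Graph n → (k : ℕ) → Dist (Vec (Graph n) (suc k))
processFrom G zero    = return (G ∷ [])
processFrom G (suc k) =
  uniform (nonEdges G) >>= λ e →
  processFrom (addEdge G e) k >>= λ ω →
  return (G ∷ ω)

-- G₀ , G₁ , … , G_N with N = n C 2.
randomGraphProcess : ∀ n → Dist (Vec (Graph n) (suc (n C 2)))
randomGraphProcess n = processFrom (emptyGraph n) (n C 2)

-- m is the hitting time τ_d of minimum degree d on the trajectory ω.
IsHittingTime : ∀ {k} → ℕ → Vec (Graph n) (suc k) → Fin (suc k) → Set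
IsHittingTime d ω m =
  δ (lookup ω m) ℕ.≥ d × (∀ i → i Fin.< m → ¬ (δ (lookup ω i) ℕ.≥ d))

{-# OPTIONS --safe #-}
module Submission where

-- Let f and g be injective with |f x - f y| = |g x - g y| on every edge.  Along
-- an edge either f - g or f + g is constant, so x ↦ (f x - g x , f x + g x) puts
-- the vertices at distinct points of a grid, with every edge inside a row or a
-- column; rigidity says that a single line contains all vertices.  If disjoint
-- sets of linear size always span edges, some line R has linear size: otherwise
-- a union X of rows and a union Y of columns, both of moderate size, cut the
-- grid into quadrants with no edges between opposite ones.  A vertex outside R
-- has at most one neighbour in R, so the complement W of R is small, sends at
-- most |W| edges out, and, all degrees being at least 2, induces a graph without
-- isolated vertices.  With high probability only W = ∅ has these properties.
--
-- The hitting time τ lies between two fixed times m₁ < m₂: the number of isolated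
-- vertices at time m₁ has a small variance, and the minimum degree at time m₂ is
-- at least 2 by a union bound.  Hence it suffices to exclude sets W that send out
-- few edges at time m₁ and contain many edges at time m₂, which is done by a
-- union bound with the exponential supermartingales x^e(W, ∁W) Y^(2 e(W)).

-- The graph at `τ` is not the graph at a fixed time, so no union bound applies to it directly. But
-- few edges leaving W is inherited by earlier graphs and many edges inside W by later ones, so both
-- can be tested at fixed times. Heuristically τ is (n log n)/2, about 29.8 nL when n is about
-- 2^(86L); the observation times 24nL and 72nL enclose it with room for crude estimates. The union
-- bound is nearly tight. Choosing W costs about n/s per vertex, where s = |W|; sparse boundary
-- gains 2^(-44L). Internal edges are counted in both directions, so s of them are only s/2 edges
-- and gain about sL n^(-1/2) per vertex, with n^(-1/2) about 2^(-43L). What remains is one factor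
-- 2^-L, which beats the factors polynomial in L. Probabilities are rational, so exponentials are
-- replaced by powers of 1/2 and Bernoulli-type inequalities. Equality of reals is undecidable,
-- hence so is lying on a common line of the grid. The conclusion of rigidity is stable under double
-- negation and there are finitely many pairs, so decidability may be assumed while proving it.

open import Defs hiding (_-_; ∣_∣; _≃_)
import Defs
open import Data.Nat using (_≥_)
open import Data.Product using (∃-syntax; _×_)
open import Data.Rational as ℚ using (ℚ; 0ℚ; 1ℚ)
open import Data.Vec using (lookup)

open import Algebra.Bundles using (CommutativeRing)
import Algebra.Properties.CommutativeSemiring.Exp as Exp
import Algebra.Properties.Semiring.Sum as Sum
open import Data.Bool using (Bool; true; false; T; if_then_else_; not)
open import Data.Empty using (⊥; ⊥-elim)
open import Data.Fin as Fin using (Fin; zero; suc; toℕ)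
import Data.Fin.Properties as Fin
import Data.Integer as ℤ
open import Data.Integer.Tactic.RingSolver using () renaming (solve-∀ to ℤ-solve)
open import Data.List as List using (List; []; _∷_; length)
open import Data.List.Extrema.Nat using (v≤min⁺; min≤xs)
open import Data.List.Membership.Propositional using (_∈_)
import Data.List.Membership.Propositional.Properties as ∈
import Data.List.Properties as List
open import Data.List.Relation.Unary.All as All using (All)
import Data.List.Relation.Unary.All.Properties as All
open import Data.List.Relation.Unary.Any using (here; there)
open import Data.Maybe as Maybe using (Maybe; just; nothing; maybe′)
import Data.Nat
open import Data.Nat as ℕ using (ℕ; zero; suc)
open import Data.Nat.Combinatorics using (_C_; nC1≡n; nCk+nC[k+1]≡[n+1]C[k+1])
import Data.Nat.DivMod as ℕ
import Data.Nat.Properties as ℕ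
open import Data.Nat.Tactic.RingSolver using () renaming (solve-∀ to ℕ-solve)
open import Data.Product using (∃; _,_; proj₁; proj₂)
import Data.Rational
import Data.Rational.Properties as ℚ
import Data.Rational.Unnormalised as ℚᵘ
import Data.Rational.Unnormalised.Properties as ℚᵘ
open import Data.Sum using (_⊎_; inj₁; inj₂; [_,_]′)
open import Data.Vec as Vec using (Vec; []; _∷_)
import Data.Vec.Properties as Vec
open import Function using (_∘_; id)
open import Level using (0ℓ)
open import Relation.Binary using (tri<; tri≈; tri>)
open import Relation.Binary.PropositionalEquality
open import Relation.Nullary using (¬_; Dec; yes; no; does; _because_; contradiction)
open import Relation.Nullary.Decidable using (dec⇒maybe; ¬?; _×-dec_; _→-dec_)
open import Tactic.RingSolver using (solve-∀)
open import Tactic.RingSolver.Core.AlmostCommutativeRing using (AlmostCommutativeRing; fromCommutativeRing)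

-- Powers and estimates in ℚ

module _ where
  open Data.Rational using (_+_; _*_; _-_; -_; _≤_; _<_)
  open ℚ.≤-Reasoning

  ℚ-ring : AlmostCommutativeRing 0ℓ 0ℓ
  ℚ-ring = fromCommutativeRing ℚ.+-*-commutativeRing (λ x → dec⇒maybe (0ℚ ℚ.≟ x))

  open Exp (CommutativeRing.commutativeSemiring ℚ.+-*-commutativeRing) public
    using (_^_; ^-homo-*; ^-assocʳ; ^-distrib-*)

  -- Recursion lets a literal such as `ι 2` unfold to a sum of ones, which is the form in which ring
  -- identities mention it.
  ι : ℕ → ℚ
  ι zero    = 0ℚ
  ι (suc n) = 1ℚ + ι n

  0≤1 : 0ℚ ≤ 1ℚ
  0≤1 = ℚ.≤ᵇ⇒≤ _

  ≤-by : ∀ {a b} c → 0ℚ ≤ c → a + c ≡ b → a ≤ b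
  ≤-by {a} {b} c 0≤c a+c≡b = begin
    a      ≡⟨ ℚ.+-identityʳ a ⟨
    a + 0ℚ ≤⟨ ℚ.+-monoʳ-≤ a 0≤c ⟩
    a + c  ≡⟨ a+c≡b ⟩
    b      ∎

  a≤b⇒0≤b-a : ∀ {a b} → a ≤ b → 0ℚ ≤ b - a
  a≤b⇒0≤b-a {a} {b} a≤b = begin
    0ℚ    ≡⟨ ℚ.+-inverseʳ a ⟨
    a - a ≤⟨ ℚ.+-monoˡ-≤ (- a) a≤b ⟩
    b - a ∎

  0≤b-a⇒a≤b : ∀ {a b} → 0ℚ ≤ b - a → a ≤ b
  0≤b-a⇒a≤b {a} {b} p = ≤-by (b - a) p (lem a b)
    where
    lem : ∀ a b → a + (b - a) ≡ b
    lem = solve-∀ ℚ-ring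

  *-monoʳ : ∀ {a b c} → 0ℚ ≤ c → a ≤ b → c * a ≤ c * b
  *-monoʳ {c = c} 0≤c = ℚ.*-monoˡ-≤-nonNeg c {{ℚ.nonNegative 0≤c}}

  *-monoˡ : ∀ {a b c} → 0ℚ ≤ c → a ≤ b → a * c ≤ b * c
  *-monoˡ {c = c} 0≤c = ℚ.*-monoʳ-≤-nonNeg c {{ℚ.nonNegative 0≤c}}

  *-mono : ∀ {a b c d} → 0ℚ ≤ a → 0ℚ ≤ d → a ≤ b → c ≤ d → a * c ≤ b * d
  *-mono 0≤a 0≤d a≤b c≤d = ℚ.≤-trans (*-monoʳ 0≤a c≤d) (*-monoˡ 0≤d a≤b)

  0≤* : ∀ {a b} → 0ℚ ≤ a → 0ℚ ≤ b → 0ℚ ≤ a * b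
  0≤* {a} {b} 0≤a 0≤b = begin
    0ℚ     ≡⟨ ℚ.*-zeroʳ a ⟨
    a * 0ℚ ≤⟨ *-monoʳ 0≤a 0≤b ⟩
    a * b  ∎

  0≤+ : ∀ {a b} → 0ℚ ≤ a → 0ℚ ≤ b → 0ℚ ≤ a + b
  0≤+ 0≤a 0≤b = ℚ.+-mono-≤ 0≤a 0≤b

  0≤square : ∀ a → 0ℚ ≤ a * a
  0≤square a with ℚ.≤-total 0ℚ a
  ... | inj₁ 0≤a = 0≤* 0≤a 0≤a
  ... | inj₂ a≤0 = ℚ.≤-trans (0≤* 0≤-a 0≤-a) (ℚ.≤-reflexive (lem a))
    where
    0≤-a : 0ℚ ≤ - a
    0≤-a = ℚ.neg-antimono-≤ a≤0
    lem : ∀ a → - a * - a ≡ a * a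
    lem = solve-∀ ℚ-ring

  *-cancel-≤ : ∀ {a b} c → 0ℚ < c → c * a ≤ c * b → a ≤ b
  *-cancel-≤ c 0<c = ℚ.*-cancelˡ-≤-pos c {{ℚ.positive 0<c}}

  0≤ι : ∀ n → 0ℚ ≤ ι n
  0≤ι zero    = ℚ.≤-refl
  0≤ι (suc n) = 0≤+ 0≤1 (0≤ι n)

  0<ι : ∀ {n} → 0 ℕ.< n → 0ℚ < ι n
  0<ι {suc n} _ = ℚ.<-≤-trans (ℚ.*<* (ℤ.+<+ (ℕ.s≤s ℕ.z≤n)))
    (≤-by {1ℚ} (ι n) (0≤ι n) refl)

  ι-+ : ∀ m n → ι (m ℕ.+ n) ≡ ι m + ι n
  ι-+ zero    n = sym (ℚ.+-identityˡ (ι n))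
  ι-+ (suc m) n = trans (cong (1ℚ +_) (ι-+ m n)) (sym (ℚ.+-assoc 1ℚ (ι m) (ι n)))

  ι-* : ∀ m n → ι (m ℕ.* n) ≡ ι m * ι n
  ι-* zero    n = sym (ℚ.*-zeroˡ (ι n))
  ι-* (suc m) n = begin-equality
    ι (n ℕ.+ m ℕ.* n)   ≡⟨ ι-+ n (m ℕ.* n) ⟩
    ι n + ι (m ℕ.* n)   ≡⟨ cong (ι n +_) (ι-* m n) ⟩
    ι n + ι m * ι n     ≡⟨ lem (ι n) (ι m) ⟩
    (1ℚ + ι m) * ι n    ∎
    where
    lem : ∀ a b → a + b * a ≡ (1ℚ + b) * a
    lem = solve-∀ ℚ-ring

  ι-^ : ∀ m n → ι (m ℕ.^ n) ≡ ι m ^ n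
  ι-^ m zero    = refl
  ι-^ m (suc n) = trans (ι-* m (m ℕ.^ n)) (cong (ι m *_) (ι-^ m n))

  ι-mono : ∀ {m n} → m ℕ.≤ n → ι m ≤ ι n
  ι-mono {n = n} ℕ.z≤n = 0≤ι n
  ι-mono (ℕ.s≤s m≤n)   = ℚ.+-monoʳ-≤ 1ℚ (ι-mono m≤n)

  1≤ι : ∀ {n} → 1 ℕ.≤ n → 1ℚ ≤ ι n
  1≤ι = ι-mono

  inverse : ∀ n → 0 ℕ.< n → ∃[ r ] (ι n * r ≡ 1ℚ × 0ℚ ≤ r)
  inverse n 0<n = (ℚ.1/ ι n) {{nz}} , ℚ.*-inverseʳ (ι n) {{nz}} ,
    ℚ.<⇒≤ (ℚ.positive⁻¹ _ {{ℚ.1/pos⇒pos (ι n) {{ℚ.positive (0<ι 0<n)}}}})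
    where nz = ℚ.pos⇒nonZero (ι n) {{ℚ.positive (0<ι 0<n)}}

  0≤^ : ∀ {a} n → 0ℚ ≤ a → 0ℚ ≤ a ^ n
  0≤^ zero    0≤a = 0≤1
  0≤^ (suc n) 0≤a = 0≤* 0≤a (0≤^ n 0≤a)

  ^-mono : ∀ {a b} n → 0ℚ ≤ a → a ≤ b → a ^ n ≤ b ^ n
  ^-mono zero    0≤a a≤b = ℚ.≤-refl
  ^-mono (suc n) 0≤a a≤b = *-mono 0≤a (0≤^ n (ℚ.≤-trans 0≤a a≤b)) a≤b (^-mono n 0≤a a≤b)

  1^ : ∀ n → 1ℚ ^ n ≡ 1ℚ
  1^ zero    = refl
  1^ (suc n) = trans (ℚ.*-identityˡ _) (1^ n)

  1≤^ : ∀ {a} n → 1ℚ ≤ a → 1ℚ ≤ a ^ n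
  1≤^ {a} n 1≤a = begin
    1ℚ     ≡⟨ 1^ n ⟨
    1ℚ ^ n ≤⟨ ^-mono n 0≤1 1≤a ⟩
    a ^ n  ∎

  ^≤1 : ∀ {a} n → 0ℚ ≤ a → a ≤ 1ℚ → a ^ n ≤ 1ℚ
  ^≤1 {a} n 0≤a a≤1 = begin
    a ^ n  ≤⟨ ^-mono n 0≤a a≤1 ⟩
    1ℚ ^ n ≡⟨ 1^ n ⟩
    1ℚ     ∎

  ^-antitone : ∀ {a m n} → 0ℚ ≤ a → a ≤ 1ℚ → m ℕ.≤ n → a ^ n ≤ a ^ m
  ^-antitone {a} {m} {n} 0≤a a≤1 m≤n = begin
    a ^ n                   ≡⟨ cong (a ^_) (ℕ.m+[n∸m]≡n m≤n) ⟨
    a ^ (m ℕ.+ (n ℕ.∸ m))   ≡⟨ ^-homo-* a m (n ℕ.∸ m) ⟩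
    a ^ m * a ^ (n ℕ.∸ m)   ≤⟨ *-monoʳ (0≤^ m 0≤a) (^≤1 (n ℕ.∸ m) 0≤a a≤1) ⟩
    a ^ m * 1ℚ              ≡⟨ ℚ.*-identityʳ (a ^ m) ⟩
    a ^ m                   ∎

  ^-monotone : ∀ {a m n} → 1ℚ ≤ a → m ℕ.≤ n → a ^ m ≤ a ^ n
  ^-monotone {a} {m} {n} 1≤a m≤n = begin
    a ^ m                   ≡⟨ ℚ.*-identityʳ (a ^ m) ⟨
    a ^ m * 1ℚ              ≤⟨ *-monoʳ (0≤^ m (ℚ.≤-trans 0≤1 1≤a)) (1≤^ (n ℕ.∸ m) 1≤a) ⟩
    a ^ m * a ^ (n ℕ.∸ m)   ≡⟨ ^-homo-* a m (n ℕ.∸ m) ⟨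
    a ^ (m ℕ.+ (n ℕ.∸ m))   ≡⟨ cong (a ^_) (ℕ.m+[n∸m]≡n m≤n) ⟩
    a ^ n                   ∎

  bernoulli : ∀ u n → 0ℚ ≤ u → u ≤ 1ℚ → 1ℚ - ι n * u ≤ (1ℚ - u) ^ n
  bernoulli u zero    0≤u u≤1 = ℚ.≤-reflexive (lem u)
    where
    lem : ∀ u → 1ℚ - 0ℚ * u ≡ 1ℚ
    lem = solve-∀ ℚ-ring
  bernoulli u (suc n) 0≤u u≤1 = begin
    1ℚ - (1ℚ + ι n) * u        ≤⟨ ≤-by (ι n * (u * u)) (0≤* (0≤ι n) (0≤* 0≤u 0≤u)) (lem u (ι n)) ⟩
    (1ℚ - u) * (1ℚ - ι n * u)  ≤⟨ *-monoʳ (a≤b⇒0≤b-a u≤1) (bernoulli u n 0≤u u≤1) ⟩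
    (1ℚ - u) * (1ℚ - u) ^ n    ∎
    where
    lem : ∀ u k → 1ℚ - (1ℚ + k) * u + k * (u * u) ≡ (1ℚ - u) * (1ℚ - k * u)
    lem = solve-∀ ℚ-ring

  -- Bernoulli's inequality for 1 + u/v, homogenised so that no division by `v` occurs.
  bernoulli⁺ : ∀ u v n → 0ℚ ≤ u → 0ℚ ≤ v → v ^ n * (v + ι (suc n) * u) ≤ (v + u) ^ suc n
  bernoulli⁺ u v zero    0≤u 0≤v = ℚ.≤-reflexive (lem u v)
    where
    lem : ∀ u v → 1ℚ * (v + (1ℚ + 0ℚ) * u) ≡ (v + u) * 1ℚ
    lem = solve-∀ ℚ-ring
  bernoulli⁺ u v (suc n) 0≤u 0≤v = begin
    (v * v ^ n) * (v + (1ℚ + ι (suc n)) * u)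
      ≤⟨ ≤-by (u * (v ^ n * (ι (suc n) * u)))
           (0≤* 0≤u (0≤* (0≤^ n 0≤v) (0≤* (0≤ι (suc n)) 0≤u))) (lem u v (v ^ n) (ι (suc n))) ⟩
    (v + u) * (v ^ n * (v + ι (suc n) * u))
      ≤⟨ *-monoʳ (0≤+ 0≤v 0≤u) (bernoulli⁺ u v n 0≤u 0≤v) ⟩
    (v + u) * (v + u) ^ suc n ∎
    where
    lem : ∀ u v p k → (v * p) * (v + (1ℚ + k) * u) + u * (p * (k * u)) ≡ (v + u) * (p * (v + k * u))
    lem = solve-∀ ℚ-ring

  -- Since (1 - v)(1 + v) ≤ 1, the power of 1 - v is at most the inverse of the Bernoulli bound for
  -- 1 + v; this upper bound stands in for exp(-nv).
  [1-v]^n[1+nv]≤1 : ∀ v n → 0ℚ ≤ v → v ≤ 1ℚ → (1ℚ - v) ^ n * (1ℚ + ι n * v) ≤ 1ℚ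
  [1-v]^n[1+nv]≤1 v zero    0≤v v≤1 = ℚ.≤-reflexive (lem v)
    where
    lem : ∀ v → 1ℚ * (1ℚ + 0ℚ * v) ≡ 1ℚ
    lem = solve-∀ ℚ-ring
  [1-v]^n[1+nv]≤1 v (suc n) 0≤v v≤1 = begin
    ((1ℚ - v) * p) * (1ℚ + (1ℚ + ι n) * v)
      ≤⟨ ≤-by (p * ((1ℚ + ι n) * (v * v)))
           (0≤* (0≤^ n (a≤b⇒0≤b-a v≤1)) (0≤* (0≤ι (suc n)) (0≤* 0≤v 0≤v))) (lem v p (ι n)) ⟩
    p * (1ℚ + ι n * v)
      ≤⟨ [1-v]^n[1+nv]≤1 v n 0≤v v≤1 ⟩
    1ℚ ∎
    where
    p = (1ℚ - v) ^ n
    lem : ∀ v p k → ((1ℚ - v) * p) * (1ℚ + (1ℚ + k) * v) + p * ((1ℚ + k) * (v * v)) ≡ p * (1ℚ + k * v)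
    lem = solve-∀ ℚ-ring

  2ℚ 3ℚ : ℚ
  2ℚ = ι 2
  3ℚ = ι 3

  ½^ : ℕ → ℚ
  ½^ n = ℚ.½ ^ n

  [1-1/n]^n≤½ : ∀ v n → 0ℚ ≤ v → v ≤ 1ℚ → 1ℚ ≤ ι n * v → (1ℚ - v) ^ n ≤ ℚ.½
  [1-1/n]^n≤½ v n 0≤v v≤1 1≤nv = *-cancel-≤ 2ℚ (0<ι {2} (ℕ.s≤s ℕ.z≤n)) (begin
    2ℚ * (1ℚ - v) ^ n               ≡⟨ ℚ.*-comm 2ℚ ((1ℚ - v) ^ n) ⟩
    (1ℚ - v) ^ n * (1ℚ + 1ℚ)        ≤⟨ *-monoʳ (0≤^ n (a≤b⇒0≤b-a v≤1)) (ℚ.+-monoʳ-≤ 1ℚ 1≤nv) ⟩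
    (1ℚ - v) ^ n * (1ℚ + ι n * v)   ≤⟨ [1-v]^n[1+nv]≤1 v n 0≤v v≤1 ⟩
    1ℚ                              ∎)

  -- The counterpart of exp(x) ≤ 1 + x + x² for 0 ≤ x ≤ 1; at x = 1 it yields the constant 3 in
  -- place of e.
  [1+v]^n≤1+nv+n²v² : ∀ v n → 0ℚ ≤ v → ι n * v ≤ 1ℚ →
    (1ℚ + v) ^ n ≤ 1ℚ + ι n * v + (ι n * v) * (ι n * v)
  [1+v]^n≤1+nv+n²v² v zero    0≤v nv≤1 = ℚ.≤-reflexive (lem v)
    where
    lem : ∀ v → 1ℚ ≡ 1ℚ + 0ℚ * v + (0ℚ * v) * (0ℚ * v)
    lem = solve-∀ ℚ-ring
  [1+v]^n≤1+nv+n²v² v (suc n) 0≤v nv≤1 = begin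
    (1ℚ + v) * (1ℚ + v) ^ n
      ≤⟨ *-monoʳ (0≤+ 0≤1 0≤v) ([1+v]^n≤1+nv+n²v² v n 0≤v nv≤1′) ⟩
    (1ℚ + v) * (1ℚ + k * v + (k * v) * (k * v))
      ≤⟨ ≤-by (v * v * (1ℚ + k * (1ℚ - k * v)))
           (0≤* (0≤* 0≤v 0≤v) (0≤+ 0≤1 (0≤* (0≤ι n) (a≤b⇒0≤b-a nv≤1′)))) (lem v k) ⟩
    1ℚ + (1ℚ + k) * v + ((1ℚ + k) * v) * ((1ℚ + k) * v) ∎
    where
    k = ι n
    nv≤1′ : ι n * v ≤ 1ℚ
    nv≤1′ = ℚ.≤-trans (*-monoˡ 0≤v (ι-mono (ℕ.n≤1+n n))) nv≤1
    lem : ∀ v k → (1ℚ + v) * (1ℚ + k * v + (k * v) * (k * v)) + v * v * (1ℚ + k * (1ℚ - k * v))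
                ≡ 1ℚ + (1ℚ + k) * v + ((1ℚ + k) * v) * ((1ℚ + k) * v)
    lem = solve-∀ ℚ-ring

  [1+v]^n≤3 : ∀ v n → 0ℚ ≤ v → ι n * v ≤ 1ℚ → (1ℚ + v) ^ n ≤ 3ℚ
  [1+v]^n≤3 v n 0≤v nv≤1 = begin
    (1ℚ + v) ^ n                                 ≤⟨ [1+v]^n≤1+nv+n²v² v n 0≤v nv≤1 ⟩
    1ℚ + ι n * v + (ι n * v) * (ι n * v)         ≤⟨ ℚ.+-mono-≤ (ℚ.+-monoʳ-≤ 1ℚ nv≤1)
                                                      (*-mono (0≤* (0≤ι n) 0≤v) 0≤1 nv≤1 nv≤1) ⟩
    3ℚ                                           ∎

-- Counting edges and non-edges

module _ where
  open Data.Nat using (_+_; _*_; _≤_; _<_; z≤n; s≤s)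
  open Sum ℕ.+-*-semiring public
    using (sum; sum-syntax; sum-cong-≗; ∑-distrib-+; ∑-comm; *-distribˡ-sum; *-distribʳ-sum; sum-replicate-zero)
  open ≡-Reasoning

  ⟦_⟧ : ∀ {p} {P : Set p} → Dec P → ℕ
  ⟦ P? ⟧ = if does P? then 1 else 0

  ⟦⟧-yes : ∀ {p} {P : Set p} (P? : Dec P) → P → ⟦ P? ⟧ ≡ 1
  ⟦⟧-yes (yes _) _ = refl
  ⟦⟧-yes (no ¬p) p = contradiction p ¬p

  ⟦⟧-no : ∀ {p} {P : Set p} (P? : Dec P) → ¬ P → ⟦ P? ⟧ ≡ 0
  ⟦⟧-no (yes p) ¬p = contradiction p ¬p
  ⟦⟧-no (no _)  _  = refl

  ⟦⟧≤1 : ∀ {p} {P : Set p} (P? : Dec P) → ⟦ P? ⟧ ≤ 1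
  ⟦⟧≤1 (yes _) = s≤s z≤n
  ⟦⟧≤1 (no _)  = z≤n

  ⟦⟧-mono : ∀ {p q} {P : Set p} {Q : Set q} (P? : Dec P) (Q? : Dec Q) → (P → Q) → ⟦ P? ⟧ ≤ ⟦ Q? ⟧
  ⟦⟧-mono (yes p) (yes _) _ = s≤s z≤n
  ⟦⟧-mono (yes p) (no ¬q) f = contradiction (f p) ¬q
  ⟦⟧-mono (no _)  _       _ = z≤n

  ⟦⟧-cong : ∀ {p q} {P : Set p} {Q : Set q} (P? : Dec P) (Q? : Dec Q) → (P → Q) → (Q → P) → ⟦ P? ⟧ ≡ ⟦ Q? ⟧
  ⟦⟧-cong P? Q? f g = ℕ.≤-antisym (⟦⟧-mono P? Q? f) (⟦⟧-mono Q? P? g)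

  ⟦⟧-idem : ∀ {p} {P : Set p} (P? : Dec P) → ⟦ P? ⟧ * ⟦ P? ⟧ ≡ ⟦ P? ⟧
  ⟦⟧-idem (yes _) = refl
  ⟦⟧-idem (no _)  = refl

  ⟦⟧-¬ : ∀ {p} {P : Set p} (P? : Dec P) → ⟦ ¬? P? ⟧ + ⟦ P? ⟧ ≡ 1
  ⟦⟧-¬ (yes _) = refl
  ⟦⟧-¬ (no _)  = refl

  ∑-mono : ∀ {n} {f g : Fin n → ℕ} → (∀ i → f i ≤ g i) → sum f ≤ sum g
  ∑-mono {zero}  f≤g = z≤n
  ∑-mono {suc n} f≤g = ℕ.+-mono-≤ (f≤g zero) (∑-mono (f≤g ∘ suc))

  ∑-zero : ∀ {n} {f : Fin n → ℕ} → (∀ i → f i ≡ 0) → sum f ≡ 0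
  ∑-zero {n} f≡0 = trans (sum-cong-≗ f≡0) (sum-replicate-zero n)

  ∑-1 : ∀ n → ∑[ i < n ] 1 ≡ n
  ∑-1 zero    = refl
  ∑-1 (suc n) = cong suc (∑-1 n)

  ∑-const : ∀ n c → ∑[ i < n ] c ≡ n * c
  ∑-const zero    c = refl
  ∑-const (suc n) c = cong (λ k → c + k) (∑-const n c)

  term≤∑ : ∀ {n} (f : Fin n → ℕ) i → f i ≤ sum f
  term≤∑ f zero    = ℕ.m≤m+n (f zero) _
  term≤∑ f (suc i) = ℕ.≤-trans (term≤∑ (f ∘ suc) i) (ℕ.m≤n+m _ (f zero))

  ∑-δ : ∀ {n} (a : Fin n) (f : Fin n → ℕ) → ∑[ u < n ] (⟦ u Fin.≟ a ⟧ * f u) ≡ f a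
  ∑-δ {suc n} zero f = begin
    f zero + 0 + ∑[ u < n ] 0 ≡⟨ cong₂ _+_ (ℕ.+-identityʳ (f zero)) (sum-replicate-zero n) ⟩
    f zero + 0                ≡⟨ ℕ.+-identityʳ (f zero) ⟩
    f zero                    ∎
  ∑-δ {suc n} (suc a) f = trans (sum-cong-≗ lem) (∑-δ a (f ∘ suc))
    where
    lem : ∀ u → ⟦ Fin.suc u Fin.≟ suc a ⟧ * f (suc u) ≡ ⟦ u Fin.≟ a ⟧ * f (suc u)
    lem u = cong (λ k → k * f (suc u))
      (⟦⟧-cong (Fin.suc u Fin.≟ suc a) (u Fin.≟ a) Fin.suc-injective (cong suc))

  ∑² : ∀ {n} → (Fin n → Fin n → ℕ) → ℕ
  ∑² {n} χ = ∑[ u < n ] (∑[ v < n ] χ u v)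

  ∑²-cong : ∀ {n} {χ ψ : Fin n → Fin n → ℕ} → (∀ u v → χ u v ≡ ψ u v) → ∑² χ ≡ ∑² ψ
  ∑²-cong eq = sum-cong-≗ (λ u → sum-cong-≗ (eq u))

  ∑²-mono : ∀ {n} {χ ψ : Fin n → Fin n → ℕ} → (∀ u v → χ u v ≤ ψ u v) → ∑² χ ≤ ∑² ψ
  ∑²-mono le = ∑-mono (λ u → ∑-mono (le u))

  ∑²-+ : ∀ {n} (χ ψ : Fin n → Fin n → ℕ) → ∑² (λ u v → χ u v + ψ u v) ≡ ∑² χ + ∑² ψ
  ∑²-+ χ ψ = trans (sum-cong-≗ (λ u → ∑-distrib-+ (χ u) (ψ u))) (∑-distrib-+ (sum ∘ χ) (sum ∘ ψ))

  ∑²-δ : ∀ {n} (a b : Fin n) (χ : Fin n → Fin n → ℕ) →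
    ∑² (λ u v → χ u v * (⟦ u Fin.≟ a ⟧ * ⟦ v Fin.≟ b ⟧)) ≡ χ a b
  ∑²-δ {n} a b χ = begin
    ∑² (λ u v → χ u v * (⟦ u Fin.≟ a ⟧ * ⟦ v Fin.≟ b ⟧))
      ≡⟨ ∑²-cong (λ u v → lem (χ u v) ⟦ u Fin.≟ a ⟧ ⟦ v Fin.≟ b ⟧) ⟩
    ∑² (λ u v → ⟦ u Fin.≟ a ⟧ * (⟦ v Fin.≟ b ⟧ * χ u v))
      ≡⟨ sum-cong-≗ (λ u → *-distribˡ-sum ⟦ u Fin.≟ a ⟧ (λ v → ⟦ v Fin.≟ b ⟧ * χ u v)) ⟨
    ∑[ u < n ] (⟦ u Fin.≟ a ⟧ * ∑[ v < n ] (⟦ v Fin.≟ b ⟧ * χ u v))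
      ≡⟨ ∑-δ a (λ u → ∑[ v < n ] (⟦ v Fin.≟ b ⟧ * χ u v)) ⟩
    ∑[ v < n ] (⟦ v Fin.≟ b ⟧ * χ a v)
      ≡⟨ ∑-δ b (χ a) ⟩
    χ a b ∎
    where
    lem : ∀ x p q → x * (p * q) ≡ p * (q * x)
    lem = ℕ-solve

  ∑²-diag : ∀ {n} (χ : Fin n → Fin n → ℕ) → ∑² (λ u v → ⟦ v Fin.≟ u ⟧ * χ u v) ≡ ∑[ u < n ] (χ u u)
  ∑²-diag χ = sum-cong-≗ (λ u → ∑-δ u (χ u))

  ∑ᴸ : ∀ {a} {A : Set a} → List A → (A → ℕ) → ℕ
  ∑ᴸ xs f = List.foldr (λ x s → f x + s) 0 xs

  ∑ᴸ-++ : ∀ {a} {A : Set a} (xs ys : List A) f → ∑ᴸ (xs List.++ ys) f ≡ ∑ᴸ xs f + ∑ᴸ ys f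
  ∑ᴸ-++ []       ys f = refl
  ∑ᴸ-++ (x ∷ xs) ys f = trans (cong (λ k → f x + k) (∑ᴸ-++ xs ys f)) (sym (ℕ.+-assoc (f x) _ _))

  ∑ᴸ-map : ∀ {a} {A : Set a} {b} {B : Set b} (h : B → A) (xs : List B) f → ∑ᴸ (List.map h xs) f ≡ ∑ᴸ xs (f ∘ h)
  ∑ᴸ-map h []       f = refl
  ∑ᴸ-map h (x ∷ xs) f = cong (λ k → f (h x) + k) (∑ᴸ-map h xs f)

  module _ {a} {A : Set a} where

    ∑ᴸ-cong : ∀ (xs : List A) {f g : A → ℕ} → (∀ x → f x ≡ g x) → ∑ᴸ xs f ≡ ∑ᴸ xs g
    ∑ᴸ-cong []       eq = refl
    ∑ᴸ-cong (x ∷ xs) eq = cong₂ _+_ (eq x) (∑ᴸ-cong xs eq)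

    ∑ᴸ-filter : ∀ {p} {P : A → Set p} (P? : ∀ x → Dec (P x)) (xs : List A) f →
      ∑ᴸ (List.filter P? xs) f ≡ ∑ᴸ xs (λ x → ⟦ P? x ⟧ * f x)
    ∑ᴸ-filter P? []       f = refl
    ∑ᴸ-filter P? (x ∷ xs) f with P? x
    ... | true  because _ = cong₂ _+_ (sym (ℕ.+-identityʳ (f x))) (∑ᴸ-filter P? xs f)
    ... | false because _ = ∑ᴸ-filter P? xs f

    ∑ᴸ-mapMaybe : ∀ {b} {B : Set b} (h : B → Maybe A) (xs : List B) f →
      ∑ᴸ (List.mapMaybe h xs) f ≡ ∑ᴸ xs (λ x → maybe′ f 0 (h x))
    ∑ᴸ-mapMaybe h []       f = refl
    ∑ᴸ-mapMaybe h (x ∷ xs) f with h x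
    ... | just y  = cong (λ k → f y + k) (∑ᴸ-mapMaybe h xs f)
    ... | nothing = ∑ᴸ-mapMaybe h xs f

    ∑ᴸ-tabulate : ∀ n (h : Fin n → A) f → ∑ᴸ (List.tabulate h) f ≡ ∑[ i < n ] f (h i)
    ∑ᴸ-tabulate zero    h f = refl
    ∑ᴸ-tabulate (suc n) h f = cong (λ k → f (h zero) + k) (∑ᴸ-tabulate n (h ∘ suc) f)

    ∑ᴸ-cartesianProduct : ∀ {b} {B : Set b} (xs : List A) (ys : List B) f →
      ∑ᴸ (List.cartesianProduct xs ys) f ≡ ∑ᴸ xs (λ x → ∑ᴸ ys (λ y → f (x , y)))
    ∑ᴸ-cartesianProduct []       ys f = refl
    ∑ᴸ-cartesianProduct (x ∷ xs) ys f = trans (∑ᴸ-++ (List.map (x ,_) ys) _ f)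
      (cong₂ _+_ (∑ᴸ-map (x ,_) ys f) (∑ᴸ-cartesianProduct xs ys f))

    length-∑ᴸ : (xs : List A) → ∑ᴸ xs (λ _ → 1) ≡ length xs
    length-∑ᴸ []       = refl
    length-∑ᴸ (x ∷ xs) = cong suc (length-∑ᴸ xs)

-- Adjacency counts, non-edges and degrees

module _ where
  open Data.Nat using (_+_; _*_; _≤_; _<_; z≤n; s≤s)
  open ≡-Reasoning

  adj : ∀ {n} → Graph n → Fin n → Fin n → ℕ
  adj G u v = ⟦ SimpleGraph._~?_ G u v ⟧

  -- Ordered pairs are counted. With χ the indicator of W × W every edge inside W counts twice, with
  -- χ that of W × ∁W every edge of the cut counts once.
  cnt : ∀ {n} → (Fin n → Fin n → ℕ) → Graph n → ℕ
  cnt χ G = ∑² (λ u v → χ u v * adj G u v)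

  endpoints : ∀ {n} {A : Set} → (Fin n → Fin n → A) → Pair n → A
  endpoints χ ((u , v) , _) = χ u v

  sym-sum : ∀ {n} → (Fin n → Fin n → ℕ) → Pair n → ℕ
  sym-sum χ ((u , v) , _) = χ u v + χ v u

  2*nC2+n≡n² : ∀ n → 2 * (n C 2) + n ≡ n * n
  2*nC2+n≡n² zero    = refl
  2*nC2+n≡n² (suc n) = begin
    2 * (suc n C 2) + suc n     ≡⟨ cong (λ k → 2 * k + suc n) (nCk+nC[k+1]≡[n+1]C[k+1] n 1) ⟨
    2 * (n C 1 + n C 2) + suc n ≡⟨ cong (λ k → 2 * (k + n C 2) + suc n) (nC1≡n n) ⟩
    2 * (n + n C 2) + suc n     ≡⟨ lem n (n C 2) ⟩
    2 * (n C 2) + n + (2 * n + 1) ≡⟨ cong (λ k → k + (2 * n + 1)) (2*nC2+n≡n² n) ⟩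
    n * n + (2 * n + 1)         ≡⟨ lem′ n ⟩
    suc n * suc n               ∎
    where
    lem : ∀ n c → 2 * (n + c) + suc n ≡ 2 * c + n + (2 * n + 1)
    lem = ℕ-solve
    lem′ : ∀ n → n * n + (2 * n + 1) ≡ suc n * suc n
    lem′ = ℕ-solve

  ∑-pairs : ∀ n (g : Fin n → Fin n → ℕ) →
    ∑ᴸ (pairs n) (endpoints g) ≡ ∑² (λ u v → ⟦ u Fin.<? v ⟧ * g u v)
  ∑-pairs n g = begin
    ∑ᴸ (pairs n) (endpoints g)
      ≡⟨ ∑ᴸ-mapMaybe pair? (List.cartesianProduct (List.allFin n) (List.allFin n)) (endpoints g) ⟩
    ∑ᴸ (List.cartesianProduct (List.allFin n) (List.allFin n)) (λ p → maybe′ (endpoints g) 0 (pair? p))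
      ≡⟨ ∑ᴸ-cong (List.cartesianProduct (List.allFin n) (List.allFin n)) value ⟩
    ∑ᴸ (List.cartesianProduct (List.allFin n) (List.allFin n)) (λ (u , v) → ⟦ u Fin.<? v ⟧ * g u v)
      ≡⟨ ∑ᴸ-cartesianProduct (List.allFin n) (List.allFin n) (λ (u , v) → ⟦ u Fin.<? v ⟧ * g u v) ⟩
    ∑ᴸ (List.allFin n) (λ u → ∑ᴸ (List.allFin n) (λ v → ⟦ u Fin.<? v ⟧ * g u v))
      ≡⟨ ∑ᴸ-tabulate n id _ ⟩
    ∑[ u < n ] ∑ᴸ (List.allFin n) (λ v → ⟦ u Fin.<? v ⟧ * g u v)
      ≡⟨ sum-cong-≗ (λ u → ∑ᴸ-tabulate n id (λ v → ⟦ u Fin.<? v ⟧ * g u v)) ⟩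
    ∑² (λ u v → ⟦ u Fin.<? v ⟧ * g u v) ∎
    where
    pair? : Fin n × Fin n → Maybe (Pair n)
    pair? (u , v) = Maybe.map ((u , v) ,_) (dec⇒maybe (u Fin.<? v))
    value : ∀ p → maybe′ (endpoints g) 0 (pair? p) ≡ ⟦ proj₁ p Fin.<? proj₂ p ⟧ * g (proj₁ p) (proj₂ p)
    value (u , v) = by-cases (u Fin.<? v)
      where
      by-cases : (d : Dec (u Fin.< v)) →
        maybe′ (endpoints g) 0 (Maybe.map ((u , v) ,_) (dec⇒maybe d)) ≡ ⟦ d ⟧ * g u v
      by-cases (yes _) = sym (ℕ.+-identityʳ (g u v))
      by-cases (no _)  = refl

  module _ {n} (G : Graph n) where
    open SimpleGraph G

    adj-irrefl : ∀ u → adj G u u ≡ 0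
    adj-irrefl u = ⟦⟧-no (u ~? u) (irrefl refl)

    nonadj : Fin n → Fin n → ℕ
    nonadj u v = ⟦ ¬? (u ~? v) ⟧

    nonadj-sym : ∀ u v → nonadj u v ≡ nonadj v u
    nonadj-sym u v = ⟦⟧-cong (¬? (u ~? v)) (¬? (v ~? u)) (λ p → p ∘ symm) (λ p → p ∘ symm)

    nonadj+adj : ∀ u v → nonadj u v + adj G u v ≡ 1
    nonadj+adj u v with u ~? v
    ... | yes _ = refl
    ... | no _  = refl

    ∑-nonEdges : (g : Fin n → Fin n → ℕ) →
      ∑ᴸ (nonEdges G) (endpoints g) ≡ ∑² (λ u v → ⟦ u Fin.<? v ⟧ * (nonadj u v * g u v))
    ∑-nonEdges g = trans (∑ᴸ-filter _ (pairs n) (endpoints g))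
      (∑-pairs n (λ u v → nonadj u v * g u v))

    -- Every ordered pair is a diagonal pair, an adjacent pair, or one of the two orders of exactly
    -- one listed non-edge. All later counts are instances: χ = 1 gives the number of non-edges, a
    -- cut gives the crossing pairs still available, and an indicator of one vertex gives the
    -- non-edges at it.
    ∑-nonEdges-sym : (χ : Fin n → Fin n → ℕ) →
      ∑ᴸ (nonEdges G) (sym-sum χ) + cnt χ G + ∑[ u < n ] (χ u u) ≡ ∑² χ
    ∑-nonEdges-sym χ = begin
      ∑ᴸ (nonEdges G) (sym-sum χ) + cnt χ G + ∑[ u < n ] (χ u u)
        ≡⟨ cong₂ (λ a b → a + cnt χ G + b) (∑-nonEdges (λ u v → χ u v + χ v u)) (sym (∑²-diag χ)) ⟩
      ∑² (λ u v → ⟦ u Fin.<? v ⟧ * (nonadj u v * (χ u v + χ v u))) + cnt χ G + ∑² diag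
        ≡⟨ cong (λ a → a + cnt χ G + ∑² diag) (trans (∑²-cong split) (∑²-+ lower upper)) ⟩
      ∑² lower + ∑² upper + cnt χ G + ∑² diag
        ≡⟨ cong (λ a → ∑² lower + a + cnt χ G + ∑² diag) (∑-comm upper) ⟩
      ∑² lower + ∑² (λ u v → upper v u) + cnt χ G + ∑² diag
        ≡⟨ cong (λ a → a + cnt χ G + ∑² diag) (∑²-+ lower (λ u v → upper v u)) ⟨
      ∑² (λ u v → lower u v + upper v u) + cnt χ G + ∑² diag
        ≡⟨ cong (λ a → a + ∑² diag) (∑²-+ (λ u v → lower u v + upper v u) (λ u v → χ u v * adj G u v)) ⟨
      ∑² (λ u v → lower u v + upper v u + χ u v * adj G u v) + ∑² diag
        ≡⟨ ∑²-+ (λ u v → lower u v + upper v u + χ u v * adj G u v) diag ⟨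
      ∑² (λ u v → lower u v + upper v u + χ u v * adj G u v + diag u v)
        ≡⟨ ∑²-cong pointwise ⟩
      ∑² χ ∎
      where
      lower upper diag : Fin n → Fin n → ℕ
      lower u v = ⟦ u Fin.<? v ⟧ * (nonadj u v * χ u v)
      upper u v = ⟦ u Fin.<? v ⟧ * (nonadj u v * χ v u)
      diag  u v = ⟦ v Fin.≟ u ⟧ * χ u v
      split : ∀ u v → ⟦ u Fin.<? v ⟧ * (nonadj u v * (χ u v + χ v u)) ≡ lower u v + upper u v
      split u v = lem ⟦ u Fin.<? v ⟧ (nonadj u v) (χ u v) (χ v u)
        where
        lem : ∀ a b c d → a * (b * (c + d)) ≡ a * (b * c) + a * (b * d)
        lem = ℕ-solve
      collect : ∀ a a′ b c d x → a * (b * x) + a′ * (b * x) + x * c + d * x ≡ ((a + a′) * b + c + d) * x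
      collect = ℕ-solve
      one : ∀ u v → (⟦ u Fin.<? v ⟧ + ⟦ v Fin.<? u ⟧) * nonadj u v + adj G u v + ⟦ v Fin.≟ u ⟧ ≡ 1
      one u v with Fin.<-cmp u v
      ... | tri< u<v u≢v v≮u
        rewrite ⟦⟧-yes (u Fin.<? v) u<v | ⟦⟧-no (v Fin.<? u) v≮u | ⟦⟧-no (v Fin.≟ u) (u≢v ∘ sym)
        = trans (ℕ.+-identityʳ _) (trans (cong (λ k → k + adj G u v) (ℕ.*-identityˡ (nonadj u v))) (nonadj+adj u v))
      ... | tri> u≮v u≢v v<u
        rewrite ⟦⟧-no (u Fin.<? v) u≮v | ⟦⟧-yes (v Fin.<? u) v<u | ⟦⟧-no (v Fin.≟ u) (u≢v ∘ sym)
        = trans (ℕ.+-identityʳ _) (trans (cong (λ k → k + adj G u v) (ℕ.*-identityˡ (nonadj u v))) (nonadj+adj u v))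
      ... | tri≈ u≮u refl _
        rewrite ⟦⟧-no (u Fin.<? u) u≮u | ⟦⟧-yes (u Fin.≟ u) refl | adj-irrefl u
        = refl
      pointwise : ∀ u v → lower u v + upper v u + χ u v * adj G u v + diag u v ≡ χ u v
      pointwise u v = begin
        lower u v + upper v u + χ u v * adj G u v + diag u v
          ≡⟨ cong (λ k → lower u v + ⟦ v Fin.<? u ⟧ * (k * χ u v) + χ u v * adj G u v + diag u v) (nonadj-sym v u) ⟩
        lower u v + ⟦ v Fin.<? u ⟧ * (nonadj u v * χ u v) + χ u v * adj G u v + diag u v
          ≡⟨ collect ⟦ u Fin.<? v ⟧ ⟦ v Fin.<? u ⟧ (nonadj u v) (adj G u v) ⟦ v Fin.≟ u ⟧ (χ u v) ⟩
        ((⟦ u Fin.<? v ⟧ + ⟦ v Fin.<? u ⟧) * nonadj u v + adj G u v + ⟦ v Fin.≟ u ⟧) * χ u v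
          ≡⟨ cong (λ k → k * χ u v) (one u v) ⟩
        1 * χ u v
          ≡⟨ ℕ.*-identityˡ (χ u v) ⟩
        χ u v ∎

    #nonEdges : ℕ
    #nonEdges = length (nonEdges G)

    2#nonEdges : 2 * #nonEdges + cnt (λ _ _ → 1) G + n ≡ n * n
    2#nonEdges = begin
      2 * #nonEdges + cnt (λ _ _ → 1) G + n
        ≡⟨ cong₂ (λ a b → a + cnt (λ _ _ → 1) G + b) (double (nonEdges G)) (sym (∑-1 n)) ⟩
      ∑ᴸ (nonEdges G) (λ _ → 2) + cnt (λ _ _ → 1) G + ∑[ u < n ] 1
        ≡⟨ ∑-nonEdges-sym (λ _ _ → 1) ⟩
      ∑[ u < n ] (∑[ v < n ] 1)
        ≡⟨ sum-cong-≗ {n} (λ _ → ∑-1 n) ⟩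
      ∑[ u < n ] n
        ≡⟨ ∑-const n n ⟩
      n * n ∎
      where
      double : (xs : List (Pair n)) → 2 * length xs ≡ ∑ᴸ xs (λ _ → 2)
      double []       = refl
      double (x ∷ xs) = trans (ℕ.*-suc 2 (length xs)) (cong (2 +_) (double xs))

    #nonEdges≤nC2 : #nonEdges ≤ n C 2
    #nonEdges≤nC2 = ℕ.*-cancelˡ-≤ 2 (ℕ.+-cancelʳ-≤ n _ _ (ℕ.≤-trans
      (ℕ.+-monoˡ-≤ n (ℕ.m≤m+n (2 * #nonEdges) (cnt (λ _ _ → 1) G)))
      (ℕ.≤-reflexive (trans 2#nonEdges (sym (2*nC2+n≡n² n))))))

    nonEdge⇒≁ : ∀ {u v} {u<v : u Fin.< v} → ((u , v) , u<v) ∈ nonEdges G → ¬ (u ~ v)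
    nonEdge⇒≁ = proj₂ ∘ ∈.∈-filter⁻ _ {xs = pairs n}

  module _ {n} (G : Graph n) {a b : Fin n} (a<b : a Fin.< b) (a≁b : ¬ SimpleGraph._~_ G a b) where

    private
      e : Pair n
      e = (a , b) , a<b

    adj-addEdge : ∀ u v → adj (addEdge G e) u v ≡
      adj G u v + (⟦ u Fin.≟ a ⟧ * ⟦ v Fin.≟ b ⟧ + ⟦ u Fin.≟ b ⟧ * ⟦ v Fin.≟ a ⟧)
    adj-addEdge u v with SimpleGraph._~?_ G u v | u Fin.≟ a | v Fin.≟ b | u Fin.≟ b | v Fin.≟ a
    ... | yes u~v | yes refl | yes refl | _        | _        = contradiction u~v a≁b
    ... | yes u~v | _        | _        | yes refl | yes refl = contradiction (SimpleGraph.symm G u~v) a≁b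
    ... | no _    | yes refl | yes refl | yes refl | _        = contradiction refl (Fin.<⇒≢ a<b)
    ... | no _    | yes refl | yes refl | no _     | _        = refl
    ... | no _    | yes refl | no _     | yes refl | _        = contradiction refl (Fin.<⇒≢ a<b)
    ... | no _    | yes refl | no _     | no _     | _        = refl
    ... | no _    | no _     | _        | yes refl | yes refl = refl
    ... | no _    | no _     | _        | yes refl | no _     = refl
    ... | no _    | no _     | _        | no _     | _        = refl
    ... | yes _   | no _     | _        | no _     | _        = refl
    ... | yes _   | no _     | _        | yes _    | no _     = refl
    ... | yes _   | yes _    | no _     | no _     | _        = refl
    ... | yes _   | yes _    | no _     | yes _    | no _     = refl

    cnt-addEdge : ∀ χ → cnt χ (addEdge G e) ≡ cnt χ G + (χ a b + χ b a)
    cnt-addEdge χ = begin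
      ∑² (λ u v → χ u v * adj (addEdge G e) u v)
        ≡⟨ ∑²-cong (λ u v → trans (cong (χ u v *_) (adj-addEdge u v)) (lem (χ u v) (adj G u v) _ _)) ⟩
      ∑² (λ u v → χ u v * adj G u v + (χ u v * (⟦ u Fin.≟ a ⟧ * ⟦ v Fin.≟ b ⟧) + χ u v * (⟦ u Fin.≟ b ⟧ * ⟦ v Fin.≟ a ⟧)))
        ≡⟨ trans (∑²-+ (λ u v → χ u v * adj G u v) _)
             (cong (λ k → cnt χ G + k) (∑²-+ (λ u v → χ u v * (⟦ u Fin.≟ a ⟧ * ⟦ v Fin.≟ b ⟧)) _)) ⟩
      cnt χ G + (∑² (λ u v → χ u v * (⟦ u Fin.≟ a ⟧ * ⟦ v Fin.≟ b ⟧)) + ∑² (λ u v → χ u v * (⟦ u Fin.≟ b ⟧ * ⟦ v Fin.≟ a ⟧)))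
        ≡⟨ cong (λ k → cnt χ G + k) (cong₂ _+_ (∑²-δ a b χ) (∑²-δ b a χ)) ⟩
      cnt χ G + (χ a b + χ b a) ∎
      where
      lem : ∀ x p q r → x * (p + (q + r)) ≡ x * p + (x * q + x * r)
      lem = ℕ-solve

    #nonEdges-addEdge : suc (#nonEdges (addEdge G e)) ≡ #nonEdges G
    #nonEdges-addEdge = ℕ.*-cancelˡ-≡ _ _ 2 (ℕ.+-cancelʳ-≡ (cnt (λ _ _ → 1) G + n) _ _ (begin
      2 * suc M′ + (cnt (λ _ _ → 1) G + n)        ≡⟨ lem M′ (cnt (λ _ _ → 1) G) n ⟩
      2 * M′ + (cnt (λ _ _ → 1) G + 2) + n        ≡⟨ cong (λ k → 2 * M′ + k + n) (cnt-addEdge (λ _ _ → 1)) ⟨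
      2 * M′ + cnt (λ _ _ → 1) (addEdge G e) + n  ≡⟨ 2#nonEdges (addEdge G e) ⟩
      n * n                                       ≡⟨ 2#nonEdges G ⟨
      2 * #nonEdges G + cnt (λ _ _ → 1) G + n     ≡⟨ ℕ.+-assoc (2 * #nonEdges G) _ n ⟩
      2 * #nonEdges G + (cnt (λ _ _ → 1) G + n)   ∎))
      where
      M′ = #nonEdges (addEdge G e)
      lem : ∀ m c n → 2 * suc m + (c + n) ≡ 2 * m + (c + 2) + n
      lem = ℕ-solve

  cnt-empty : ∀ {n} χ → cnt χ (emptyGraph n) ≡ 0
  cnt-empty χ = ∑-zero (λ u → ∑-zero (λ v → ℕ.*-zeroʳ (χ u v)))

  #nonEdges-empty : ∀ n → #nonEdges (emptyGraph n) ≡ n C 2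
  #nonEdges-empty n = ℕ.*-cancelˡ-≡ _ _ 2 (ℕ.+-cancelʳ-≡ n _ _ (begin
    2 * M + n                                   ≡⟨ cong (λ k → k + n) (ℕ.+-identityʳ (2 * M)) ⟨
    2 * M + 0 + n                               ≡⟨ cong (λ k → 2 * M + k + n) (cnt-empty {n} (λ _ _ → 1)) ⟨
    2 * M + cnt (λ _ _ → 1) (emptyGraph n) + n  ≡⟨ 2#nonEdges (emptyGraph n) ⟩
    n * n                                       ≡⟨ 2*nC2+n≡n² n ⟨
    2 * (n C 2) + n                             ∎))
    where M = #nonEdges (emptyGraph n)

  deg : ∀ {n} → Graph n → Fin n → ℕ
  deg {n} G v = ∑[ w < n ] (adj G v w)

  degree≡deg : ∀ {n} (G : Graph n) v → degree G v ≡ deg G v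
  degree≡deg {n} G v = begin
    degree G v
      ≡⟨ length-∑ᴸ (List.filter (SimpleGraph._~?_ G v) (List.allFin n)) ⟨
    ∑ᴸ (List.filter (SimpleGraph._~?_ G v) (List.allFin n)) (λ _ → 1)
      ≡⟨ ∑ᴸ-filter (SimpleGraph._~?_ G v) (List.allFin n) (λ _ → 1) ⟩
    ∑ᴸ (List.allFin n) (λ w → adj G v w * 1)
      ≡⟨ ∑ᴸ-tabulate n id (λ w → adj G v w * 1) ⟩
    ∑[ w < n ] (adj G v w * 1)
      ≡⟨ sum-cong-≗ (λ w → ℕ.*-identityʳ (adj G v w)) ⟩
    deg G v ∎

  δ≥⇒deg≥ : ∀ {n} (G : Graph n) {d} → d ≤ δ G → ∀ v → d ≤ deg G v
  δ≥⇒deg≥ {n} G {d} d≤δ v = ℕ.≤-trans d≤δ (ℕ.≤-trans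
    (All.lookup (min≤xs n (List.map (degree G) (List.allFin n))) (∈.∈-map⁺ (degree G) (∈.∈-allFin v)))
    (ℕ.≤-reflexive (degree≡deg G v)))

  deg≥⇒δ≥ : ∀ {n} (G : Graph n) {d} → d ≤ n → (∀ v → d ≤ deg G v) → d ≤ δ G
  deg≥⇒δ≥ {n} G {d} d≤n d≤deg = v≤min⁺ d≤n (All.map⁺ (All.tabulate {xs = List.allFin n}
    (λ {v} _ → ℕ.≤-trans (d≤deg v) (ℕ.≤-reflexive (sym (degree≡deg G v))))))

-- Expectations over the graph process

module _ where
  open Data.Rational using (_+_; _*_; _-_; -_; _≤_; _<_)
  open ℚ.≤-Reasoning

  ∑ℚ : ∀ {a} {A : Set a} → List A → (A → ℚ) → ℚ
  ∑ℚ []       f = 0ℚ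
  ∑ℚ (x ∷ xs) f = f x + ∑ℚ xs f

  module _ {a} {A : Set a} where

    ∑ℚ-mono : (xs : List A) {f g : A → ℚ} → (∀ x → x ∈ xs → f x ≤ g x) → ∑ℚ xs f ≤ ∑ℚ xs g
    ∑ℚ-mono []       f≤g = ℚ.≤-refl
    ∑ℚ-mono (x ∷ xs) f≤g = ℚ.+-mono-≤ (f≤g x (here refl)) (∑ℚ-mono xs (λ y y∈ → f≤g y (there y∈)))

    ∑ℚ-cong : (xs : List A) {f g : A → ℚ} → (∀ x → x ∈ xs → f x ≡ g x) → ∑ℚ xs f ≡ ∑ℚ xs g
    ∑ℚ-cong []       f≡g = refl
    ∑ℚ-cong (x ∷ xs) f≡g = cong₂ _+_ (f≡g x (here refl)) (∑ℚ-cong xs (λ y y∈ → f≡g y (there y∈)))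

    ∑ℚ-+ : (xs : List A) (f g : A → ℚ) → ∑ℚ xs (λ x → f x + g x) ≡ ∑ℚ xs f + ∑ℚ xs g
    ∑ℚ-+ []       f g = refl
    ∑ℚ-+ (x ∷ xs) f g = trans (cong (λ s → f x + g x + s) (∑ℚ-+ xs f g)) (lem (f x) (g x) _ _)
      where
      lem : ∀ a b c d → a + b + (c + d) ≡ a + c + (b + d)
      lem = solve-∀ ℚ-ring

    ∑ℚ-* : (xs : List A) (c : ℚ) (f : A → ℚ) → ∑ℚ xs (λ x → c * f x) ≡ c * ∑ℚ xs f
    ∑ℚ-* []       c f = sym (ℚ.*-zeroʳ c)
    ∑ℚ-* (x ∷ xs) c f = trans (cong (λ s → c * f x + s) (∑ℚ-* xs c f)) (sym (ℚ.*-distribˡ-+ c (f x) _))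

    ∑ℚ-const : (xs : List A) (c : ℚ) → ∑ℚ xs (λ _ → c) ≡ ι (length xs) * c
    ∑ℚ-const []       c = sym (ℚ.*-zeroˡ c)
    ∑ℚ-const (x ∷ xs) c = trans (cong (c +_) (∑ℚ-const xs c)) (lem c (ι (length xs)))
      where
      lem : ∀ c k → c + k * c ≡ (1ℚ + k) * c
      lem = solve-∀ ℚ-ring

    ∑ℚ-ι : (xs : List A) (f : A → ℕ) → ∑ℚ xs (ι ∘ f) ≡ ι (∑ᴸ xs f)
    ∑ℚ-ι []       f = refl
    ∑ℚ-ι (x ∷ xs) f = trans (cong (ι (f x) +_) (∑ℚ-ι xs f)) (sym (ι-+ (f x) _))

    ∑ℚ-nonneg : (xs : List A) {f : A → ℚ} → (∀ x → 0ℚ ≤ f x) → 0ℚ ≤ ∑ℚ xs f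
    ∑ℚ-nonneg []       0≤f = ℚ.≤-refl
    ∑ℚ-nonneg (x ∷ xs) 0≤f = 0≤+ (0≤f x) (∑ℚ-nonneg xs 0≤f)

    term≤∑ℚ : ∀ {xs : List A} {f : A → ℚ} → (∀ x → 0ℚ ≤ f x) → ∀ {x} → x ∈ xs → f x ≤ ∑ℚ xs f
    term≤∑ℚ {x ∷ xs} {f} 0≤f (here refl) = ≤-by (∑ℚ xs f) (∑ℚ-nonneg xs 0≤f) refl
    term≤∑ℚ {x ∷ xs} {f} 0≤f (there y∈)  =
      ℚ.≤-trans (term≤∑ℚ 0≤f y∈) (≤-by (f x) (0≤f x) (ℚ.+-comm (∑ℚ xs f) (f x)))

  recip : ℕ → ℚ
  recip m = ℤ.+ 1 ℚ./ suc m

  ι-recip : ∀ m → ι (suc m) * recip m ≡ 1ℚ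
  ι-recip m = ℚ.toℚᵘ-injective (ℚᵘ.≃-trans (ℚ.toℚᵘ-homo-* (ι (suc m)) (recip m))
    (ℚᵘ.≃-trans (ℚᵘ.*-cong (toℚᵘ-ι (suc m)) (ℚ.toℚᵘ-fromℚᵘ (ℚᵘ.mkℚᵘ (ℤ.+ 1) m)))
      (ℚᵘ.*≡* (cong ℤ.+_ (lem m)))))
    where
    lem : ∀ m → suc m ℕ.* 1 ℕ.* 1 ≡ 1 ℕ.* (1 ℕ.* suc m)
    lem = ℕ-solve
    toℚᵘ-ι : ∀ n → ℚ.toℚᵘ (ι n) ℚᵘ.≃ ℚᵘ.mkℚᵘ (ℤ.+ n) 0
    toℚᵘ-ι zero    = ℚᵘ.≃-refl
    toℚᵘ-ι (suc n) = ℚᵘ.≃-trans (ℚ.toℚᵘ-homo-+ 1ℚ (ι n))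
      (ℚᵘ.≃-trans (ℚᵘ.+-congʳ ℚᵘ.1ℚᵘ (toℚᵘ-ι n)) (ℚᵘ.*≡* (lem′ (ℤ.+ n))))
      where
      lem′ : ∀ z → (ℤ.+ 1 ℤ.* ℤ.+ 1 ℤ.+ z ℤ.* ℤ.+ 1) ℤ.* ℤ.+ 1 ≡ (ℤ.+ 1 ℤ.+ z) ℤ.* ℤ.+ 1
      lem′ = ℤ-solve

  0≤recip : ∀ m → 0ℚ ≤ recip m
  0≤recip m = ℚ.nonNegative⁻¹ (recip m) {{ℚ.normalize-nonNeg 1 (suc m)}}

  EX : ∀ {a} {A : Set a} → Dist A → (A → ℚ) → ℚ
  EX d f = ∑ℚ d (λ (p , x) → p * f x)

  indicator : Bool → ℚ
  indicator b = if b then 1ℚ else 0ℚ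

  Pr≡EX : ∀ {a} {A : Set a} (d : Dist A) (b : A → Bool) → Pr d b ≡ EX d (indicator ∘ b)
  Pr≡EX []            b = refl
  Pr≡EX ((p , x) ∷ d) b with b x
  ... | true  = cong₂ _+_ (sym (ℚ.*-identityʳ p)) (Pr≡EX d b)
  ... | false = trans (Pr≡EX d b) (trans (sym (ℚ.+-identityˡ _)) (cong (_+ EX d (indicator ∘ b)) (sym (ℚ.*-zeroʳ p))))

  ∑ℚ-++ : ∀ {a} {A : Set a} (xs ys : List A) f → ∑ℚ (xs List.++ ys) f ≡ ∑ℚ xs f + ∑ℚ ys f
  ∑ℚ-++ []       ys f = sym (ℚ.+-identityˡ _)
  ∑ℚ-++ (x ∷ xs) ys f = trans (cong (f x +_) (∑ℚ-++ xs ys f)) (sym (ℚ.+-assoc (f x) _ _))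

  ∑ℚ-map : ∀ {a b} {A : Set a} {B : Set b} (h : B → A) (xs : List B) f → ∑ℚ (List.map h xs) f ≡ ∑ℚ xs (f ∘ h)
  ∑ℚ-map h []       f = refl
  ∑ℚ-map h (x ∷ xs) f = cong (f (h x) +_) (∑ℚ-map h xs f)

  EX->>= : ∀ {a b} {A : Set a} {B : Set b} (d : Dist A) (f : A → Dist B) (g : B → ℚ) →
    EX (d >>= f) g ≡ EX d (λ x → EX (f x) g)
  EX->>= []            f g = refl
  EX->>= ((p , x) ∷ d) f g = trans (∑ℚ-++ (List.map scale (f x)) (d >>= f) value)
    (cong₂ _+_
      (trans (∑ℚ-map scale (f x) value)
        (trans (∑ℚ-cong (f x) (λ (q , y) _ → ℚ.*-assoc p q (g y))) (∑ℚ-* (f x) p value)))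
      (EX->>= d f g))
    where
    scale : ℚ × _ → ℚ × _
    scale (q , y) = p * q , y
    value : ℚ × _ → ℚ
    value (q , y) = q * g y

  EX-return : ∀ {a} {A : Set a} (x : A) (f : A → ℚ) → EX (return x) f ≡ f x
  EX-return x f = trans (ℚ.+-identityʳ _) (ℚ.*-identityˡ (f x))

  average : ∀ {a} {A : Set a} → List A → (A → ℚ) → ℚ
  average []          f = 0ℚ
  average (x ∷ xs)    f = recip (length xs) * ∑ℚ (x ∷ xs) f

  EX-uniform : ∀ {a} {A : Set a} (xs : List A) (f : A → ℚ) → EX (uniform xs) f ≡ average xs f
  EX-uniform []       f = refl
  EX-uniform (x ∷ xs) f = trans
    (∑ℚ-map (λ y → recip (length xs) , y) (x ∷ xs) (λ (p , y) → p * f y))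
    (∑ℚ-* (x ∷ xs) (recip (length xs)) f)

  module _ {a} {A : Set a} where

    average-mono : (xs : List A) {f g : A → ℚ} → (∀ x → x ∈ xs → f x ≤ g x) → average xs f ≤ average xs g
    average-mono []       f≤g = ℚ.≤-refl
    average-mono (x ∷ xs) f≤g = *-monoʳ (0≤recip (length xs)) (∑ℚ-mono (x ∷ xs) f≤g)

    average-cong : (xs : List A) {f g : A → ℚ} → (∀ x → x ∈ xs → f x ≡ g x) → average xs f ≡ average xs g
    average-cong []       f≡g = refl
    average-cong (x ∷ xs) f≡g = cong (recip (length xs) *_) (∑ℚ-cong (x ∷ xs) f≡g)

    average-+ : (xs : List A) (f g : A → ℚ) → average xs (λ x → f x + g x) ≡ average xs f + average xs g
    average-+ []       f g = refl
    average-+ (x ∷ xs) f g = trans (cong (recip (length xs) *_) (∑ℚ-+ (x ∷ xs) f g))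
      (ℚ.*-distribˡ-+ (recip (length xs)) (∑ℚ (x ∷ xs) f) (∑ℚ (x ∷ xs) g))

    average-* : (xs : List A) (c : ℚ) (f : A → ℚ) → average xs (λ x → c * f x) ≡ c * average xs f
    average-* []       c f = sym (ℚ.*-zeroʳ c)
    average-* (x ∷ xs) c f = trans (cong (recip (length xs) *_) (∑ℚ-* (x ∷ xs) c f))
      (lem (recip (length xs)) c (∑ℚ (x ∷ xs) f))
      where
      lem : ∀ r c s → r * (c * s) ≡ c * (r * s)
      lem = solve-∀ ℚ-ring

    average-const : (xs : List A) → 0 ℕ.< length xs → (c : ℚ) → average xs (λ _ → c) ≡ c
    average-const (x ∷ xs) _ c = begin-equality
      recip m * ∑ℚ (x ∷ xs) (λ _ → c)  ≡⟨ cong (recip m *_) (∑ℚ-const (x ∷ xs) c) ⟩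
      recip m * (ι (suc m) * c)        ≡⟨ lem (recip m) (ι (suc m)) c ⟩
      ι (suc m) * recip m * c          ≡⟨ cong (_* c) (ι-recip m) ⟩
      1ℚ * c                           ≡⟨ ℚ.*-identityˡ c ⟩
      c                                ∎
      where
      m = length xs
      lem : ∀ r k c → r * (k * c) ≡ k * r * c
      lem = solve-∀ ℚ-ring

    average-≤ : (xs : List A) {f : A → ℚ} {c : ℚ} → 0 ℕ.< length xs → ∑ℚ xs f ≤ ι (length xs) * c → average xs f ≤ c
    average-≤ (x ∷ xs) {f} {c} 0<l ∑f≤ = begin
      recip m * ∑ℚ (x ∷ xs) f          ≤⟨ *-monoʳ (0≤recip m) ∑f≤ ⟩
      recip m * (ι (suc m) * c)        ≡⟨ cong (recip m *_) (∑ℚ-const (x ∷ xs) c) ⟨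
      average (x ∷ xs) (λ _ → c)       ≡⟨ average-const (x ∷ xs) 0<l c ⟩
      c                                ∎
      where m = length xs

  Trajectories : ℕ → ℕ → Set₁
  Trajectories n k = Vec (Graph n) (suc k)

  -- The expectation unrolled one step at a time. A graph without non-edges averages to 0, so mass
  -- is lost if the process runs too long; this is the reason for the hypotheses `k ≤ #nonEdges G`
  -- below.
  𝔼 : ∀ {n} k → Graph n → (Trajectories n k → ℚ) → ℚ
  𝔼 zero    G f = f (G ∷ [])
  𝔼 (suc k) G f = average (nonEdges G) (λ e → 𝔼 k (addEdge G e) (λ ω → f (G ∷ ω)))

  EX-processFrom : ∀ {n} k (G : Graph n) f → EX (processFrom G k) f ≡ 𝔼 k G f
  EX-processFrom zero    G f = EX-return (G ∷ []) f
  EX-processFrom (suc k) G f = begin-equality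
    EX (processFrom G (suc k)) f
      ≡⟨ EX->>= (uniform (nonEdges G)) _ f ⟩
    EX (uniform (nonEdges G)) (λ e → EX (processFrom (addEdge G e) k >>= λ ω → return (G ∷ ω)) f)
      ≡⟨ EX-uniform (nonEdges G) _ ⟩
    average (nonEdges G) (λ e → EX (processFrom (addEdge G e) k >>= λ ω → return (G ∷ ω)) f)
      ≡⟨ average-cong (nonEdges G) (λ e _ → trans (EX->>= (processFrom (addEdge G e) k) (λ ω → return (G ∷ ω)) f)
           (trans (∑ℚ-cong (processFrom (addEdge G e) k) (λ (p , ω) _ → cong (p *_) (EX-return (G ∷ ω) f)))
             (EX-processFrom k (addEdge G e) (λ ω → f (G ∷ ω))))) ⟩
    𝔼 (suc k) G f ∎

  -- The support of the process. Pointwise comparisons under `𝔼` are required only here, so they may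
  -- use that each graph extends its predecessor.
  data Trajectory {n} : ∀ {k} → Graph n → Trajectories n k → Set₁ where
    finish : ∀ {G} → Trajectory G (G ∷ [])
    advance : ∀ {k G e} {ω : Trajectories n k} → e ∈ nonEdges G → Trajectory (addEdge G e) ω → Trajectory G (G ∷ ω)

  𝔼-mono : ∀ {n} k (G : Graph n) {f g} → (∀ ω → Trajectory G ω → f ω ≤ g ω) → 𝔼 k G f ≤ 𝔼 k G g
  𝔼-mono zero    G f≤g = f≤g (G ∷ []) finish
  𝔼-mono (suc k) G f≤g = average-mono (nonEdges G) (λ e e∈ →
    𝔼-mono k (addEdge G e) (λ ω t → f≤g (G ∷ ω) (advance e∈ t)))

  𝔼-+ : ∀ {n} k (G : Graph n) f g → 𝔼 k G (λ ω → f ω + g ω) ≡ 𝔼 k G f + 𝔼 k G g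
  𝔼-+ zero    G f g = refl
  𝔼-+ (suc k) G f g = trans (average-cong (nonEdges G) (λ e _ → 𝔼-+ k (addEdge G e) _ _)) (average-+ (nonEdges G) _ _)

  𝔼-* : ∀ {n} k (G : Graph n) c f → 𝔼 k G (λ ω → c * f ω) ≡ c * 𝔼 k G f
  𝔼-* zero    G c f = refl
  𝔼-* (suc k) G c f = trans (average-cong (nonEdges G) (λ e _ → 𝔼-* k (addEdge G e) c _)) (average-* (nonEdges G) c _)

  #nonEdges-pred : ∀ {n} (G : Graph n) {e} → e ∈ nonEdges G → suc (#nonEdges (addEdge G e)) ≡ #nonEdges G
  #nonEdges-pred G {(a , b) , a<b} e∈ = #nonEdges-addEdge G a<b (nonEdge⇒≁ G {u<v = a<b} e∈)

  ≤-pred : ∀ {n k} (G : Graph n) {e} → e ∈ nonEdges G → suc k ℕ.≤ #nonEdges G → k ℕ.≤ #nonEdges (addEdge G e)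
  ≤-pred G e∈ k< = ℕ.≤-pred (ℕ.≤-trans k< (ℕ.≤-reflexive (sym (#nonEdges-pred G e∈))))

  𝔼-const : ∀ {n} k (G : Graph n) → k ℕ.≤ #nonEdges G → ∀ c → 𝔼 k G (λ _ → c) ≡ c
  𝔼-const zero    G _   c = refl
  𝔼-const (suc k) G k<M c = trans
    (average-cong (nonEdges G) (λ e e∈ → 𝔼-const k (addEdge G e) (≤-pred G e∈ k<M) c))
    (average-const (nonEdges G) (ℕ.≤-trans (ℕ.s≤s ℕ.z≤n) k<M) c)

  𝔼-∑ : ∀ {n a} {A : Set a} k (G : Graph n) (xs : List A) (f : A → Trajectories n k → ℚ) → k ℕ.≤ #nonEdges G →
    𝔼 k G (λ ω → ∑ℚ xs (λ x → f x ω)) ≡ ∑ℚ xs (λ x → 𝔼 k G (f x))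
  𝔼-∑ k G []       f k≤M = 𝔼-const k G k≤M 0ℚ
  𝔼-∑ k G (x ∷ xs) f k≤M = trans (𝔼-+ k G (f x) _) (cong (𝔼 k G (f x) +_) (𝔼-∑ k G xs f k≤M))

  -- The index counts the remaining steps, so that K 0 is the terminal payoff.
  Supermartingale : ∀ {n} → ℕ → (ℕ → Graph n → ℚ) → Set₁
  Supermartingale lo K = ∀ i G → lo ℕ.≤ #nonEdges G →
    ∑ℚ (nonEdges G) (λ e → K i (addEdge G e)) ≤ ι (#nonEdges G) * K (suc i) G

  module _ {n} lo (K : ℕ → Graph n → ℚ) (super : Supermartingale lo K)
    (h : Graph n → ℚ) (h≤K : ∀ G → h G ≤ K 0 G) where

    -- Optional stopping by induction on the steps. Those after the observed time contribute total
    -- mass 1 and drop out by `𝔼-const`.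
    𝔼-lookup-≤ : ∀ k G (i : Fin (suc k)) →
      k ℕ.≤ #nonEdges G → toℕ i ℕ.+ lo ℕ.≤ #nonEdges G →
      𝔼 k G (λ ω → h (lookup ω i)) ≤ K (toℕ i) G
    𝔼-lookup-≤ zero    G zero    k≤M i+lo≤M = h≤K G
    𝔼-lookup-≤ (suc k) G zero    k≤M i+lo≤M = ℚ.≤-trans (ℚ.≤-reflexive (𝔼-const (suc k) G k≤M (h G))) (h≤K G)
    𝔼-lookup-≤ (suc k) G (suc i) k≤M i+lo≤M = average-≤ (nonEdges G)
      (ℕ.≤-trans (ℕ.s≤s ℕ.z≤n) k≤M)
      (ℚ.≤-trans
        (∑ℚ-mono (nonEdges G) (λ e e∈ → 𝔼-lookup-≤ k (addEdge G e) i (≤-pred G e∈ k≤M) (≤-pred G e∈ i+lo≤M)))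
        (super (toℕ i) G (ℕ.≤-trans (ℕ.m≤n+m lo (suc (toℕ i))) i+lo≤M)))

  module _ {n} lo (K K′ : ℕ → Graph n → ℚ) (super : Supermartingale lo K) (super′ : Supermartingale lo K′)
    (c h : Graph n → ℚ) (0≤c : ∀ G → 0ℚ ≤ c G) (h≤K : ∀ G → h G ≤ K 0 G)
    (d : ℕ) (cK≤K′ : ∀ G → c G * K d G ≤ K′ 0 G) where

    -- Two supermartingales are glued: `K` controls the last `d` steps, and at the first observation
    -- time the product `c * K d` is handed over to `K′`, which controls the steps before it.
    𝔼-lookup₂-≤ : ∀ k G (i j : Fin (suc k)) → toℕ j ≡ toℕ i ℕ.+ d →
      k ℕ.≤ #nonEdges G → toℕ j ℕ.+ lo ℕ.≤ #nonEdges G →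
      𝔼 k G (λ ω → c (lookup ω i) * h (lookup ω j)) ≤ K′ (toℕ i) G
    𝔼-lookup₂-≤ zero G zero zero refl k≤M j+lo≤M =
      ℚ.≤-trans (*-monoʳ (0≤c G) (h≤K G)) (cK≤K′ G)
    𝔼-lookup₂-≤ (suc k) G zero j refl k≤M j+lo≤M = begin
      𝔼 (suc k) G (λ ω → c (lookup ω zero) * h (lookup ω j))
        ≡⟨ 𝔼-* (suc k) G (c G) (λ ω → h (lookup ω j)) ⟩
      c G * 𝔼 (suc k) G (λ ω → h (lookup ω j))
        ≤⟨ *-monoʳ (0≤c G) (𝔼-lookup-≤ lo K super h h≤K (suc k) G j k≤M j+lo≤M) ⟩
      c G * K (toℕ j) G
        ≤⟨ cK≤K′ G ⟩
      K′ 0 G ∎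
    𝔼-lookup₂-≤ (suc k) G (suc i) (suc j) eq k≤M j+lo≤M = average-≤ (nonEdges G)
      (ℕ.≤-trans (ℕ.s≤s ℕ.z≤n) k≤M)
      (ℚ.≤-trans
        (∑ℚ-mono (nonEdges G) (λ e e∈ → 𝔼-lookup₂-≤ k (addEdge G e) i j (ℕ.suc-injective eq) (≤-pred G e∈ k≤M) (≤-pred G e∈ j+lo≤M)))
        (super′ (toℕ i) G (ℕ.≤-trans (ℕ.m≤n+m lo (suc (toℕ j))) j+lo≤M)))

-- Exponential potentials

module _ where
  open Data.Rational using (_+_; _*_; _-_; -_; _≤_; _<_)
  open ℚ.≤-Reasoning

  ∑ℚ-linear : ∀ {a} {A : Set a} (xs : List A) α β (s t : A → ℕ) →
    ∑ℚ xs (λ e → 1ℚ - α * ι (s e) + β * ι (t e)) ≡ ι (length xs) - α * ι (∑ᴸ xs s) + β * ι (∑ᴸ xs t)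
  ∑ℚ-linear []       α β s t = lem α β
    where
    lem : ∀ α β → 0ℚ ≡ 0ℚ - α * 0ℚ + β * 0ℚ
    lem = solve-∀ ℚ-ring
  ∑ℚ-linear (x ∷ xs) α β s t = begin-equality
    1ℚ - α * ι (s x) + β * ι (t x) + ∑ℚ xs (λ e → 1ℚ - α * ι (s e) + β * ι (t e))
      ≡⟨ cong (1ℚ - α * ι (s x) + β * ι (t x) +_) (∑ℚ-linear xs α β s t) ⟩
    1ℚ - α * ι (s x) + β * ι (t x) + (ι (length xs) - α * ι (∑ᴸ xs s) + β * ι (∑ᴸ xs t))
      ≡⟨ lem α β (ι (s x)) (ι (t x)) (ι (length xs)) (ι (∑ᴸ xs s)) (ι (∑ᴸ xs t)) ⟩
    1ℚ + ι (length xs) - α * (ι (s x) + ι (∑ᴸ xs s)) + β * (ι (t x) + ι (∑ᴸ xs t))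
      ≡⟨ cong₂ (λ p q → 1ℚ + ι (length xs) - α * p + β * q) (ι-+ (s x) _) (ι-+ (t x) _) ⟨
    1ℚ + ι (length xs) - α * ι (s x ℕ.+ ∑ᴸ xs s) + β * ι (t x ℕ.+ ∑ᴸ xs t) ∎
    where
    lem : ∀ α β s t l S T → 1ℚ - α * s + β * t + (l - α * S + β * T) ≡ 1ℚ + l - α * (s + S) + β * (t + T)
    lem = solve-∀ ℚ-ring

  -- The possible increments of `cnt χ` and `cnt I` under one new edge. An internal edge adds 2
  -- because both of its orders are counted.
  data Kind (s t : ℕ) : Set where
    neutral  : s ≡ 0 → t ≡ 0 → Kind s t
    crossing : s ≡ 1 → t ≡ 0 → Kind s t
    internal : s ≡ 0 → t ≡ 2 → Kind s t

  -- `x` below 1 penalises crossing pairs and `Y` above 1 rewards internal ones; `w` and `v` are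
  -- their inverses. `A` is a guaranteed relative loss per step while at most `k` crossing pairs are
  -- used up, and `D` bounds the relative gain per step from internal pairs while at least `lo`
  -- non-edges are left.
  record Weights {n} (χ I : Fin n → Fin n → ℕ) (k lo : ℕ) : Set where
    field
      x w Y v A D : ℚ
      irrefl-χ : ∀ u → χ u u ≡ 0
      kind     : ∀ a b → Kind (χ a b ℕ.+ χ b a) (I a b ℕ.+ I b a)
      0≤x : 0ℚ ≤ x
      x≤1 : x ≤ 1ℚ
      0≤w : 0ℚ ≤ w
      wx≡1 : w * x ≡ 1ℚ
      1≤Y : 1ℚ ≤ Y
      0≤v : 0ℚ ≤ v
      vY≡1 : v * Y ≡ 1ℚ
      0≤A : 0ℚ ≤ A
      A≤1 : A ≤ 1ℚ
      0≤D : 0ℚ ≤ D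
      A-bound : A * ι (n C 2) ≤ (1ℚ - x) * (ι (∑² χ) - ι k)
      D-bound : (Y * Y - 1ℚ) * ι (∑² I) ≤ D * ι lo

  module Potential {n} {χ I : Fin n → Fin n → ℕ} {k lo : ℕ} (W : Weights χ I k lo) where
    open Weights W

    -- The growth factors per step: `Λ₁` up to the first observation time, where both kinds of pairs
    -- are weighted, and `Λ₂` between the two times, where only internal ones are.
    Λ₁ Λ₂ : ℚ
    Λ₁ = 1ℚ - A + D
    Λ₂ = 1ℚ + D

    0≤Λ₁ : 0ℚ ≤ Λ₁
    0≤Λ₁ = 0≤+ (a≤b⇒0≤b-a A≤1) 0≤D

    0≤Λ₂ : 0ℚ ≤ Λ₂
    0≤Λ₂ = 0≤+ 0≤1 0≤D

    0≤Y : 0ℚ ≤ Y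
    0≤Y = ℚ.≤-trans 0≤1 1≤Y

    0≤Y²-1 : 0ℚ ≤ Y * Y - 1ℚ
    0≤Y²-1 = a≤b⇒0≤b-a (ℚ.≤-trans 1≤Y (ℚ.≤-trans (ℚ.≤-reflexive (sym (ℚ.*-identityʳ Y))) (*-monoʳ 0≤Y 1≤Y)))

    -- An affine majorant, so that summing over the non-edges requires only the sums of `s` and `t`.
    -- It is exact except for internal pairs, where `t` = 2 charges the gain Y² - 1 twice; `D`
    -- absorbs this.
    pair-weight : ∀ {s t} → Kind s t → x ^ s * Y ^ t ≤ 1ℚ - (1ℚ - x) * ι s + (Y * Y - 1ℚ) * ι t
    pair-weight (neutral refl refl) = ℚ.≤-reflexive (lem x Y)
      where
      lem : ∀ x Y → 1ℚ * 1ℚ ≡ 1ℚ - (1ℚ - x) * 0ℚ + (Y * Y - 1ℚ) * 0ℚ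
      lem = solve-∀ ℚ-ring
    pair-weight (crossing refl refl) = ℚ.≤-reflexive (lem x Y)
      where
      lem : ∀ x Y → x * 1ℚ * 1ℚ ≡ 1ℚ - (1ℚ - x) * (1ℚ + 0ℚ) + (Y * Y - 1ℚ) * 0ℚ
      lem = solve-∀ ℚ-ring
    pair-weight (internal refl refl) = ≤-by (Y * Y - 1ℚ) 0≤Y²-1 (lem x Y)
      where
      lem : ∀ x Y → 1ℚ * (Y * (Y * 1ℚ)) + (Y * Y - 1ℚ) ≡ 1ℚ - (1ℚ - x) * 0ℚ + (Y * Y - 1ℚ) * (1ℚ + (1ℚ + 0ℚ))
      lem = solve-∀ ℚ-ring

    Y-weight : ∀ {s t} → Kind s t → Y ^ t ≤ 1ℚ - 0ℚ * ι s + (Y * Y - 1ℚ) * ι t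
    Y-weight (neutral refl refl) = ℚ.≤-reflexive (lem Y)
      where
      lem : ∀ Y → 1ℚ ≡ 1ℚ - 0ℚ * 0ℚ + (Y * Y - 1ℚ) * 0ℚ
      lem = solve-∀ ℚ-ring
    Y-weight (crossing refl refl) = ℚ.≤-reflexive (lem Y)
      where
      lem : ∀ Y → 1ℚ ≡ 1ℚ - 0ℚ * (1ℚ + 0ℚ) + (Y * Y - 1ℚ) * 0ℚ
      lem = solve-∀ ℚ-ring
    Y-weight (internal refl refl) = ≤-by (Y * Y - 1ℚ) 0≤Y²-1 (lem Y)
      where
      lem : ∀ Y → Y * (Y * 1ℚ) + (Y * Y - 1ℚ) ≡ 1ℚ - 0ℚ * 0ℚ + (Y * Y - 1ℚ) * (1ℚ + (1ℚ + 0ℚ))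
      lem = solve-∀ ℚ-ring

    kindₑ : ∀ e → Kind (sym-sum χ e) (sym-sum I e)
    kindₑ ((a , b) , _) = kind a b

    module _ (G : Graph n) (lo≤M : lo ℕ.≤ #nonEdges G) where

      internal-bound : (Y * Y - 1ℚ) * ι (∑ᴸ (nonEdges G) (sym-sum I)) ≤ D * ι (#nonEdges G)
      internal-bound = begin
        (Y * Y - 1ℚ) * ι (∑ᴸ (nonEdges G) (sym-sum I))
          -- For a gain an upper bound suffices, so adjacent and diagonal pairs are simply included.
          ≤⟨ *-monoʳ 0≤Y²-1 (ι-mono (ℕ.≤-trans (ℕ.m≤m+n _ (cnt I G)) (ℕ.≤-trans (ℕ.m≤m+n _ (∑[ u < n ] I u u))
               (ℕ.≤-reflexive (∑-nonEdges-sym G I))))) ⟩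
        (Y * Y - 1ℚ) * ι (∑² I)    ≤⟨ D-bound ⟩
        D * ι lo                   ≤⟨ *-monoʳ 0≤D (ι-mono lo≤M) ⟩
        D * ι (#nonEdges G)        ∎

      ∑-Y-weight : ∑ℚ (nonEdges G) (λ e → Y ^ sym-sum I e) ≤ ι (#nonEdges G) * Λ₂
      ∑-Y-weight = begin
        ∑ℚ (nonEdges G) (λ e → Y ^ sym-sum I e)
          ≤⟨ ∑ℚ-mono (nonEdges G) (λ e _ → Y-weight (kindₑ e)) ⟩
        ∑ℚ (nonEdges G) (λ e → 1ℚ - 0ℚ * ι (sym-sum χ e) + (Y * Y - 1ℚ) * ι (sym-sum I e))
          ≡⟨ ∑ℚ-linear (nonEdges G) 0ℚ (Y * Y - 1ℚ) (sym-sum χ) (sym-sum I) ⟩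
        M - 0ℚ * Sχ + (Y * Y - 1ℚ) * ι (∑ᴸ (nonEdges G) (sym-sum I))
          ≤⟨ ℚ.+-monoʳ-≤ (M - 0ℚ * Sχ) internal-bound ⟩
        M - 0ℚ * Sχ + D * M
          ≡⟨ lem M Sχ D ⟩
        M * Λ₂ ∎
        where
        M = ι (#nonEdges G)
        Sχ = ι (∑ᴸ (nonEdges G) (sym-sum χ))
        lem : ∀ m s d → m - 0ℚ * s + d * m ≡ m * (1ℚ + d)
        lem = solve-∀ ℚ-ring

      ∑-pair-weight : cnt χ G ℕ.≤ k →
        ∑ℚ (nonEdges G) (λ e → x ^ sym-sum χ e * Y ^ sym-sum I e) ≤ ι (#nonEdges G) * Λ₁
      ∑-pair-weight cnt≤k = begin
        ∑ℚ (nonEdges G) (λ e → x ^ sym-sum χ e * Y ^ sym-sum I e)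
          ≤⟨ ∑ℚ-mono (nonEdges G) (λ e _ → pair-weight (kindₑ e)) ⟩
        ∑ℚ (nonEdges G) (λ e → 1ℚ - (1ℚ - x) * ι (sym-sum χ e) + (Y * Y - 1ℚ) * ι (sym-sum I e))
          ≡⟨ ∑ℚ-linear (nonEdges G) (1ℚ - x) (Y * Y - 1ℚ) (sym-sum χ) (sym-sum I) ⟩
        M - (1ℚ - x) * Sχ + (Y * Y - 1ℚ) * ι (∑ᴸ (nonEdges G) (sym-sum I))
          ≤⟨ ℚ.+-monoʳ-≤ (M - (1ℚ - x) * Sχ) internal-bound ⟩
        M - (1ℚ - x) * Sχ + D * M
          ≤⟨ ℚ.+-monoˡ-≤ (D * M) (ℚ.+-monoʳ-≤ M (ℚ.neg-antimono-≤ crossing-bound)) ⟩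
        M - A * M + D * M
          ≡⟨ lem M A D ⟩
        M * Λ₁ ∎
        where
        M = ι (#nonEdges G)
        Sχ = ι (∑ᴸ (nonEdges G) (sym-sum χ))
        lem : ∀ m a d → m - a * m + d * m ≡ m * (1ℚ - a + d)
        lem = solve-∀ ℚ-ring
        ∑χ≤ : ∑² χ ℕ.≤ ∑ᴸ (nonEdges G) (sym-sum χ) ℕ.+ k
        ∑χ≤ = ℕ.≤-trans (ℕ.≤-reflexive (trans (sym (∑-nonEdges-sym G χ))
            (trans (cong (∑ᴸ (nonEdges G) (sym-sum χ) ℕ.+ cnt χ G ℕ.+_) (∑-zero irrefl-χ)) (ℕ.+-identityʳ _))))
          (ℕ.+-monoʳ-≤ (∑ᴸ (nonEdges G) (sym-sum χ)) cnt≤k)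
        -- At least `∑² χ - k` crossing pairs are still non-edges, among at most `n C 2` non-edges
        -- in all.
        crossing-bound : A * M ≤ (1ℚ - x) * Sχ
        crossing-bound = begin
          A * M                            ≤⟨ *-monoʳ 0≤A (ι-mono (#nonEdges≤nC2 G)) ⟩
          A * ι (n C 2)                    ≤⟨ A-bound ⟩
          (1ℚ - x) * (ι (∑² χ) - ι k)      ≤⟨ *-monoʳ (a≤b⇒0≤b-a x≤1) (0≤b-a⇒a≤b (ℚ.≤-trans (a≤b⇒0≤b-a
                                                (ℚ.≤-trans (ι-mono ∑χ≤) (ℚ.≤-reflexive (ι-+ (∑ᴸ (nonEdges G) (sym-sum χ)) k))))
                                                (ℚ.≤-reflexive (lem′ Sχ (ι k) (ι (∑² χ)))))) ⟩
          (1ℚ - x) * Sχ                    ∎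
          where
          lem′ : ∀ a b c → (a + b) - c ≡ a - (c - b)
          lem′ = solve-∀ ℚ-ring

    -- The Chernoff potential of the event that `cnt I` reaches `j`: the terminal value
    -- (Y^cnt)/(Y^j) dominates its indicator, and `Λ₂ ^ i` pays for the steps to come.
    late : ℕ → ℕ → Graph n → ℚ
    late j i G = v ^ j * Λ₂ ^ i * Y ^ cnt I G

    late-super : ∀ j → Supermartingale lo (late j)
    late-super j i G lo≤M = begin
      ∑ℚ (nonEdges G) (λ e → v ^ j * Λ₂ ^ i * Y ^ cnt I (addEdge G e))
        ≡⟨ ∑ℚ-cong (nonEdges G) split ⟩
      ∑ℚ (nonEdges G) (λ e → v ^ j * Λ₂ ^ i * Y ^ cnt I G * Y ^ sym-sum I e)
        ≡⟨ ∑ℚ-* (nonEdges G) (v ^ j * Λ₂ ^ i * Y ^ cnt I G) _ ⟩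
      v ^ j * Λ₂ ^ i * Y ^ cnt I G * ∑ℚ (nonEdges G) (λ e → Y ^ sym-sum I e)
        ≤⟨ *-monoʳ (0≤* (0≤* (0≤^ j 0≤v) (0≤^ i 0≤Λ₂)) (0≤^ (cnt I G) 0≤Y)) (∑-Y-weight G lo≤M) ⟩
      v ^ j * Λ₂ ^ i * Y ^ cnt I G * (ι (#nonEdges G) * Λ₂)
        ≡⟨ lem (v ^ j) (Λ₂ ^ i) (Y ^ cnt I G) (ι (#nonEdges G)) Λ₂ ⟩
      ι (#nonEdges G) * (v ^ j * (Λ₂ * Λ₂ ^ i) * Y ^ cnt I G) ∎
      where
      lem : ∀ a b c m l → a * b * c * (m * l) ≡ m * (a * (l * b) * c)
      lem = solve-∀ ℚ-ring
      split : ∀ e → e ∈ nonEdges G → v ^ j * Λ₂ ^ i * Y ^ cnt I (addEdge G e) ≡ v ^ j * Λ₂ ^ i * Y ^ cnt I G * Y ^ sym-sum I e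
      split e@((a , b) , a<b) e∈ = begin-equality
        v ^ j * Λ₂ ^ i * Y ^ cnt I (addEdge G e)
          ≡⟨ cong (λ c → v ^ j * Λ₂ ^ i * Y ^ c) (cnt-addEdge G a<b (nonEdge⇒≁ G {u<v = a<b} e∈) I) ⟩
        v ^ j * Λ₂ ^ i * Y ^ (cnt I G ℕ.+ sym-sum I e)
          ≡⟨ cong (v ^ j * Λ₂ ^ i *_) (^-homo-* Y (cnt I G) (sym-sum I e)) ⟩
        v ^ j * Λ₂ ^ i * (Y ^ cnt I G * Y ^ sym-sum I e)
          ≡⟨ ℚ.*-assoc (v ^ j * Λ₂ ^ i) _ _ ⟨
        v ^ j * Λ₂ ^ i * Y ^ cnt I G * Y ^ sym-sum I e ∎

    few : Graph n → ℚ
    few G = ι ⟦ cnt χ G ℕ.≤? k ⟧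

    -- The factor few G kills the potential once more than k crossing pairs
    -- are present, so that at least ∑² χ - k of them are always available.
    early : ℚ → ℕ → Graph n → ℚ
    early B i G = few G * (B * Λ₁ ^ i * (x ^ cnt χ G * Y ^ cnt I G))

    early-super : ∀ B → 0ℚ ≤ B → Supermartingale lo (early B)
    early-super B 0≤B i G lo≤M = by-cases (cnt χ G ℕ.≤? k)
      where
      by-cases : (d : Dec (cnt χ G ℕ.≤ k)) →
        ∑ℚ (nonEdges G) (λ e → early B i (addEdge G e)) ≤
        ι (#nonEdges G) * (ι ⟦ d ⟧ * (B * Λ₁ ^ suc i * (x ^ cnt χ G * Y ^ cnt I G)))
      -- Adding an edge never lowers the crossing count, so a potential once killed remains 0.
      by-cases (no cnt≰k) = begin
        ∑ℚ (nonEdges G) (λ e → early B i (addEdge G e))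
          ≡⟨ ∑ℚ-cong (nonEdges G) vanish ⟩
        ∑ℚ (nonEdges G) (λ _ → 0ℚ)
          ≡⟨ ∑ℚ-const (nonEdges G) 0ℚ ⟩
        ι (#nonEdges G) * 0ℚ
          ≡⟨ cong (ι (#nonEdges G) *_) (ℚ.*-zeroˡ (B * Λ₁ ^ suc i * (x ^ cnt χ G * Y ^ cnt I G))) ⟨
        ι (#nonEdges G) * (0ℚ * (B * Λ₁ ^ suc i * (x ^ cnt χ G * Y ^ cnt I G))) ∎
        where
        vanish : ∀ e → e ∈ nonEdges G → early B i (addEdge G e) ≡ 0ℚ
        vanish e@((a , b) , a<b) e∈ = trans
          (cong (λ c → ι c * (B * Λ₁ ^ i * (x ^ cnt χ (addEdge G e) * Y ^ cnt I (addEdge G e))))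
            (⟦⟧-no (cnt χ (addEdge G e) ℕ.≤? k) (λ le → cnt≰k (ℕ.≤-trans (ℕ.m≤m+n (cnt χ G) _)
              (ℕ.≤-trans (ℕ.≤-reflexive (sym (cnt-addEdge G a<b (nonEdge⇒≁ G {u<v = a<b} e∈) χ))) le)))))
          (ℚ.*-zeroˡ (B * Λ₁ ^ i * (x ^ cnt χ (addEdge G e) * Y ^ cnt I (addEdge G e))))
      by-cases (yes cnt≤k) = begin
        ∑ℚ (nonEdges G) (λ e → early B i (addEdge G e))
          ≤⟨ ∑ℚ-mono (nonEdges G) bound ⟩
        ∑ℚ (nonEdges G) (λ e → P * (x ^ sym-sum χ e * Y ^ sym-sum I e))
          ≡⟨ ∑ℚ-* (nonEdges G) P _ ⟩
        P * ∑ℚ (nonEdges G) (λ e → x ^ sym-sum χ e * Y ^ sym-sum I e)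
          ≤⟨ *-monoʳ 0≤P (∑-pair-weight G lo≤M cnt≤k) ⟩
        P * (ι (#nonEdges G) * Λ₁)
          ≡⟨ lem B (Λ₁ ^ i) (x ^ cnt χ G) (Y ^ cnt I G) (ι (#nonEdges G)) Λ₁ ⟩
        ι (#nonEdges G) * (ι 1 * (B * Λ₁ ^ suc i * (x ^ cnt χ G * Y ^ cnt I G))) ∎
        where
        P = B * Λ₁ ^ i * (x ^ cnt χ G * Y ^ cnt I G)
        0≤P : 0ℚ ≤ P
        0≤P = 0≤* (0≤* 0≤B (0≤^ i 0≤Λ₁)) (0≤* (0≤^ (cnt χ G) 0≤x) (0≤^ (cnt I G) 0≤Y))
        lem : ∀ c a p q m l → c * a * (p * q) * (m * l) ≡ m * ((1ℚ + 0ℚ) * (c * (l * a) * (p * q)))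
        lem = solve-∀ ℚ-ring
        regroup : ∀ c p q r s → c * ((p * q) * (r * s)) ≡ c * (p * r) * (q * s)
        regroup = solve-∀ ℚ-ring
        bound : ∀ e → e ∈ nonEdges G → early B i (addEdge G e) ≤ P * (x ^ sym-sum χ e * Y ^ sym-sum I e)
        bound e@((a , b) , a<b) e∈ = begin
          ι ⟦ cnt χ (addEdge G e) ℕ.≤? k ⟧ * Q
            ≤⟨ *-monoˡ 0≤Q (ι-mono (⟦⟧≤1 (cnt χ (addEdge G e) ℕ.≤? k))) ⟩
          1ℚ * Q
            ≡⟨ ℚ.*-identityˡ Q ⟩
          B * Λ₁ ^ i * (x ^ cnt χ (addEdge G e) * Y ^ cnt I (addEdge G e))
            ≡⟨ cong₂ (λ p q → B * Λ₁ ^ i * (x ^ p * Y ^ q)) (cnt-addEdge G a<b e∉ χ) (cnt-addEdge G a<b e∉ I) ⟩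
          B * Λ₁ ^ i * (x ^ (cnt χ G ℕ.+ sym-sum χ e) * Y ^ (cnt I G ℕ.+ sym-sum I e))
            ≡⟨ cong₂ (λ p q → B * Λ₁ ^ i * (p * q)) (^-homo-* x (cnt χ G) _) (^-homo-* Y (cnt I G) _) ⟩
          B * Λ₁ ^ i * ((x ^ cnt χ G * x ^ sym-sum χ e) * (Y ^ cnt I G * Y ^ sym-sum I e))
            ≡⟨ regroup (B * Λ₁ ^ i) (x ^ cnt χ G) (x ^ sym-sum χ e) (Y ^ cnt I G) (Y ^ sym-sum I e) ⟩
          P * (x ^ sym-sum χ e * Y ^ sym-sum I e) ∎
          where
          e∉ = nonEdge⇒≁ G {u<v = a<b} e∈
          Q = B * Λ₁ ^ i * (x ^ cnt χ (addEdge G e) * Y ^ cnt I (addEdge G e))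
          0≤Q : 0ℚ ≤ Q
          0≤Q = 0≤* (0≤* 0≤B (0≤^ i 0≤Λ₁)) (0≤* (0≤^ (cnt χ (addEdge G e)) 0≤x) (0≤^ (cnt I (addEdge G e)) 0≤Y))

    1≤w : 1ℚ ≤ w
    1≤w = begin
      1ℚ     ≡⟨ wx≡1 ⟨
      w * x  ≤⟨ *-monoʳ 0≤w x≤1 ⟩
      w * 1ℚ ≡⟨ ℚ.*-identityʳ w ⟩
      w      ∎

    1≤a^m*b^n : ∀ {a b m n} → 1ℚ ≤ a → a * b ≡ 1ℚ → 0ℚ ≤ b → n ℕ.≤ m → 1ℚ ≤ a ^ m * b ^ n
    1≤a^m*b^n {a} {b} {m} {n} 1≤a ab≡1 0≤b n≤m = begin
      1ℚ             ≡⟨ 1^ n ⟨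
      1ℚ ^ n         ≡⟨ cong (_^ n) ab≡1 ⟨
      (a * b) ^ n    ≡⟨ ^-distrib-* a b n ⟩
      a ^ n * b ^ n  ≤⟨ *-monoˡ (0≤^ n 0≤b) (^-monotone 1≤a n≤m) ⟩
      a ^ m * b ^ n  ∎

    many : ℕ → Graph n → ℚ
    many j G = ι ⟦ j ℕ.≤? cnt I G ⟧

    many≤late : ∀ j G → many j G ≤ late j 0 G
    many≤late j G = by-cases (j ℕ.≤? cnt I G)
      where
      by-cases : (d : Dec (j ℕ.≤ cnt I G)) → ι ⟦ d ⟧ ≤ late j 0 G
      by-cases (no _) = 0≤* (0≤* (0≤^ j 0≤v) 0≤1) (0≤^ (cnt I G) 0≤Y)
      by-cases (yes j≤cnt) = begin
        1ℚ                            ≤⟨ 1≤a^m*b^n {Y} {v} {cnt I G} {j} 1≤Y (trans (ℚ.*-comm Y v) vY≡1) 0≤v j≤cnt ⟩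
        Y ^ cnt I G * v ^ j           ≡⟨ lem (v ^ j) (Y ^ cnt I G) ⟩
        v ^ j * 1ℚ * Y ^ cnt I G      ∎
        where
        lem : ∀ a b → b * a ≡ a * 1ℚ * b
        lem = solve-∀ ℚ-ring

    -- The hand-over at the first observation time. Where at most `k` crossing pairs are present,
    -- `w ^ k * x ^ cnt χ G` is at least 1 and may be multiplied in; elsewhere both sides vanish.
    few-late≤early : ∀ j d G → few G * late j d G ≤ early (Λ₂ ^ d * w ^ k * v ^ j) 0 G
    few-late≤early j d G = by-cases (cnt χ G ℕ.≤? k)
      where
      by-cases : (c : Dec (cnt χ G ℕ.≤ k)) → ι ⟦ c ⟧ * late j d G ≤
        ι ⟦ c ⟧ * (Λ₂ ^ d * w ^ k * v ^ j * 1ℚ * (x ^ cnt χ G * Y ^ cnt I G))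
      by-cases (no _) = ℚ.≤-reflexive (trans (ℚ.*-zeroˡ (late j d G)) 
        (sym (ℚ.*-zeroˡ (Λ₂ ^ d * w ^ k * v ^ j * 1ℚ * (x ^ cnt χ G * Y ^ cnt I G)))))
      by-cases (yes cnt≤k) = *-monoʳ (0≤ι 1) (begin
        v ^ j * Λ₂ ^ d * Y ^ cnt I G
          ≡⟨ ℚ.*-identityʳ _ ⟨
        v ^ j * Λ₂ ^ d * Y ^ cnt I G * 1ℚ
          ≤⟨ *-monoʳ (0≤* (0≤* (0≤^ j 0≤v) (0≤^ d 0≤Λ₂)) (0≤^ (cnt I G) 0≤Y))
               (1≤a^m*b^n {w} {x} {k} {cnt χ G} 1≤w wx≡1 0≤x cnt≤k) ⟩
        v ^ j * Λ₂ ^ d * Y ^ cnt I G * (w ^ k * x ^ cnt χ G)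
          ≡⟨ lem (v ^ j) (Λ₂ ^ d) (Y ^ cnt I G) (w ^ k) (x ^ cnt χ G) ⟩
        Λ₂ ^ d * w ^ k * v ^ j * 1ℚ * (x ^ cnt χ G * Y ^ cnt I G) ∎)
        where
        lem : ∀ a b c d e → a * b * c * (d * e) ≡ b * d * a * 1ℚ * (e * c)
        lem = solve-∀ ℚ-ring

    -- One joint Chernoff bound for both events: the empty graph has neither crossing nor internal
    -- edges, so the initial value of the potential is explicit.
    sparse-bound : ∀ j (i₁ i₂ : Fin (suc (n C 2))) d → toℕ i₂ ≡ toℕ i₁ ℕ.+ d → toℕ i₂ ℕ.+ lo ℕ.≤ n C 2 →
      𝔼 (n C 2) (emptyGraph n) (λ ω → ι ⟦ cnt χ (lookup ω i₁) ℕ.≤? k ⟧ * ι ⟦ j ℕ.≤? cnt I (lookup ω i₂) ⟧)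
        ≤ Λ₁ ^ toℕ i₁ * (Λ₂ ^ d * w ^ k * v ^ j)
    sparse-bound j i₁ i₂ d eq i₂+lo≤N = begin
      𝔼 (n C 2) (emptyGraph n) (λ ω → few (lookup ω i₁) * many j (lookup ω i₂))
        ≤⟨ 𝔼-lookup₂-≤ lo (late j) (early B) (late-super j) (early-super B 0≤B) few (many j)
             (λ G → 0≤ι ⟦ cnt χ G ℕ.≤? k ⟧) (many≤late j) d (few-late≤early j d)
             (n C 2) (emptyGraph n) i₁ i₂ eq
             (ℕ.≤-reflexive (sym (#nonEdges-empty n)))
             (ℕ.≤-trans i₂+lo≤N (ℕ.≤-reflexive (sym (#nonEdges-empty n)))) ⟩
      early B (toℕ i₁) (emptyGraph n)
        ≤⟨ *-monoˡ (0≤* (0≤* 0≤B (0≤^ (toℕ i₁) 0≤Λ₁)) (0≤* (0≤^ (cnt χ (emptyGraph n)) 0≤x) (0≤^ (cnt I (emptyGraph n)) 0≤Y)))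
             (ι-mono (⟦⟧≤1 (cnt χ (emptyGraph n) ℕ.≤? k))) ⟩
      1ℚ * (B * Λ₁ ^ toℕ i₁ * (x ^ cnt χ (emptyGraph n) * Y ^ cnt I (emptyGraph n)))
        ≡⟨ cong₂ (λ p q → 1ℚ * (B * Λ₁ ^ toℕ i₁ * (x ^ p * Y ^ q))) (cnt-empty χ) (cnt-empty I) ⟩
      1ℚ * (B * Λ₁ ^ toℕ i₁ * (1ℚ * 1ℚ))
        ≡⟨ lem B (Λ₁ ^ toℕ i₁) ⟩
      Λ₁ ^ toℕ i₁ * B ∎
      where
      B = Λ₂ ^ d * w ^ k * v ^ j
      0≤B : 0ℚ ≤ B
      0≤B = 0≤* (0≤* (0≤^ d 0≤Λ₂) (0≤^ k 0≤w)) (0≤^ j 0≤v)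
      lem : ∀ c l → 1ℚ * (c * l * (1ℚ * 1ℚ)) ≡ l * c
      lem = solve-∀ ℚ-ring

-- Isolated vertices: a second moment estimate

module _ where
  open ≡-Reasoning
  open Data.Nat using (_+_; _*_; _≤_; z≤n; s≤s)

  iso : ∀ {n} → Graph n → Fin n → ℕ
  iso G v = ⟦ deg G v ℕ.≟ 0 ⟧

  distinct : ∀ {n} → Fin n → Fin n → ℕ
  distinct u v = ⟦ ¬? (u Fin.≟ v) ⟧

  -- For X isolated vertices `#iso²` is X(X - 1), not X². Distinct vertices are what can be treated
  -- as a pair that survives together.
  #iso #iso² : ∀ {n} → Graph n → ℕ
  #iso {n} G = ∑[ v < n ] (iso G v)
  #iso² G = ∑² (λ u v → distinct u v * (iso G u * iso G v))

  touch : ∀ {n} → Fin n → Pair n → ℕ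
  touch v = sym-sum (λ a _ → ⟦ a Fin.≟ v ⟧)

  touch₂ : ∀ {n} → Fin n → Fin n → Pair n → ℕ
  touch₂ u v = sym-sum (λ a b → ⟦ a Fin.≟ u ⟧ * ⟦ b Fin.≟ v ⟧)

  #iso²+#iso : ∀ {n} (G : Graph n) → #iso² G + #iso G ≡ #iso G * #iso G
  #iso²+#iso {n} G = begin
    #iso² G + #iso G
      ≡⟨ cong (#iso² G +_) (sum-cong-≗ (λ v → idem v)) ⟨
    #iso² G + ∑[ v < n ] (iso G v * iso G v)
      ≡⟨ cong (#iso² G +_) (∑²-diag (λ u v → iso G u * iso G v)) ⟨
    #iso² G + ∑² (λ u v → ⟦ v Fin.≟ u ⟧ * (iso G u * iso G v))
      ≡⟨ ∑²-+ (λ u v → distinct u v * (iso G u * iso G v)) _ ⟨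
    ∑² (λ u v → distinct u v * (iso G u * iso G v) + ⟦ v Fin.≟ u ⟧ * (iso G u * iso G v))
      ≡⟨ ∑²-cong (λ u v → trans (sym (ℕ.*-distribʳ-+ (iso G u * iso G v) (distinct u v) ⟦ v Fin.≟ u ⟧))
           (trans (cong (λ c → c * (iso G u * iso G v)) (one u v)) (ℕ.*-identityˡ (iso G u * iso G v)))) ⟩
    ∑² (λ u v → iso G u * iso G v)
      ≡⟨ sum-cong-≗ (λ u → *-distribˡ-sum (iso G u) (iso G)) ⟨
    ∑[ u < n ] (iso G u * #iso G)
      ≡⟨ *-distribʳ-sum (#iso G) (iso G) ⟨
    #iso G * #iso G ∎
    where
    idem : ∀ v → iso G v * iso G v ≡ iso G v
    idem v = ⟦⟧-idem (deg G v ℕ.≟ 0)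
    one : ∀ u v → distinct u v + ⟦ v Fin.≟ u ⟧ ≡ 1
    one u v = trans (cong (distinct u v +_) (⟦⟧-cong (v Fin.≟ u) (u Fin.≟ v) sym sym)) (⟦⟧-¬ (u Fin.≟ v))

  module _ {n} (G : Graph n) where

    module _ {a b : Fin n} (a<b : a Fin.< b) (a≁b : ¬ SimpleGraph._~_ G a b) where

      private
        e : Pair n
        e = (a , b) , a<b

      deg-addEdge : ∀ v → deg (addEdge G e) v ≡ deg G v + touch v e
      deg-addEdge v = begin
        deg (addEdge G e) v
          ≡⟨ sum-cong-≗ (adj-addEdge G a<b a≁b v) ⟩
        ∑[ w < n ] (adj G v w + (⟦ v Fin.≟ a ⟧ * ⟦ w Fin.≟ b ⟧ + ⟦ v Fin.≟ b ⟧ * ⟦ w Fin.≟ a ⟧))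
          ≡⟨ trans (∑-distrib-+ (adj G v) _) (cong (deg G v +_) (∑-distrib-+ (λ w → ⟦ v Fin.≟ a ⟧ * ⟦ w Fin.≟ b ⟧) _)) ⟩
        deg G v + (∑[ w < n ] (⟦ v Fin.≟ a ⟧ * ⟦ w Fin.≟ b ⟧) + ∑[ w < n ] (⟦ v Fin.≟ b ⟧ * ⟦ w Fin.≟ a ⟧))
          ≡⟨ cong₂ (λ p q → deg G v + (p + q)) (factor a b) (factor b a) ⟩
        deg G v + touch v e ∎
        where
        factor : ∀ c d → ∑[ w < n ] (⟦ v Fin.≟ c ⟧ * ⟦ w Fin.≟ d ⟧) ≡ ⟦ c Fin.≟ v ⟧
        factor c d = begin
          ∑[ w < n ] (⟦ v Fin.≟ c ⟧ * ⟦ w Fin.≟ d ⟧) ≡⟨ sum-cong-≗ (λ w → ℕ.*-comm ⟦ v Fin.≟ c ⟧ ⟦ w Fin.≟ d ⟧) ⟩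
          ∑[ w < n ] (⟦ w Fin.≟ d ⟧ * ⟦ v Fin.≟ c ⟧) ≡⟨ ∑-δ d (λ _ → ⟦ v Fin.≟ c ⟧) ⟩
          ⟦ v Fin.≟ c ⟧                              ≡⟨ ⟦⟧-cong (v Fin.≟ c) (c Fin.≟ v) sym sym ⟩
          ⟦ c Fin.≟ v ⟧                              ∎

      touch≤1 : ∀ v → touch v e ≡ 0 ⊎ touch v e ≡ 1
      touch≤1 v with a Fin.≟ v | b Fin.≟ v
      ... | yes refl | yes refl = contradiction refl (Fin.<⇒≢ a<b)
      ... | yes _    | no _     = inj₂ refl
      ... | no _     | yes _    = inj₂ refl
      ... | no _     | no _     = inj₁ refl

      iso-addEdge : ∀ v → iso (addEdge G e) v + iso G v * touch v e ≡ iso G v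
      iso-addEdge v = lem (deg G v) (touch≤1 v) (deg-addEdge v)
        where
        lem : ∀ d {d′ t} → t ≡ 0 ⊎ t ≡ 1 → d′ ≡ d + t → ⟦ d′ ℕ.≟ 0 ⟧ + ⟦ d ℕ.≟ 0 ⟧ * t ≡ ⟦ d ℕ.≟ 0 ⟧
        lem zero    (inj₁ refl) refl = refl
        lem zero    (inj₂ refl) refl = refl
        lem (suc d) (inj₁ refl) refl = refl
        lem (suc d) (inj₂ refl) refl = refl

      touch*touch : ∀ {u v} → u ≢ v → touch u e * touch v e ≡ touch₂ u v e
      touch*touch {u} {v} u≢v with a Fin.≟ u | b Fin.≟ u | a Fin.≟ v | b Fin.≟ v
      ... | yes refl | _        | yes refl | _        = contradiction refl u≢v
      ... | _        | yes refl | _        | yes refl = contradiction refl u≢v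
      ... | yes refl | yes refl | _        | _        = contradiction refl (Fin.<⇒≢ a<b)
      ... | _        | _        | yes refl | yes refl = contradiction refl (Fin.<⇒≢ a<b)
      ... | yes _    | no _     | no _     | yes _    = refl
      ... | yes _    | no _     | no _     | no _     = refl
      ... | no _     | yes _    | yes _    | no _     = refl
      ... | no _     | yes _    | no _     | no _     = refl
      ... | no _     | no _     | yes _    | no _     = refl
      ... | no _     | no _     | no _     | yes _    = refl
      ... | no _     | no _     | no _     | no _     = refl

    ∑-touch : ∀ v → deg G v ≡ 0 → ∑ᴸ (nonEdges G) (touch v) + 1 ≡ n
    ∑-touch v deg≡0 = begin
      ∑ᴸ (nonEdges G) (touch v) + 1
        ≡⟨ cong₂ _+_ (sym (ℕ.+-identityʳ _)) (sym one) ⟩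
      ∑ᴸ (nonEdges G) (touch v) + 0 + ∑[ u < n ] (χ u u)
        ≡⟨ cong (λ c → ∑ᴸ (nonEdges G) (touch v) + c + ∑[ u < n ] (χ u u)) (sym cnt≡0) ⟩
      ∑ᴸ (nonEdges G) (touch v) + cnt χ G + ∑[ u < n ] (χ u u)
        ≡⟨ ∑-nonEdges-sym G χ ⟩
      ∑² χ
        ≡⟨ sum-cong-≗ (λ u → trans (∑-const n ⟦ u Fin.≟ v ⟧) (ℕ.*-comm n ⟦ u Fin.≟ v ⟧)) ⟩
      ∑[ u < n ] (⟦ u Fin.≟ v ⟧ * n)
        ≡⟨ ∑-δ v (λ _ → n) ⟩
      n ∎
      where
      χ : Fin n → Fin n → ℕ
      χ a _ = ⟦ a Fin.≟ v ⟧
      one : ∑[ u < n ] (χ u u) ≡ 1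
      one = trans (sum-cong-≗ (λ u → sym (ℕ.*-identityʳ ⟦ u Fin.≟ v ⟧))) (∑-δ v (λ _ → 1))
      cnt≡0 : cnt χ G ≡ 0
      cnt≡0 = begin
        ∑² (λ u w → ⟦ u Fin.≟ v ⟧ * adj G u w)       ≡⟨ sum-cong-≗ (λ u → *-distribˡ-sum ⟦ u Fin.≟ v ⟧ (adj G u)) ⟨
        ∑[ u < n ] (⟦ u Fin.≟ v ⟧ * deg G u)         ≡⟨ ∑-δ v (deg G) ⟩
        deg G v                                      ≡⟨ deg≡0 ⟩
        0                                            ∎

    ∑-touch₂ : ∀ u v → ∑ᴸ (nonEdges G) (touch₂ u v) ≤ 1
    ∑-touch₂ u v = ℕ.≤-trans (ℕ.≤-trans (ℕ.m≤m+n _ (cnt χ G)) (ℕ.m≤m+n _ (∑[ u < n ] (χ u u))))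
      (ℕ.≤-reflexive (trans (∑-nonEdges-sym G χ) total))
      where
      χ : Fin n → Fin n → ℕ
      χ a b = ⟦ a Fin.≟ u ⟧ * ⟦ b Fin.≟ v ⟧
      total : ∑² χ ≡ 1
      total = trans (∑²-cong (λ a b → sym (ℕ.*-identityˡ (χ a b)))) (∑²-δ u v (λ _ _ → 1))

  data Survives (i i′ s : ℕ) : Set where
    spared : s ≡ 0 → i′ ≡ i → Survives i i′ s
    struck : s ≡ 1 → i′ ≡ 0 → Survives i i′ s

  survives : ∀ {i i′ s} → i′ + i * s ≡ i → s ≡ 0 ⊎ s ≡ 1 → Survives i i′ s
  survives {i} {i′} eq (inj₁ refl) = spared refl
    (trans (sym (trans (cong (i′ +_) (ℕ.*-zeroʳ i)) (ℕ.+-identityʳ i′))) eq)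
  survives {i} {i′} eq (inj₂ refl) = struck refl
    (ℕ.+-cancelʳ-≡ i i′ 0 (trans (cong (i′ +_) (sym (ℕ.*-identityʳ i))) eq))

  iso-empty : ∀ n v → iso (emptyGraph n) v ≡ 1
  iso-empty n v = ⟦⟧-yes (deg (emptyGraph n) v ℕ.≟ 0) (∑-zero {n} (λ _ → refl))

  #iso-empty : ∀ n → #iso (emptyGraph n) ≡ n
  #iso-empty n = trans (sum-cong-≗ (iso-empty n)) (∑-1 n)

  ∑ᴸ-sum : ∀ {a} {A : Set a} {m} (xs : List A) (f : Fin m → A → ℕ) →
    ∑ᴸ xs (λ e → ∑[ i < m ] (f i e)) ≡ ∑[ i < m ] (∑ᴸ xs (f i))
  ∑ᴸ-sum {m = m} []       f = sym (sum-replicate-zero m)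
  ∑ᴸ-sum         (x ∷ xs) f = trans (cong (sum (λ i → f i x) +_) (∑ᴸ-sum xs f))
    (sym (∑-distrib-+ (λ i → f i x) (λ i → ∑ᴸ xs (f i))))

  ∑ᴸ-∑² : ∀ {a} {A : Set a} {m} (xs : List A) (f : Fin m → Fin m → A → ℕ) →
    ∑ᴸ xs (λ e → ∑² (λ u v → f u v e)) ≡ ∑² (λ u v → ∑ᴸ xs (f u v))
  ∑ᴸ-∑² {m = m} xs f = trans (∑ᴸ-sum xs (λ u e → ∑[ v < m ] (f u v e))) (sum-cong-≗ (λ u → ∑ᴸ-sum xs (f u)))

  ∑ᴸ-+ : ∀ {a} {A : Set a} (xs : List A) (f g : A → ℕ) → ∑ᴸ xs (λ e → f e + g e) ≡ ∑ᴸ xs f + ∑ᴸ xs g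
  ∑ᴸ-+ []       f g = refl
  ∑ᴸ-+ (x ∷ xs) f g = trans (cong (f x + g x +_) (∑ᴸ-+ xs f g)) (lem (f x) (g x) (∑ᴸ xs f) (∑ᴸ xs g))
    where
    lem : ∀ a b c d → a + b + (c + d) ≡ a + c + (b + d)
    lem = ℕ-solve

  ∑ᴸ-* : ∀ {a} {A : Set a} (xs : List A) c (f : A → ℕ) → ∑ᴸ xs (λ e → c * f e) ≡ c * ∑ᴸ xs f
  ∑ᴸ-* []       c f = sym (ℕ.*-zeroʳ c)
  ∑ᴸ-* (x ∷ xs) c f = trans (cong (c * f x +_) (∑ᴸ-* xs c f)) (sym (ℕ.*-distribˡ-+ c (f x) (∑ᴸ xs f)))

  ∑ᴸ-const : ∀ {a} {A : Set a} (xs : List A) c → ∑ᴸ xs (λ _ → c) ≡ length xs * c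
  ∑ᴸ-const []       c = refl
  ∑ᴸ-const (x ∷ xs) c = cong (c +_) (∑ᴸ-const xs c)

  ∑ᴸ-cong∈ : ∀ {a} {A : Set a} (xs : List A) {f g : A → ℕ} → (∀ x → x ∈ xs → f x ≡ g x) → ∑ᴸ xs f ≡ ∑ᴸ xs g
  ∑ᴸ-cong∈ []       eq = refl
  ∑ᴸ-cong∈ (x ∷ xs) eq = cong₂ _+_ (eq x (here refl)) (∑ᴸ-cong∈ xs (λ y y∈ → eq y (there y∈)))

  module _ {n} (G : Graph n) where

    private
      E = nonEdges G

    iso*∑-touch : ∀ v → iso G v * ∑ᴸ E (touch v) ≡ iso G v * (n ℕ.∸ 1)
    iso*∑-touch v = by-cases (deg G v ℕ.≟ 0)
      where
      by-cases : (d : Dec (deg G v ≡ 0)) → ⟦ d ⟧ * ∑ᴸ E (touch v) ≡ ⟦ d ⟧ * (n ℕ.∸ 1)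
      by-cases (no _)      = refl
      by-cases (yes deg≡0) = cong (1 *_) (trans (sym (ℕ.m+n∸n≡m (∑ᴸ E (touch v)) 1)) (cong (ℕ._∸ 1) (∑-touch G v deg≡0)))

    -- An isolated vertex lies on n - 1 non-edges, and precisely these destroy it. The loss stands
    -- on the left to avoid truncated subtraction.
    ∑-#iso : ∑ᴸ E (λ e → #iso (addEdge G e)) + #iso G * (n ℕ.∸ 1) ≡ length E * #iso G
    ∑-#iso = begin
      ∑ᴸ E (λ e → #iso (addEdge G e)) + #iso G * (n ℕ.∸ 1)
        ≡⟨ cong (∑ᴸ E (λ e → #iso (addEdge G e)) +_) (trans (*-distribʳ-sum (n ℕ.∸ 1) (iso G)) (sym (sum-cong-≗ iso*∑-touch))) ⟩
      ∑ᴸ E (λ e → #iso (addEdge G e)) + ∑[ v < n ] (iso G v * ∑ᴸ E (touch v))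
        ≡⟨ cong (∑ᴸ E (λ e → #iso (addEdge G e)) +_) (trans (∑ᴸ-sum E (λ v e → iso G v * touch v e))
             (sum-cong-≗ (λ v → ∑ᴸ-* E (iso G v) (touch v)))) ⟨
      ∑ᴸ E (λ e → #iso (addEdge G e)) + ∑ᴸ E (λ e → ∑[ v < n ] (iso G v * touch v e))
        ≡⟨ ∑ᴸ-+ E (λ e → #iso (addEdge G e)) (λ e → ∑[ v < n ] (iso G v * touch v e)) ⟨
      ∑ᴸ E (λ e → #iso (addEdge G e) + ∑[ v < n ] (iso G v * touch v e))
        ≡⟨ ∑ᴸ-cong∈ E (λ { e@((a , b) , a<b) e∈ → trans (sym (∑-distrib-+ (iso (addEdge G e)) (λ v → iso G v * touch v e)))
             (sum-cong-≗ (iso-addEdge G a<b (nonEdge⇒≁ G {u<v = a<b} e∈))) }) ⟩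
      ∑ᴸ E (λ _ → #iso G)
        ≡⟨ ∑ᴸ-const E (#iso G) ⟩
      length E * #iso G ∎

    -- Two isolated vertices are hit by 2(n - 1) non-edges counted with multiplicity, but at most
    -- one non-edge joins them and is counted twice. Inclusion-exclusion puts this correction, at
    -- most one per pair, on the right.
    ∑-#iso² : ∑ᴸ E (λ e → #iso² (addEdge G e)) + #iso² G * (2 * (n ℕ.∸ 1)) ≤ length E * #iso² G + #iso² G
    ∑-#iso² = ℕ.≤-trans (ℕ.≤-reflexive lhs) (ℕ.≤-trans (ℕ.≤-reflexive exact) (ℕ.+-monoʳ-≤ (length E * #iso² G) both≤))
      where
      d ii : Fin n → Fin n → ℕ
      d = distinct
      ii u v = iso G u * iso G v
      lhs : ∑ᴸ E (λ e → #iso² (addEdge G e)) + #iso² G * (2 * (n ℕ.∸ 1)) ≡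
            ∑ᴸ E (λ e → #iso² (addEdge G e) + ∑² (λ u v → d u v * ii u v * (touch u e + touch v e)))
      lhs = begin
        ∑ᴸ E (λ e → #iso² (addEdge G e)) + #iso² G * (2 * (n ℕ.∸ 1))
          ≡⟨ cong (∑ᴸ E (λ e → #iso² (addEdge G e)) +_) (trans (*-distribʳ-sum (2 * (n ℕ.∸ 1)) (λ u → ∑[ v < n ] (d u v * ii u v)))
               (sum-cong-≗ (λ u → *-distribʳ-sum (2 * (n ℕ.∸ 1)) (λ v → d u v * ii u v)))) ⟩
        ∑ᴸ E (λ e → #iso² (addEdge G e)) + ∑² (λ u v → d u v * ii u v * (2 * (n ℕ.∸ 1)))
          ≡⟨ cong (∑ᴸ E (λ e → #iso² (addEdge G e)) +_) (∑²-cong (λ u v →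
               trans (spread (d u v) (iso G u) (iso G v) (n ℕ.∸ 1))
                 (cong₂ (λ p q → d u v * iso G v * p + d u v * iso G u * q) (sym (iso*∑-touch u)) (sym (iso*∑-touch v))))) ⟩
        ∑ᴸ E (λ e → #iso² (addEdge G e)) + ∑² (λ u v → d u v * iso G v * (iso G u * ∑ᴸ E (touch u)) + d u v * iso G u * (iso G v * ∑ᴸ E (touch v)))
          ≡⟨ cong (∑ᴸ E (λ e → #iso² (addEdge G e)) +_) (∑²-cong (λ u v →
               trans (gather (d u v) (iso G u) (iso G v) (∑ᴸ E (touch u)) (∑ᴸ E (touch v)))
                 (trans (cong (d u v * ii u v *_) (sym (∑ᴸ-+ E (touch u) (touch v))))
                   (sym (∑ᴸ-* E (d u v * ii u v) (λ e → touch u e + touch v e)))))) ⟩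
        ∑ᴸ E (λ e → #iso² (addEdge G e)) + ∑² (λ u v → ∑ᴸ E (λ e → d u v * ii u v * (touch u e + touch v e)))
          ≡⟨ cong (∑ᴸ E (λ e → #iso² (addEdge G e)) +_) (∑ᴸ-∑² E (λ u v e → d u v * ii u v * (touch u e + touch v e))) ⟨
        ∑ᴸ E (λ e → #iso² (addEdge G e)) + ∑ᴸ E (λ e → ∑² (λ u v → d u v * ii u v * (touch u e + touch v e)))
          ≡⟨ ∑ᴸ-+ E (λ e → #iso² (addEdge G e)) (λ e → ∑² (λ u v → d u v * ii u v * (touch u e + touch v e))) ⟨
        ∑ᴸ E (λ e → #iso² (addEdge G e) + ∑² (λ u v → d u v * ii u v * (touch u e + touch v e))) ∎
        where
        spread : ∀ d i j k → d * (i * j) * (2 * k) ≡ d * j * (i * k) + d * i * (j * k)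
        spread = ℕ-solve
        gather : ∀ d i j s t → d * j * (i * s) + d * i * (j * t) ≡ d * (i * j) * (s + t)
        gather = ℕ-solve
      both : Pair n → ℕ
      both e = ∑² (λ u v → d u v * ii u v * touch₂ u v e)
      pointwise : ∀ e → e ∈ E → ∀ u v →
        d u v * (iso (addEdge G e) u * iso (addEdge G e) v) + d u v * ii u v * (touch u e + touch v e)
          ≡ d u v * ii u v + d u v * ii u v * touch₂ u v e
      pointwise e@((a , b) , a<b) e∈ u v = by-cases (u Fin.≟ v)
        where
        e∉ = nonEdge⇒≁ G {u<v = a<b} e∈
        by-cases : (p : Dec (u ≡ v)) → let δ = ⟦ ¬? p ⟧ in
          δ * (iso (addEdge G e) u * iso (addEdge G e) v) + δ * ii u v * (touch u e + touch v e)
            ≡ δ * ii u v + δ * ii u v * touch₂ u v e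
        by-cases (yes _)  = refl
        by-cases (no u≢v) = trans
          (inclusion-exclusion (iso G u) (iso G v)
            (survives (iso-addEdge G a<b e∉ u) (touch≤1 G a<b e∉ u))
            (survives (iso-addEdge G a<b e∉ v) (touch≤1 G a<b e∉ v)))
          (cong (λ c → 1 * ii u v + 1 * ii u v * c) (touch*touch G a<b e∉ u≢v))
          where
          inclusion-exclusion : ∀ i j {i′ j′ s t} → Survives i i′ s → Survives j j′ t →
            1 * (i′ * j′) + 1 * (i * j) * (s + t) ≡ 1 * (i * j) + 1 * (i * j) * (s * t)
          inclusion-exclusion i j (spared refl refl) (spared refl refl) = refl
          inclusion-exclusion i j (spared refl refl) (struck refl refl) = lem i j
            where
            lem : ∀ i j → 1 * (i * 0) + 1 * (i * j) * 1 ≡ 1 * (i * j) + 1 * (i * j) * 0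
            lem = ℕ-solve
          inclusion-exclusion i j (struck refl refl) (spared refl refl) = lem i j
            where
            lem : ∀ i j → 0 + 1 * (i * j) * 1 ≡ 1 * (i * j) + 1 * (i * j) * 0
            lem = ℕ-solve
          inclusion-exclusion i j (struck refl refl) (struck refl refl) = lem i j
            where
            lem : ∀ i j → 0 + 1 * (i * j) * 2 ≡ 1 * (i * j) + 1 * (i * j) * 1
            lem = ℕ-solve
      exact : ∑ᴸ E (λ e → #iso² (addEdge G e) + ∑² (λ u v → d u v * ii u v * (touch u e + touch v e)))
        ≡ length E * #iso² G + ∑ᴸ E both
      exact = begin
        ∑ᴸ E (λ e → #iso² (addEdge G e) + ∑² (λ u v → d u v * ii u v * (touch u e + touch v e)))
          ≡⟨ ∑ᴸ-cong∈ E (λ e e∈ → trans (sym (∑²-+ (λ u v → d u v * (iso (addEdge G e) u * iso (addEdge G e) v)) (λ u v → d u v * ii u v * (touch u e + touch v e))))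
               (trans (∑²-cong (pointwise e e∈)) (∑²-+ (λ u v → d u v * ii u v) (λ u v → d u v * ii u v * touch₂ u v e)))) ⟩
        ∑ᴸ E (λ e → #iso² G + both e)
          ≡⟨ ∑ᴸ-+ E (λ _ → #iso² G) both ⟩
        ∑ᴸ E (λ _ → #iso² G) + ∑ᴸ E both
          ≡⟨ cong (_+ ∑ᴸ E both) (∑ᴸ-const E (#iso² G)) ⟩
        length E * #iso² G + ∑ᴸ E both ∎
      both≤ : ∑ᴸ E both ≤ #iso² G
      both≤ = ℕ.≤-trans
        (ℕ.≤-reflexive (trans (∑ᴸ-∑² E (λ u v e → d u v * ii u v * touch₂ u v e))
          (∑²-cong (λ u v → ∑ᴸ-* E (d u v * ii u v) (touch₂ u v)))))
        (∑²-mono (λ u v → ℕ.≤-trans (ℕ.*-monoʳ-≤ (d u v * ii u v) (∑-touch₂ G u v)) (ℕ.≤-reflexive (ℕ.*-identityʳ _))))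

module _ where
  open Data.Rational using (_+_; _*_; _-_; -_; _≤_; _<_)
  open ℚ.≤-Reasoning

  module SecondMoment (n : ℕ) (2≤n : 2 ℕ.≤ n) where

    κ : ℚ
    κ = ι (n ℕ.∸ 1)

    -- The probability that an isolated vertex stays so for i steps if M non-edges
    -- are left.
    survival : ℕ → ℕ → ℚ
    survival zero    M       = 1ℚ
    survival (suc i) zero    = 0ℚ
    survival (suc i) (suc m) = (1ℚ - κ * recip m) * survival i m

    survival-lower : ∀ {u} lo → 0 ℕ.< lo → u ≤ 1ℚ → κ ≤ u * ι lo → ∀ i M → i ℕ.+ lo ℕ.≤ M → (1ℚ - u) ^ i ≤ survival i M
    survival-lower lo 0<lo u≤1 κ≤ zero M i+lo≤M = ℚ.≤-refl
    survival-lower {u} lo 0<lo u≤1 κ≤ (suc i) (suc m) (ℕ.s≤s i+lo≤M) =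
      *-mono (a≤b⇒0≤b-a u≤1) (ℚ.≤-trans (0≤^ i (a≤b⇒0≤b-a u≤1)) ih) (ℚ.+-monoʳ-≤ 1ℚ (ℚ.neg-antimono-≤ κr≤u)) ih
      where
      ih = survival-lower lo 0<lo u≤1 κ≤ i m i+lo≤M
      0≤u : 0ℚ ≤ u
      0≤u = *-cancel-≤ (ι lo) (0<ι 0<lo) (begin
        ι lo * 0ℚ ≡⟨ ℚ.*-zeroʳ (ι lo) ⟩
        0ℚ        ≤⟨ 0≤ι (n ℕ.∸ 1) ⟩
        κ         ≤⟨ κ≤ ⟩
        u * ι lo  ≡⟨ ℚ.*-comm u (ι lo) ⟩
        ι lo * u  ∎)
      κr≤u : κ * recip m ≤ u
      κr≤u = begin
        κ * recip m               ≤⟨ *-monoˡ (0≤recip m) (ℚ.≤-trans κ≤ (*-monoʳ 0≤u (ι-mono (ℕ.≤-trans (ℕ.m≤n+m lo i) (ℕ.≤-trans i+lo≤M (ℕ.n≤1+n m)))))) ⟩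
        u * ι (suc m) * recip m   ≡⟨ ℚ.*-assoc u (ι (suc m)) (recip m) ⟩
        u * (ι (suc m) * recip m) ≡⟨ cong (u *_) (ι-recip m) ⟩
        u * 1ℚ                    ≡⟨ ℚ.*-identityʳ u ⟩
        u                         ∎

    -- E (X_end - μ)² for X the number of isolated vertices, bounded through
    -- E X_end and E X_end(X_end - 1).
    Φ : ℚ → ℕ → Graph n → ℚ
    Φ μ i G = P * P * ι (#iso² G) + (1ℚ - (μ + μ)) * P * ι (#iso G) + μ * μ
      where P = survival i (#nonEdges G)

    -- The surplus 1 of `∑-#iso²` must fit into the quadratic term of M(1 - κ/M)² = M - 2κ + κ²/M,
    -- which is the case exactly when M ≤ κ². Thus two isolated vertices survive together no more
    -- often than independent ones would.
    #nonEdges≤κ² : (G : Graph n) → ι (#nonEdges G) ≤ κ * κ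
    #nonEdges≤κ² G = ℚ.≤-trans (ι-mono (ℕ.≤-trans M≤N N≤k²)) (ℚ.≤-reflexive (ι-* (n ℕ.∸ 1) (n ℕ.∸ 1)))
      where
      M≤N : #nonEdges G ℕ.≤ n C 2
      M≤N = #nonEdges≤nC2 G
      N≤k² : n C 2 ℕ.≤ (n ℕ.∸ 1) ℕ.* (n ℕ.∸ 1)
      N≤k² = lem n 2≤n (2*nC2+n≡n² n)
        where
        lem : ∀ n {c} → 2 ℕ.≤ n → 2 ℕ.* c ℕ.+ n ≡ n ℕ.* n → c ℕ.≤ (n ℕ.∸ 1) ℕ.* (n ℕ.∸ 1)
        lem (suc k) {c} (ℕ.s≤s 1≤k) eq = ℕ.*-cancelˡ-≤ 2 (ℕ.+-cancelʳ-≤ (suc k) _ _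
          (ℕ.≤-trans (ℕ.≤-reflexive eq) (ℕ.≤-trans (ℕ.≤-reflexive (sq k))
            (ℕ.+-monoˡ-≤ (suc k) (ℕ.+-monoʳ-≤ (k ℕ.* k) (ℕ.≤-trans (ℕ.≤-reflexive (sym (ℕ.*-identityˡ k)))
              (ℕ.≤-trans (ℕ.*-monoˡ-≤ k 1≤k) (ℕ.≤-reflexive (sym (ℕ.+-identityʳ (k ℕ.* k))))))))))) 
          where
          sq : ∀ k → suc k ℕ.* suc k ≡ k ℕ.* k ℕ.+ k ℕ.+ suc k
          sq = ℕ-solve

    Φ-super : ∀ μ → Supermartingale 1 (Φ μ)
    Φ-super μ i G 1≤M = by-cases (#nonEdges G) refl 1≤M
      where
      by-cases : ∀ M → #nonEdges G ≡ M → 1 ℕ.≤ M →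
        ∑ℚ (nonEdges G) (λ e → Φ μ i (addEdge G e)) ≤ ι (#nonEdges G) * Φ μ (suc i) G
      by-cases (suc m) #≡ _ = begin
        ∑ℚ (nonEdges G) (λ e → Φ μ i (addEdge G e))
          ≡⟨ ∑ℚ-cong (nonEdges G) (λ e e∈ → cong (λ k → let P = survival i k in
               P * P * ι (#iso² (addEdge G e)) + (1ℚ - (μ + μ)) * P * ι (#iso (addEdge G e)) + μ * μ)
               (ℕ.suc-injective (trans (#nonEdges-pred G e∈) #≡))) ⟩
        ∑ℚ (nonEdges G) (λ e → P * P * ι (#iso² (addEdge G e)) + β * ι (#iso (addEdge G e)) + μ * μ)
          ≡⟨ trans (∑ℚ-+ (nonEdges G) _ _) (cong₂ _+_ (∑ℚ-+ (nonEdges G) _ _) (∑ℚ-const (nonEdges G) (μ * μ))) ⟩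
        ∑ℚ (nonEdges G) (λ e → P * P * ι (#iso² (addEdge G e))) + ∑ℚ (nonEdges G) (λ e → β * ι (#iso (addEdge G e))) + ι (#nonEdges G) * (μ * μ)
          ≡⟨ cong₂ (λ a b → a + b + ι (#nonEdges G) * (μ * μ)) (pull (P * P) (λ e → #iso² (addEdge G e))) (pull β (λ e → #iso (addEdge G e))) ⟩
        P * P * S′ + β * X′ + ι (#nonEdges G) * (μ * μ)
          ≤⟨ ℚ.+-monoˡ-≤ (ι (#nonEdges G) * (μ * μ)) (ℚ.+-mono-≤ (*-monoʳ 0≤P² S′≤) (ℚ.≤-reflexive (cong (β *_) X′≡))) ⟩
        P * P * (M * S + S - S * (κ + κ)) + β * (M * X - X * κ) + ι (#nonEdges G) * (μ * μ)
          ≡⟨ cong (λ k → P * P * (M * S + S - S * (κ + κ)) + β * (M * X - X * κ) + ι k * (μ * μ)) #≡ ⟩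
        P * P * (M * S + S - S * (κ + κ)) + β * (M * X - X * κ) + M * (μ * μ)
          ≤⟨ ≤-by (P * P * S * (κ * κ * r - 1ℚ)) (0≤* (0≤* 0≤P² (0≤ι (#iso² G))) (a≤b⇒0≤b-a 1≤κ²r)) ring₁ ⟩
        P * P * S * (M - (κ + κ) * 1ℚ + κ * κ * r * 1ℚ) + (1ℚ - (μ + μ)) * P * X * (M - κ * 1ℚ) + M * (μ * μ)
          -- Writing the coefficient 1 as `M * r` exposes the factors 1 - κr by which `survival`
          -- changes in one step.
          ≡⟨ cong (λ o → P * P * S * (M - (κ + κ) * o + κ * κ * r * o) + (1ℚ - (μ + μ)) * P * X * (M - κ * o) + M * (μ * μ)) (ι-recip m) ⟨
        P * P * S * (M - (κ + κ) * (M * r) + κ * κ * r * (M * r)) + (1ℚ - (μ + μ)) * P * X * (M - κ * (M * r)) + M * (μ * μ)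
          ≡⟨ ring₂ P S M κ r μ X ⟩
        M * (Q * Q * S + (1ℚ - (μ + μ)) * Q * X + μ * μ)
          ≡⟨ cong (λ k → ι k * (survival (suc i) k * survival (suc i) k * S + (1ℚ - (μ + μ)) * survival (suc i) k * X + μ * μ)) #≡ ⟨
        ι (#nonEdges G) * Φ μ (suc i) G ∎
        where
        M = ι (suc m)
        r = recip m
        P = survival i m
        Q = (1ℚ - κ * r) * P
        β = (1ℚ - (μ + μ)) * P
        S = ι (#iso² G)
        X = ι (#iso G)
        S′ = ι (∑ᴸ (nonEdges G) (λ e → #iso² (addEdge G e)))
        X′ = ι (∑ᴸ (nonEdges G) (λ e → #iso (addEdge G e)))
        pull : ∀ c (f : Pair n → ℕ) → ∑ℚ (nonEdges G) (λ e → c * ι (f e)) ≡ c * ι (∑ᴸ (nonEdges G) f)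
        pull c f = trans (∑ℚ-* (nonEdges G) c (ι ∘ f)) (cong (c *_) (∑ℚ-ι (nonEdges G) f))
        0≤P² : 0ℚ ≤ P * P
        0≤P² = 0≤square P
        1≤κ²r : 1ℚ ≤ κ * κ * r
        1≤κ²r = begin
          1ℚ               ≡⟨ ι-recip m ⟨
          M * r            ≡⟨ cong (λ k → ι k * r) #≡ ⟨
          ι (#nonEdges G) * r ≤⟨ *-monoˡ (0≤recip m) (#nonEdges≤κ² G) ⟩
          κ * κ * r        ∎
        X′≡ : X′ ≡ M * X - X * κ
        X′≡ = begin-equality
          X′                       ≡⟨ lem X′ (X * κ) ⟩
          X′ + X * κ - X * κ       ≡⟨ cong (_- X * κ) (trans (cong (λ y → X′ + y) (sym (ι-* (#iso G) (n ℕ.∸ 1)))) (sym (ι-+ (∑ᴸ (nonEdges G) (λ e → #iso (addEdge G e))) _))) ⟩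
          ι (∑ᴸ (nonEdges G) (λ e → #iso (addEdge G e)) ℕ.+ #iso G ℕ.* (n ℕ.∸ 1)) - X * κ
                                   ≡⟨ cong (λ y → ι y - X * κ) (trans (∑-#iso G) (cong (ℕ._* #iso G) #≡)) ⟩
          ι (suc m ℕ.* #iso G) - X * κ
                                   ≡⟨ cong (_- X * κ) (ι-* (suc m) (#iso G)) ⟩
          M * X - X * κ            ∎
          where
          lem : ∀ a b → a ≡ a + b - b
          lem = solve-∀ ℚ-ring
        S′≤ : S′ ≤ M * S + S - S * (κ + κ)
        S′≤ = begin
          S′                       ≡⟨ lem S′ S κ ⟩
          S′ + S * (ι 2 * κ) - S * (κ + κ)
            ≡⟨ cong (_- S * (κ + κ)) (trans (cong (λ y → S′ + y) (trans (cong (S *_) (sym (ι-* 2 (n ℕ.∸ 1)))) (sym (ι-* (#iso² G) (2 ℕ.* (n ℕ.∸ 1))))))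
                 (sym (ι-+ (∑ᴸ (nonEdges G) (λ e → #iso² (addEdge G e))) _))) ⟩
          ι (∑ᴸ (nonEdges G) (λ e → #iso² (addEdge G e)) ℕ.+ #iso² G ℕ.* (2 ℕ.* (n ℕ.∸ 1))) - S * (κ + κ)
            ≤⟨ ℚ.+-monoˡ-≤ (- (S * (κ + κ))) (ι-mono (∑-#iso² G)) ⟩
          ι (#nonEdges G ℕ.* #iso² G ℕ.+ #iso² G) - S * (κ + κ)
            ≡⟨ cong (_- S * (κ + κ)) (trans (ι-+ (#nonEdges G ℕ.* #iso² G) (#iso² G)) (cong (_+ S) (trans (cong (λ k → ι (k ℕ.* #iso² G)) #≡) (ι-* (suc m) (#iso² G))))) ⟩
          M * S + S - S * (κ + κ)  ∎
          where
          lem : ∀ a s k → a ≡ a + s * ((1ℚ + (1ℚ + 0ℚ)) * k) - s * (k + k)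
          lem = solve-∀ ℚ-ring
        ring₁ : P * P * (M * S + S - S * (κ + κ)) + β * (M * X - X * κ) + M * (μ * μ) + P * P * S * (κ * κ * r - 1ℚ)
          ≡ P * P * S * (M - (κ + κ) * 1ℚ + κ * κ * r * 1ℚ) + (1ℚ - (μ + μ)) * P * X * (M - κ * 1ℚ) + M * (μ * μ)
        ring₁ = lem P S M κ r μ X
          where
          lem : ∀ P S M κ r μ X → P * P * (M * S + S - S * (κ + κ)) + (1ℚ - (μ + μ)) * P * (M * X - X * κ) + M * (μ * μ) + P * P * S * (κ * κ * r - 1ℚ)
            ≡ P * P * S * (M - (κ + κ) * 1ℚ + κ * κ * r * 1ℚ) + (1ℚ - (μ + μ)) * P * X * (M - κ * 1ℚ) + M * (μ * μ)
          lem = solve-∀ ℚ-ring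
        ring₂ : ∀ P S M κ r μ X →
          P * P * S * (M - (κ + κ) * (M * r) + κ * κ * r * (M * r)) + (1ℚ - (μ + μ)) * P * X * (M - κ * (M * r)) + M * (μ * μ)
          ≡ M * ((1ℚ - κ * r) * P * ((1ℚ - κ * r) * P) * S + (1ℚ - (μ + μ)) * ((1ℚ - κ * r) * P) * X + μ * μ)
        ring₂ = solve-∀ ℚ-ring

    no-iso : Graph n → ℚ
    no-iso G = ι ⟦ #iso G ℕ.≟ 0 ⟧

    -- Chebyshev's inequality: with no step remaining `Φ μ` equals (X - μ)², which is μ² at X = 0.
    no-iso≤Φ : ∀ μ G → μ * μ * no-iso G ≤ Φ μ 0 G
    no-iso≤Φ μ G = by-cases (#iso G ℕ.≟ 0)
      where
      by-cases : (d : Dec (#iso G ≡ 0)) → μ * μ * ι ⟦ d ⟧ ≤ Φ μ 0 G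
      by-cases (yes X≡0) = begin
        μ * μ * (1ℚ + 0ℚ)
          ≤⟨ ≤-by (ι (#iso² G)) (0≤ι (#iso² G)) (lem μ (ι (#iso² G))) ⟩
        1ℚ * 1ℚ * ι (#iso² G) + (1ℚ - (μ + μ)) * 1ℚ * 0ℚ + μ * μ
          ≡⟨ cong (λ k → 1ℚ * 1ℚ * ι (#iso² G) + (1ℚ - (μ + μ)) * 1ℚ * ι k + μ * μ) X≡0 ⟨
        Φ μ 0 G ∎
        where
        lem : ∀ m s → m * m * (1ℚ + 0ℚ) + s ≡ 1ℚ * 1ℚ * s + (1ℚ - (m + m)) * 1ℚ * 0ℚ + m * m
        lem = solve-∀ ℚ-ring
      by-cases (no _) = begin
        μ * μ * 0ℚ                         ≡⟨ ℚ.*-zeroʳ (μ * μ) ⟩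
        0ℚ                                 ≤⟨ 0≤square (X - μ) ⟩
        (X - μ) * (X - μ)                  ≡⟨ lem₁ X μ ⟩
        X * X - (μ + μ) * X + μ * μ        ≡⟨ cong (λ y → y - (μ + μ) * X + μ * μ) X²≡ ⟩
        S + X - (μ + μ) * X + μ * μ        ≡⟨ lem₂ S X μ ⟩
        Φ μ 0 G                            ∎
        where
        X = ι (#iso G)
        S = ι (#iso² G)
        X²≡ : X * X ≡ S + X
        X²≡ = trans (sym (ι-* (#iso G) (#iso G))) (trans (cong ι (sym (#iso²+#iso G))) (ι-+ (#iso² G) (#iso G)))
        lem₁ : ∀ x m → (x - m) * (x - m) ≡ x * x - (m + m) * x + m * m
        lem₁ = solve-∀ ℚ-ring
        lem₂ : ∀ s x m → s + x - (m + m) * x + m * m ≡ 1ℚ * 1ℚ * s + (1ℚ - (m + m)) * 1ℚ * x + m * m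
        lem₂ = solve-∀ ℚ-ring

    μ : ℕ → ℚ
    μ i = ι n * survival i (n C 2)

    -- With m = nP the initial potential is P²n(n - 1) + (1 - 2m)m + m² = m - P²n, so the variance
    -- is at most the mean and m² times the probability is at most m.
    second-moment-bound : (i : Fin (suc (n C 2))) → toℕ i ℕ.+ 1 ℕ.≤ n C 2 → 0ℚ < μ (toℕ i) →
      μ (toℕ i) * 𝔼 (n C 2) (emptyGraph n) (λ ω → no-iso (lookup ω i)) ≤ 1ℚ
    second-moment-bound i i<N 0<μ = *-cancel-≤ m 0<μ (begin
      m * (m * E)                                        ≡⟨ ℚ.*-assoc m m E ⟨
      m * m * E                                          ≡⟨ 𝔼-* (n C 2) G₀ (m * m) (λ ω → no-iso (lookup ω i)) ⟨
      𝔼 (n C 2) G₀ (λ ω → m * m * no-iso (lookup ω i))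
        ≤⟨ 𝔼-lookup-≤ 1 (Φ m) (Φ-super m) (λ G → m * m * no-iso G) (no-iso≤Φ m) (n C 2) G₀ i
             (ℕ.≤-reflexive (sym (#nonEdges-empty n))) (ℕ.≤-trans i<N (ℕ.≤-reflexive (sym (#nonEdges-empty n)))) ⟩
      Φ m (toℕ i) G₀
        ≡⟨ cong₂ (λ N X → let P = survival (toℕ i) N in P * P * ι (#iso² G₀) + (1ℚ - (m + m)) * P * ι X + m * m) (#nonEdges-empty n) (#iso-empty n) ⟩
      P * P * ι (#iso² G₀) + (1ℚ - (m + m)) * P * ι n + m * m
        ≡⟨ lem₀ P (ι (#iso² G₀)) m (ι n) ⟩
      P * P * (ι (#iso² G₀) + ι n) - P * P * ι n + (1ℚ - (m + m)) * P * ι n + m * m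
        ≡⟨ cong (λ y → P * P * y - P * P * ι n + (1ℚ - (m + m)) * P * ι n + m * m) S+n≡n² ⟩
      P * P * (ι n * ι n) - P * P * ι n + (1ℚ - (m + m)) * P * ι n + m * m
        ≤⟨ ≤-by (P * P * ι n) (0≤* (0≤square P) (0≤ι n)) (lem P (ι n)) ⟩
      m * 1ℚ ∎)
      where
      m = μ (toℕ i)
      G₀ = emptyGraph n
      P = survival (toℕ i) (n C 2)
      E = 𝔼 (n C 2) G₀ (λ ω → no-iso (lookup ω i))
      S+n≡n² : ι (#iso² G₀) + ι n ≡ ι n * ι n
      S+n≡n² = trans (sym (ι-+ (#iso² G₀) n)) (trans (cong ι (subst (λ X → #iso² G₀ ℕ.+ X ≡ X ℕ.* X) (#iso-empty n) (#iso²+#iso G₀))) (ι-* n n))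
      lem₀ : ∀ P s m n → P * P * s + (1ℚ - (m + m)) * P * n + m * m ≡ P * P * (s + n) - P * P * n + (1ℚ - (m + m)) * P * n + m * m
      lem₀ = solve-∀ ℚ-ring
      lem : ∀ P n → P * P * (n * n) - P * P * n + (1ℚ - (n * P + n * P)) * P * n + n * P * (n * P) + P * P * n ≡ n * P * 1ℚ
      lem = solve-∀ ℚ-ring

-- The deterministic argument

module _ where
  open Data.Nat using (_+_; _*_; _≤_; _<_; z≤n; s≤s)

  ∣_∣ˢ : ∀ {n} {P : Fin n → Set} → (∀ v → Dec (P v)) → ℕ
  ∣_∣ˢ {n} P? = ∑[ v < n ] ⟦ P? v ⟧

  edges : ∀ {n} {P Q : Fin n → Set} → (∀ v → Dec (P v)) → (∀ v → Dec (Q v)) → Graph n → ℕ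
  edges P? Q? = cnt (λ u v → ⟦ P? u ⟧ * ⟦ Q? v ⟧)

  infix 4 _⊆ᴳ_
  _⊆ᴳ_ : ∀ {n} → Graph n → Graph n → Set
  G ⊆ᴳ H = ∀ u v → SimpleGraph._~_ G u v → SimpleGraph._~_ H u v

  adj-mono : ∀ {n} {G H : Graph n} → G ⊆ᴳ H → ∀ u v → adj G u v ≤ adj H u v
  adj-mono {G = G} {H} G⊆H u v = ⟦⟧-mono (SimpleGraph._~?_ G u v) (SimpleGraph._~?_ H u v) (G⊆H u v)

  intermediate : ∀ (f : ℕ → ℕ) c m → f 0 < c → c ≤ f m → ∃[ j ] (j < m × f j < c × c ≤ f (suc j))
  intermediate f c zero    f0<c c≤f0 = contradiction c≤f0 (ℕ.<⇒≱ f0<c)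
  intermediate f c (suc m) f0<c c≤fm with c ℕ.≤? f m
  ... | yes c≤f = let j , j<m , rest = intermediate f c m f0<c c≤f in j , ℕ.<-trans j<m (ℕ.n<1+n m) , rest
  ... | no c≰f  = m , ℕ.n<1+n m , ℕ.≰⇒> c≰f , c≤fm

  ∑-at-most-one : ∀ {n} {P : Fin n → Set} (P? : ∀ v → Dec (P v)) → (∀ {u v} → P u → P v → u ≡ v) → ∣ P? ∣ˢ ≤ 1
  ∑-at-most-one {zero}  P? unique = z≤n
  ∑-at-most-one {suc n} P? unique with P? zero
  ... | yes p₀ = ℕ.≤-reflexive (cong suc (∑-zero (λ v → ⟦⟧-no (P? (suc v)) (λ p → contradiction (unique p₀ p) λ ()))))
  ... | no _   = ∑-at-most-one (P? ∘ suc) (λ p q → Fin.suc-injective (unique p q))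

  module Equivalence {n} {_≈_ : Fin n → Fin n → Set} (_≈?_ : ∀ u v → Dec (u ≈ v)) where

    below? : ∀ j v → Dec (∃[ u ] (toℕ u < j × u ≈ v))
    below? j v = Fin.any? (λ u → (toℕ u ℕ.<? j) ×-dec (u ≈? v))

    ∣below∣ : ℕ → ℕ
    ∣below∣ j = ∣ below? j ∣ˢ

    ∣below∣-suc : ∀ r → ∣below∣ (suc (toℕ r)) ≤ ∣below∣ (toℕ r) + ∣ r ≈?_ ∣ˢ
    ∣below∣-suc r = ℕ.≤-trans (∑-mono pointwise) (ℕ.≤-reflexive (∑-distrib-+ (λ v → ⟦ below? (toℕ r) v ⟧) (λ v → ⟦ r ≈? v ⟧)))
      where
      pointwise : ∀ v → ⟦ below? (suc (toℕ r)) v ⟧ ≤ ⟦ below? (toℕ r) v ⟧ + ⟦ r ≈? v ⟧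
      pointwise v = by-cases (below? (suc (toℕ r)) v)
        where
        by-cases : (d : Dec (∃[ u ] (toℕ u < suc (toℕ r) × u ≈ v))) → ⟦ d ⟧ ≤ ⟦ below? (toℕ r) v ⟧ + ⟦ r ≈? v ⟧
        by-cases (no _) = z≤n
        by-cases (yes (u , s≤s u≤r , u≈v)) with ℕ.m≤n⇒m<n∨m≡n u≤r
        ... | inj₁ u<r = ℕ.≤-trans (ℕ.≤-reflexive (sym (⟦⟧-yes (below? (toℕ r) v) (u , u<r , u≈v)))) (ℕ.m≤m+n _ _)
        ... | inj₂ u≡r = ℕ.≤-trans (ℕ.≤-reflexive (sym (⟦⟧-yes (r ≈? v) (subst (_≈ v) (Fin.toℕ-injective u≡r) u≈v)))) (ℕ.m≤n+m _ _)

    -- Add the classes of the vertices 0, 1, 2, ... one after another. When the union first reaches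
    -- `c` it overshoots by less than the class just added.
    initial-classes : (∀ v → v ≈ v) → ∀ c → 1 ≤ c → c ≤ n →
      ∃[ r ] (c ≤ ∣below∣ (suc (toℕ r)) × ∣below∣ (suc (toℕ r)) < c + ∣ r ≈?_ ∣ˢ)
    initial-classes ≈-refl c 1≤c c≤n =
      let j , j<n , fj<c , c≤fj+1 = intermediate ∣below∣ c n f0<c c≤fn
          r = Fin.fromℕ< j<n
          r≡j = Fin.toℕ-fromℕ< j<n
      in r , subst (λ k → c ≤ ∣below∣ (suc k)) (sym r≡j) c≤fj+1 ,
         ℕ.≤-<-trans (∣below∣-suc r) (ℕ.+-monoˡ-< (∣ r ≈?_ ∣ˢ) (subst (λ k → ∣below∣ k < c) (sym r≡j) fj<c))
      where
      f0<c : ∣below∣ 0 < c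
      f0<c = ℕ.≤-trans (s≤s (ℕ.≤-reflexive (∑-zero (λ v → ⟦⟧-no (below? 0 v) (λ ()))))) 1≤c
      c≤fn : c ≤ ∣below∣ n
      c≤fn = ℕ.≤-trans c≤n (ℕ.≤-reflexive (trans (sym (∑-1 n))
        (sum-cong-≗ (λ v → sym (⟦⟧-yes (below? n v) (v , Fin.toℕ<n v , ≈-refl v))))))

  ⟦⟧-×-split : ∀ {p q} {P : Set p} {Q : Set q} (P? : Dec P) (Q? : Dec Q) →
    ⟦ P? ×-dec Q? ⟧ + ⟦ P? ×-dec ¬? Q? ⟧ ≡ ⟦ P? ⟧
  ⟦⟧-×-split (yes _) (yes _) = refl
  ⟦⟧-×-split (yes _) (no _)  = refl
  ⟦⟧-×-split (no _)  _       = refl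

  ⟦⟧-×-split′ : ∀ {p q} {P : Set p} {Q : Set q} (P? : Dec P) (Q? : Dec Q) →
    ⟦ P? ×-dec Q? ⟧ + ⟦ ¬? P? ×-dec Q? ⟧ ≡ ⟦ Q? ⟧
  ⟦⟧-×-split′ (yes _) (yes _) = refl
  ⟦⟧-×-split′ (yes _) (no _)  = refl
  ⟦⟧-×-split′ (no _)  _       = refl

  -- The bound `∣ P? ∣ˢ` in `many-between`, rather than 0, matches a set that sends at most one edge
  -- per vertex into a line. `no-sparse-set` reads the outgoing edges in the earlier graph and the
  -- internal ones in the later, so that it excludes sparse sets in every graph between the two.
  record Expanding {n} (t : ℕ) (G₁ G₂ : Graph n) : Set₁ where
    field
      many-between : ∀ {P Q : Fin n → Set} (P? : ∀ v → Dec (P v)) (Q? : ∀ v → Dec (Q v)) → (∀ v → P v → ¬ Q v) →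
        t ≤ ∣ P? ∣ˢ → t ≤ ∣ Q? ∣ˢ → ∣ P? ∣ˢ < edges P? Q? G₁
      no-sparse-set : ∀ {P : Fin n → Set} (P? : ∀ v → Dec (P v)) → 1 ≤ ∣ P? ∣ˢ → ∣ P? ∣ˢ < t →
        edges P? (¬? ∘ P?) G₁ ≤ ∣ P? ∣ˢ → ¬ (∣ P? ∣ˢ ≤ edges P? P? G₂)

  record IsDecEquivalence {n} (_≈_ : Fin n → Fin n → Set) : Set where
    field
      ≈-refl  : ∀ u → u ≈ u
      ≈-sym   : ∀ {u v} → u ≈ v → v ≈ u
      ≈-trans : ∀ {u v w} → u ≈ v → v ≈ w → u ≈ w
      _≈?_    : ∀ u v → Dec (u ≈ v)

  module _ {n t : ℕ} {G₁ G G₂ : Graph n} (1≤t : 1 ≤ t) (9t≤n : 9 * t ≤ n)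
    (G₁⊆G : G₁ ⊆ᴳ G) (G⊆G₂ : G ⊆ᴳ G₂) (deg≥2 : ∀ v → 2 ≤ deg G v) (expanding : Expanding t G₁ G₂) where

    open Expanding expanding

    no-edges : ∀ {P Q : Fin n → Set} (P? : ∀ v → Dec (P v)) (Q? : ∀ v → Dec (Q v)) →
      (∀ u v → P u → Q v → ¬ SimpleGraph._~_ G u v) → edges P? Q? G₁ ≡ 0
    no-edges P? Q? none = ∑-zero (λ u → ∑-zero (λ v → by-cases u v (P? u) (Q? v) (SimpleGraph._~?_ G₁ u v)))
      where
      by-cases : ∀ u v (p : Dec _) (q : Dec _) (e : Dec _) → ⟦ p ⟧ * ⟦ q ⟧ * ⟦ e ⟧ ≡ 0
      by-cases u v (no _)  _       _       = refl
      by-cases u v (yes _) (no _)  _       = refl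
      by-cases u v (yes _) (yes _) (no _)  = refl
      by-cases u v (yes p) (yes q) (yes e) = contradiction (G₁⊆G u v e) (none u v p q)

    separated⇒small : ∀ {P Q : Fin n → Set} (P? : ∀ v → Dec (P v)) (Q? : ∀ v → Dec (Q v)) → (∀ v → P v → ¬ Q v) →
      (∀ u v → P u → Q v → ¬ SimpleGraph._~_ G u v) → t ≤ ∣ P? ∣ˢ → ∣ Q? ∣ˢ < t
    separated⇒small P? Q? disjoint none t≤P = ℕ.≰⇒> (λ t≤Q →
      contradiction (subst (∣ P? ∣ˢ <_) (no-edges P? Q? none) (many-between P? Q? disjoint t≤P t≤Q)) λ ())

    module _ {_≈_ _≋_ : Fin n → Fin n → Set} (≈-equiv : IsDecEquivalence _≈_) (≋-equiv : IsDecEquivalence _≋_)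
      (≈∩≋ : ∀ {u v} → u ≈ v → u ≋ v → u ≡ v)
      (covers : ∀ u v → SimpleGraph._~_ G u v → u ≈ v ⊎ u ≋ v) where

      open IsDecEquivalence ≈-equiv
      open IsDecEquivalence ≋-equiv using () renaming (≈-sym to ≋-sym; ≈-trans to ≋-trans)
      open SimpleGraph G

      large-class⇒total : ∀ r → t ≤ ∣ r ≈?_ ∣ˢ → ∀ u v → u ≈ v
      large-class⇒total r t≤R u v = ≈-trans (≈-sym (in-R u)) (in-R v)
        where
        R? W? : ∀ v → Dec _
        R? = r ≈?_
        W? = ¬? ∘ R?

        into-R : Fin n → ℕ
        into-R w = ∑[ v < n ] (⟦ R? v ⟧ * adj G w v)

        -- An edge from outside the ≈-class R into R must be a ≋-edge. Two neighbours in R would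
        -- thus be related both ways, through R and through `w`, hence equal.
        into-R≤1 : ∀ w → ¬ (r ≈ w) → into-R w ≤ 1
        into-R≤1 w w∉R = ℕ.≤-trans (ℕ.≤-reflexive (sum-cong-≗ (λ v → product (R? v) (w ~? v))))
          (∑-at-most-one (λ v → R? v ×-dec (w ~? v)) unique)
          where
          product : ∀ {p q} {P : Set p} {Q : Set q} (P? : Dec P) (Q? : Dec Q) → ⟦ P? ⟧ * ⟦ Q? ⟧ ≡ ⟦ P? ×-dec Q? ⟧
          product (yes _) Q? = ℕ.*-identityˡ ⟦ Q? ⟧
          product (no _)  Q? = refl
          ≋-edge : ∀ {v} → r ≈ v → w ~ v → w ≋ v
          ≋-edge r≈v w~v with covers w _ w~v
          ... | inj₁ w≈v = contradiction (≈-trans r≈v (≈-sym w≈v)) w∉R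
          ... | inj₂ w≋v = w≋v
          unique : ∀ {u v} → r ≈ u × w ~ u → r ≈ v × w ~ v → u ≡ v
          unique (r≈u , w~u) (r≈v , w~v) = ≈∩≋ (≈-trans (≈-sym r≈u) r≈v) (≋-trans (≋-sym (≋-edge r≈u w~u)) (≋-edge r≈v w~v))

        ⟦W⟧*into-R≤ : ∀ w (d : Dec (r ≈ w)) → ⟦ ¬? d ⟧ * into-R w ≤ ⟦ ¬? d ⟧
        ⟦W⟧*into-R≤ w (yes _)  = z≤n
        ⟦W⟧*into-R≤ w (no w∉R) = ℕ.≤-trans (ℕ.≤-reflexive (ℕ.*-identityˡ (into-R w))) (into-R≤1 w w∉R)

        edges-W-R : edges W? R? G₁ ≤ ∣ W? ∣ˢ
        edges-W-R = ∑-mono (λ w → ℕ.≤-trans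
          (ℕ.≤-trans (∑-mono (λ v → ℕ.*-monoʳ-≤ (⟦ W? w ⟧ * ⟦ R? v ⟧) (adj-mono {G = G₁} {G} G₁⊆G w v)))
            (ℕ.≤-reflexive (trans (sum-cong-≗ (λ v → ℕ.*-assoc ⟦ W? w ⟧ ⟦ R? v ⟧ (adj G w v)))
              (sym (*-distribˡ-sum ⟦ W? w ⟧ (λ v → ⟦ R? v ⟧ * adj G w v))))))
          (⟦W⟧*into-R≤ w (R? w)))

        edges-W-∁W : edges W? (¬? ∘ W?) G₁ ≡ edges W? R? G₁
        edges-W-∁W = ∑²-cong (λ u v → cong (λ c → ⟦ W? u ⟧ * c * adj G₁ u v) (¬¬ (R? v)))
          where
          ¬¬ : ∀ {p} {P : Set p} (P? : Dec P) → ⟦ ¬? (¬? P?) ⟧ ≡ ⟦ P? ⟧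
          ¬¬ (yes _) = refl
          ¬¬ (no _)  = refl

        ∣W∣<t : ∣ W? ∣ˢ < t
        ∣W∣<t = ℕ.≰⇒> (λ t≤W → ℕ.<⇒≱ (many-between W? R? (λ _ w∉R w∈R → w∉R w∈R) t≤W t≤R) edges-W-R)

        into-W : Fin n → ℕ
        into-W w = ∑[ v < n ] (⟦ W? v ⟧ * adj G₂ w v)

        -- Edges into R stay in `G`, where there is at most one per outside vertex; edges into W are
        -- passed on to the larger `G₂`, in which islands are excluded.
        deg-split : ∀ w → deg G w ≤ into-R w + into-W w
        deg-split w = ℕ.≤-trans (∑-mono pointwise)
          (ℕ.≤-reflexive (∑-distrib-+ (λ v → ⟦ R? v ⟧ * adj G w v) (λ v → ⟦ W? v ⟧ * adj G₂ w v)))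
          where
          pointwise : ∀ v → adj G w v ≤ ⟦ R? v ⟧ * adj G w v + ⟦ W? v ⟧ * adj G₂ w v
          pointwise v = by-cases (R? v)
            where
            by-cases : (d : Dec (r ≈ v)) → adj G w v ≤ ⟦ d ⟧ * adj G w v + ⟦ ¬? d ⟧ * adj G₂ w v
            by-cases (yes _) = ℕ.≤-reflexive (sym (trans (ℕ.+-identityʳ _) (ℕ.*-identityˡ (adj G w v))))
            by-cases (no _)  = ℕ.≤-trans (adj-mono {G = G} {G₂} G⊆G₂ w v) (ℕ.≤-reflexive (sym (ℕ.*-identityˡ (adj G₂ w v))))

        ∣W∣≤edges : ∣ W? ∣ˢ ≤ edges W? W? G₂
        ∣W∣≤edges = ∑-mono (λ w → ℕ.≤-trans (by-cases w (R? w))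
          (ℕ.≤-reflexive (trans (*-distribˡ-sum ⟦ W? w ⟧ (λ v → ⟦ W? v ⟧ * adj G₂ w v))
            (sym (sum-cong-≗ (λ v → ℕ.*-assoc ⟦ W? w ⟧ ⟦ W? v ⟧ (adj G₂ w v)))))))
          where
          by-cases : ∀ w (d : Dec (r ≈ w)) → ⟦ ¬? d ⟧ ≤ ⟦ ¬? d ⟧ * into-W w
          by-cases w (yes _)  = z≤n
          by-cases w (no w∉R) = ℕ.≤-trans
            (ℕ.+-cancelˡ-≤ 1 1 (into-W w) (ℕ.≤-trans (deg≥2 w) (ℕ.≤-trans (deg-split w) (ℕ.+-monoˡ-≤ (into-W w) (into-R≤1 w w∉R)))))
            (ℕ.≤-reflexive (sym (ℕ.*-identityˡ (into-W w))))

        ∣W∣≡0 : ∣ W? ∣ˢ ≡ 0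
        ∣W∣≡0 = ℕ.n<1⇒n≡0 (ℕ.≰⇒> (λ 1≤W → no-sparse-set W? 1≤W ∣W∣<t
          (ℕ.≤-trans (ℕ.≤-reflexive edges-W-∁W) edges-W-R) ∣W∣≤edges))

        in-R : ∀ w → r ≈ w
        in-R w = by-cases (R? w) (ℕ.≤-trans (term≤∑ (λ w → ⟦ W? w ⟧) w) (ℕ.≤-reflexive ∣W∣≡0))
          where
          by-cases : (d : Dec (r ≈ w)) → ⟦ ¬? d ⟧ ≤ 0 → r ≈ w
          by-cases (yes r≈w) _ = r≈w

    -- If no class reaches t, both unions X and Y have sizes in [2t, 3t), so the quadrant outside
    -- both exceeds 2t when n ≥ 9t. Edges stay within one class of either relation and so never join
    -- opposite quadrants: X ∩ Y has fewer than t vertices. Then X minus Y and Y minus X keep at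
    -- least t each, and they are opposite as well. The target 2t is chosen for this last
    -- subtraction.
    one-class : ∀ {_≈_ _≋_ : Fin n → Fin n → Set} → IsDecEquivalence _≈_ → IsDecEquivalence _≋_ →
      (∀ {u v} → u ≈ v → u ≋ v → u ≡ v) →
      (∀ u v → SimpleGraph._~_ G u v → u ≈ v ⊎ u ≋ v) → (∀ u v → u ≈ v) ⊎ (∀ u v → u ≋ v)
    one-class {_≈_} {_≋_} ≈-equiv ≋-equiv ≈∩≋ covers =
      from-classes
        (Equivalence.initial-classes _≈?_ ≈-refl (2 * t) 1≤2t 2t≤n)
        (Equivalence.initial-classes _≋?_ ≋-refl (2 * t) 1≤2t 2t≤n)
      where
      open IsDecEquivalence ≈-equiv
      open IsDecEquivalence ≋-equiv using () renaming (≈-refl to ≋-refl; ≈-sym to ≋-sym; ≈-trans to ≋-trans; _≈?_ to _≋?_)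
      open SimpleGraph G

      1≤2t : 1 ≤ 2 * t
      1≤2t = ℕ.≤-trans 1≤t (ℕ.m≤m+n t (t + 0))
      2t≤n : 2 * t ≤ n
      2t≤n = ℕ.≤-trans (ℕ.*-monoˡ-≤ t (s≤s (s≤s (z≤n {7})))) 9t≤n

      from-classes : ∃[ r ] (2 * t ≤ Equivalence.∣below∣ _≈?_ (suc (toℕ r)) × Equivalence.∣below∣ _≈?_ (suc (toℕ r)) < 2 * t + ∣ r ≈?_ ∣ˢ) →
        ∃[ c ] (2 * t ≤ Equivalence.∣below∣ _≋?_ (suc (toℕ c)) × Equivalence.∣below∣ _≋?_ (suc (toℕ c)) < 2 * t + ∣ c ≋?_ ∣ˢ) →
        (∀ u v → u ≈ v) ⊎ (∀ u v → u ≋ v)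
      from-classes (r , X≥ , X<) (c , Y≥ , Y<) with t ℕ.≤? ∣ r ≈?_ ∣ˢ | t ℕ.≤? ∣ c ≋?_ ∣ˢ
      ... | yes big | _       = inj₁ (large-class⇒total ≈-equiv ≋-equiv ≈∩≋ covers r big)
      ... | no _    | yes big = inj₂ (large-class⇒total ≋-equiv ≈-equiv (λ p q → ≈∩≋ q p) (λ u v e → [ inj₂ , inj₁ ]′ (covers u v e)) c big)
      ... | no r<t  | no c<t  = ⊥-elim impossible
        where
        X Y : Fin n → Set
        X v = ∃[ u ] (toℕ u < suc (toℕ r) × u ≈ v)
        Y v = ∃[ u ] (toℕ u < suc (toℕ c) × u ≋ v)
        X? : ∀ v → Dec (X v)
        X? = Equivalence.below? _≈?_ (suc (toℕ r))
        Y? : ∀ v → Dec (Y v)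
        Y? = Equivalence.below? _≋?_ (suc (toℕ c))
        X-closed : ∀ {u v} → u ≈ v → X u → X v
        X-closed u≈v (w , w< , w≈u) = w , w< , ≈-trans w≈u u≈v
        Y-closed : ∀ {u v} → u ≋ v → Y u → Y v
        Y-closed u≋v (w , w< , w≋u) = w , w< , ≋-trans w≋u u≋v

        XY? : ∀ v → Dec (X v × Y v)
        XY? v = X? v ×-dec Y? v
        Xy? : ∀ v → Dec (X v × ¬ Y v)
        Xy? v = X? v ×-dec ¬? (Y? v)
        xY? : ∀ v → Dec (¬ X v × Y v)
        xY? v = ¬? (X? v) ×-dec Y? v
        xy? : ∀ v → Dec (¬ X v × ¬ Y v)
        xy? v = ¬? (X? v) ×-dec ¬? (Y? v)

        X-split : ∣ XY? ∣ˢ + ∣ Xy? ∣ˢ ≡ ∣ X? ∣ˢ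
        X-split = trans (sym (∑-distrib-+ (λ v → ⟦ XY? v ⟧) (λ v → ⟦ Xy? v ⟧))) (sum-cong-≗ (λ v → ⟦⟧-×-split (X? v) (Y? v)))
        Y-split : ∣ XY? ∣ˢ + ∣ xY? ∣ˢ ≡ ∣ Y? ∣ˢ
        Y-split = trans (sym (∑-distrib-+ (λ v → ⟦ XY? v ⟧) (λ v → ⟦ xY? v ⟧))) (sum-cong-≗ (λ v → ⟦⟧-×-split′ (X? v) (Y? v)))
        n-split : n ≡ ∣ X? ∣ˢ + (∣ xY? ∣ˢ + ∣ xy? ∣ˢ)
        n-split = trans (sym (∑-1 n)) (trans (sum-cong-≗ (λ v → trans (sym (⟦⟧-¬ (X? v))) (ℕ.+-comm ⟦ ¬? (X? v) ⟧ ⟦ X? v ⟧)))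
          (trans (∑-distrib-+ (λ v → ⟦ X? v ⟧) (λ v → ⟦ ¬? (X? v) ⟧)) (cong (∣ X? ∣ˢ +_)
            (trans (sum-cong-≗ (λ v → sym (⟦⟧-×-split (¬? (X? v)) (Y? v)))) (∑-distrib-+ (λ v → ⟦ xY? v ⟧) (λ v → ⟦ xy? v ⟧))))))

        <3t : ∀ {a b} → a < 2 * t + b → ¬ (t ≤ b) → a < 3 * t
        <3t {a} {b} a< t≰b = ℕ.<-≤-trans a< (ℕ.≤-trans (ℕ.+-monoʳ-≤ (2 * t) (ℕ.<⇒≤ (ℕ.≰⇒> t≰b))) (ℕ.≤-reflexive (lem t)))
          where
          lem : ∀ t → 2 * t + t ≡ 3 * t
          lem = ℕ-solve

        t≤xy : t ≤ ∣ xy? ∣ˢ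
        t≤xy = ℕ.≮⇒≥ (λ xy<t → ℕ.<-irrefl refl (ℕ.<-≤-trans (begin-strict
          n                                  ≡⟨ n-split ⟩
          ∣ X? ∣ˢ + (∣ xY? ∣ˢ + ∣ xy? ∣ˢ)    <⟨ ℕ.+-mono-<-≤ (<3t X< r<t) (ℕ.+-mono-≤ (ℕ.≤-trans (ℕ.≤-trans (ℕ.m≤n+m ∣ xY? ∣ˢ ∣ XY? ∣ˢ) (ℕ.≤-reflexive Y-split)) (ℕ.<⇒≤ (<3t Y< c<t))) (ℕ.<⇒≤ xy<t)) ⟩
          3 * t + (3 * t + t)                ≡⟨ lem t ⟩
          7 * t                              ∎) (ℕ.≤-trans (ℕ.*-monoˡ-≤ t (s≤s (s≤s (s≤s (s≤s (s≤s (s≤s (s≤s (z≤n {2}))))))))) 9t≤n)))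
          where
          open ℕ.≤-Reasoning
          lem : ∀ t → 3 * t + (3 * t + t) ≡ 7 * t
          lem = ℕ-solve

        XY<t : ∣ XY? ∣ˢ < t
        XY<t = separated⇒small xy? XY? (λ _ (x , _) (x′ , _) → x x′) none t≤xy
          where
          none : ∀ u v → ¬ X u × ¬ Y u → X v × Y v → ¬ (u ~ v)
          none u v (u∉X , u∉Y) (v∈X , v∈Y) u~v with covers u v u~v
          ... | inj₁ u≈v = u∉X (X-closed (≈-sym u≈v) v∈X)
          ... | inj₂ u≋v = u∉Y (Y-closed (≋-sym u≋v) v∈Y)

        t≤rest : ∀ {a b c} → a + b ≡ c → a < t → 2 * t ≤ c → t ≤ b
        t≤rest {a} {b} refl a<t 2t≤ = ℕ.+-cancelˡ-≤ t t b (ℕ.≤-trans (ℕ.≤-reflexive (cong (t +_) (sym (ℕ.+-identityʳ t))))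
          (ℕ.≤-trans 2t≤ (ℕ.+-monoˡ-≤ b (ℕ.<⇒≤ a<t))))

        impossible : ⊥
        impossible = ℕ.<⇒≱ (separated⇒small Xy? xY? (λ _ (x , _) (x′ , _) → x′ x) none (t≤rest X-split XY<t X≥)) (t≤rest Y-split XY<t Y≥)
          where
          none : ∀ u v → X u × ¬ Y u → ¬ X v × Y v → ¬ (u ~ v)
          none u v (u∈X , u∉Y) (v∉X , v∈Y) u~v with covers u v u~v
          ... | inj₁ u≈v = v∉X (X-closed u≈v u∈X)
          ... | inj₂ u≋v = u∉Y (Y-closed (≋-sym u≋v) v∈Y)

-- Real sequences

module _ where
  open Data.Rational using (_+_; _*_; _-_; -_; _≤_; _<_; ∣_∣)
  open ℚ.≤-Reasoning

  Null : (ℕ → ℚ) → Set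
  Null z = ∀ ε → 0ℚ < ε → ∃[ N ] (∀ i → N ℕ.≤ i → ∣ z i ∣ < ε)

  Null-cong : ∀ {y z} → (∀ i → y i ≡ z i) → Null y → Null z
  Null-cong y≡z Ny ε 0<ε = let N , h = Ny ε 0<ε in N , λ i N≤i → subst (λ t → ∣ t ∣ < ε) (y≡z i) (h i N≤i)

  Null-dominated : ∀ {y z} → (∀ i → ∣ z i ∣ ≤ ∣ y i ∣) → Null y → Null z
  Null-dominated z≤y Ny ε 0<ε = let N , h = Ny ε 0<ε in N , λ i N≤i → ℚ.≤-<-trans (z≤y i) (h i N≤i)

  Null-0 : Null (λ _ → 0ℚ)
  Null-0 ε 0<ε = 0 , λ _ _ → 0<ε

  0<½* : ∀ {ε} → 0ℚ < ε → 0ℚ < ℚ.½ * ε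
  0<½* {ε} 0<ε = subst (_< ℚ.½ * ε) (ℚ.*-zeroʳ ℚ.½) (ℚ.*-monoʳ-<-pos ℚ.½ 0<ε)

  Null-+ : ∀ {y z} → Null y → Null z → Null (λ i → y i + z i)
  Null-+ {y} {z} Ny Nz ε 0<ε =
    let N₁ , h₁ = Ny (ℚ.½ * ε) (0<½* 0<ε)
        N₂ , h₂ = Nz (ℚ.½ * ε) (0<½* 0<ε)
    in N₁ ℕ.⊔ N₂ , λ i N≤i → begin-strict
      ∣ y i + z i ∣          ≤⟨ ℚ.∣p+q∣≤∣p∣+∣q∣ (y i) (z i) ⟩
      ∣ y i ∣ + ∣ z i ∣      <⟨ ℚ.+-mono-< (h₁ i (ℕ.m⊔n≤o⇒m≤o N₁ N₂ N≤i)) (h₂ i (ℕ.m⊔n≤o⇒n≤o N₁ N₂ N≤i)) ⟩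
      ℚ.½ * ε + ℚ.½ * ε      ≡⟨ lem ε ⟩
      ε                      ∎
    where
    lem : ∀ ε → ℚ.½ * ε + ℚ.½ * ε ≡ ε
    lem = solve-∀ ℚ-ring

  Null-neg : ∀ {y} → Null y → Null (λ i → - y i)
  Null-neg {y} = Null-dominated (λ i → ℚ.≤-reflexive (ℚ.∣-p∣≡∣p∣ (y i)))

  Null-half : ∀ {y} → Null (λ i → y i + y i) → Null y
  Null-half {y} = Null-dominated (λ i → begin
    ∣ y i ∣              ≤⟨ ≤-by ∣ y i ∣ (ℚ.0≤∣p∣ (y i)) (lem ∣ y i ∣) ⟩
    ι 2 * ∣ y i ∣        ≡⟨ ℚ.∣p*q∣≡∣p∣*∣q∣ (ι 2) (y i) ⟨
    ∣ ι 2 * y i ∣        ≡⟨ cong ∣_∣ (lem (y i)) ⟨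
    ∣ y i + y i ∣        ∎)
    where
    lem : ∀ a → a + a ≡ (1ℚ + (1ℚ + 0ℚ)) * a
    lem = solve-∀ ℚ-ring

  -- Past the Cauchy index for ε/4, one rational value decides: below ε/2 the tail stays under 3ε/4,
  -- otherwise it stays above ε/4.
  Null-or-apart : (z : ℝ) → ∀ ε → 0ℚ < ε →
    (∃[ N ] (∀ i → N ℕ.≤ i → ∣ seq z i ∣ < ε)) ⊎ (∃[ N ] (∀ i → N ℕ.≤ i → ℚ.½ * (ℚ.½ * ε) ≤ ∣ seq z i ∣))
  Null-or-apart z ε 0<ε = by-cases (∣ seq z N ∣ ℚ.<? ℚ.½ * ε)
    where
    η = ℚ.½ * (ℚ.½ * ε)
    N = proj₁ (cauchy z η (0<½* (0<½* 0<ε)))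
    h = proj₂ (cauchy z η (0<½* (0<½* 0<ε)))
    lem : ∀ a b → a ≡ (a - b) + b
    lem = solve-∀ ℚ-ring
    lem₁ : ∀ ε → ℚ.½ * (ℚ.½ * ε) + ℚ.½ * ε + ℚ.½ * (ℚ.½ * ε) ≡ ε
    lem₁ = solve-∀ ℚ-ring
    lem₂ : ∀ ε t → ℚ.½ * (ℚ.½ * ε) + t - ℚ.½ * ε ≡ t - ℚ.½ * (ℚ.½ * ε)
    lem₂ = solve-∀ ℚ-ring
    triangle : ∀ a b → ∣ a ∣ ≤ ∣ a - b ∣ + ∣ b ∣
    triangle a b = begin
      ∣ a ∣                ≡⟨ cong ∣_∣ (lem a b) ⟩
      ∣ (a - b) + b ∣      ≤⟨ ℚ.∣p+q∣≤∣p∣+∣q∣ (a - b) b ⟩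
      ∣ a - b ∣ + ∣ b ∣    ∎
    by-cases : Dec (∣ seq z N ∣ < ℚ.½ * ε) →
      (∃[ N ] (∀ i → N ℕ.≤ i → ∣ seq z i ∣ < ε)) ⊎ (∃[ N ] (∀ i → N ℕ.≤ i → η ≤ ∣ seq z i ∣))
    by-cases (yes small) = inj₁ (N , λ i N≤i → begin-strict
      ∣ seq z i ∣                            ≤⟨ triangle (seq z i) (seq z N) ⟩
      ∣ seq z i - seq z N ∣ + ∣ seq z N ∣    <⟨ ℚ.+-mono-< (h i N N≤i ℕ.≤-refl) small ⟩
      η + ℚ.½ * ε                            ≤⟨ ≤-by η (ℚ.<⇒≤ (0<½* (0<½* 0<ε))) (lem₁ ε) ⟩
      ε                                      ∎)
    by-cases (no large) = inj₂ (N , λ i N≤i → 0≤b-a⇒a≤b (begin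
      0ℚ                                                 ≤⟨ a≤b⇒0≤b-a (triangle (seq z N) (seq z i)) ⟩
      ∣ seq z N - seq z i ∣ + ∣ seq z i ∣ - ∣ seq z N ∣  ≤⟨ ℚ.+-mono-≤ (ℚ.+-monoˡ-≤ ∣ seq z i ∣ (ℚ.<⇒≤ (h N i ℕ.≤-refl N≤i)))
                                                              (ℚ.neg-antimono-≤ (ℚ.≮⇒≥ large)) ⟩
      η + ∣ seq z i ∣ - ℚ.½ * ε                          ≡⟨ lem₂ ε (∣ seq z i ∣) ⟩
      ∣ seq z i ∣ - η                                    ∎))

  -- For each ε the apartness alternative refutes being null, so a double negation leaves only the
  -- other one. This is what makes classical case distinctions admissible in the proof of rigidity.
  Null-stable : (z : ℝ) → ¬ ¬ Null (seq z) → Null (seq z)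
  Null-stable z ¬¬Nz ε 0<ε = [ id , (λ (N , apart) → ⊥-elim (¬¬Nz (λ Nz →
    let N′ , h = Nz (ℚ.½ * (ℚ.½ * ε)) (0<½* (0<½* 0<ε))
    in ℚ.<-irrefl refl (ℚ.≤-<-trans (apart (N ℕ.⊔ N′) (ℕ.m≤m⊔n N N′)) (h (N ℕ.⊔ N′) (ℕ.m≤n⊔m N N′)))))) ]′
    (Null-or-apart z ε 0<ε)

  ∣∣p∣-∣q∣∣ : ∀ p q → ∣ ∣ p ∣ - ∣ q ∣ ∣ ≡ ∣ p - q ∣ ⊎ ∣ ∣ p ∣ - ∣ q ∣ ∣ ≡ ∣ p + q ∣
  ∣∣p∣-∣q∣∣ p q = by-cases (ℚ.∣p∣≡p∨∣p∣≡-p p) (ℚ.∣p∣≡p∨∣p∣≡-p q)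
    where
    lem₁ : ∀ p q → p - - q ≡ p + q
    lem₁ = solve-∀ ℚ-ring
    lem₂ : ∀ p q → - p - q ≡ - (p + q)
    lem₂ = solve-∀ ℚ-ring
    lem₃ : ∀ p q → - p - - q ≡ - (p - q)
    lem₃ = solve-∀ ℚ-ring
    by-cases : ∣ p ∣ ≡ p ⊎ ∣ p ∣ ≡ - p → ∣ q ∣ ≡ q ⊎ ∣ q ∣ ≡ - q →
      ∣ ∣ p ∣ - ∣ q ∣ ∣ ≡ ∣ p - q ∣ ⊎ ∣ ∣ p ∣ - ∣ q ∣ ∣ ≡ ∣ p + q ∣
    by-cases (inj₁ ep) (inj₁ eq) = inj₁ (cong₂ (λ a b → ∣ a - b ∣) ep eq)
    by-cases (inj₁ ep) (inj₂ eq) = inj₂ (trans (cong₂ (λ a b → ∣ a - b ∣) ep eq) (cong ∣_∣ (lem₁ p q)))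
    by-cases (inj₂ ep) (inj₁ eq) = inj₂ (trans (cong₂ (λ a b → ∣ a - b ∣) ep eq) (trans (cong ∣_∣ (lem₂ p q)) (ℚ.∣-p∣≡∣p∣ (p + q))))
    by-cases (inj₂ ep) (inj₂ eq) = inj₁ (trans (cong₂ (λ a b → ∣ a - b ∣) ep eq) (trans (cong ∣_∣ (lem₃ p q)) (ℚ.∣-p∣≡∣p∣ (p - q))))

  ∣p∣-∣q∣≤∣p-q∣ : ∀ p q → ∣ p ∣ - ∣ q ∣ ≤ ∣ p - q ∣
  ∣p∣-∣q∣≤∣p-q∣ p q = 0≤b-a⇒a≤b (begin
    0ℚ                                   ≤⟨ a≤b⇒0≤b-a (ℚ.∣p+q∣≤∣p∣+∣q∣ (p - q) q) ⟩
    ∣ p - q ∣ + ∣ q ∣ - ∣ (p - q) + q ∣  ≡⟨ cong (λ t → ∣ p - q ∣ + ∣ q ∣ - ∣ t ∣) (lem p q) ⟩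
    ∣ p - q ∣ + ∣ q ∣ - ∣ p ∣            ≡⟨ lem′ (∣ p - q ∣) (∣ q ∣) (∣ p ∣) ⟩
    ∣ p - q ∣ - (∣ p ∣ - ∣ q ∣)          ∎)
    where
    lem : ∀ p q → (p - q) + q ≡ p
    lem = solve-∀ ℚ-ring
    lem′ : ∀ a b c → a + b - c ≡ a - (c - b)
    lem′ = solve-∀ ℚ-ring

  ∣∣p∣-∣q∣∣≤∣p-q∣ : ∀ p q → ∣ ∣ p ∣ - ∣ q ∣ ∣ ≤ ∣ p - q ∣
  ∣∣p∣-∣q∣∣≤∣p-q∣ p q = [ (λ eq → ℚ.≤-trans (ℚ.≤-reflexive eq) (∣p∣-∣q∣≤∣p-q∣ p q)) , negative ]′
    (ℚ.∣p∣≡p∨∣p∣≡-p (∣ p ∣ - ∣ q ∣))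
    where
    neg : ∀ a b → - (a - b) ≡ b - a
    neg = solve-∀ ℚ-ring
    negative : ∣ ∣ p ∣ - ∣ q ∣ ∣ ≡ - (∣ p ∣ - ∣ q ∣) → ∣ ∣ p ∣ - ∣ q ∣ ∣ ≤ ∣ p - q ∣
    negative eq = begin
      ∣ ∣ p ∣ - ∣ q ∣ ∣  ≡⟨ trans eq (neg (∣ p ∣) (∣ q ∣)) ⟩
      ∣ q ∣ - ∣ p ∣      ≤⟨ ∣p∣-∣q∣≤∣p-q∣ q p ⟩
      ∣ q - p ∣          ≡⟨ cong ∣_∣ (neg p q) ⟨
      ∣ - (p - q) ∣      ≡⟨ ℚ.∣-p∣≡∣p∣ (p - q) ⟩
      ∣ p - q ∣          ∎

  -- The sign relating x and y cannot be computed, so the alternative appears in negated form. If x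
  -- - y keeps away from 0, then eventually the difference of absolute values can only be |x + y|,
  -- even if the signs of the terms vary.
  ∣x∣≃∣y∣⇒± : (x y : ℝ) → Defs.∣ x ∣ Defs.≃ Defs.∣ y ∣ →
    ¬ Null (λ i → seq x i - seq y i) → ¬ ¬ Null (λ i → seq x i + seq y i)
  ∣x∣≃∣y∣⇒± x y ∣x∣≃∣y∣ ¬N- ¬N+ = ¬N- N-
    where
    N- : Null (λ i → seq x i - seq y i)
    N- ε 0<ε = [ id , ⊥-elim ∘ apart⇒⊥ ]′ (Null-or-apart (x Defs.- y) ε 0<ε)
      where
      η = ℚ.½ * (ℚ.½ * ε)
      close : ∀ i {ε′} → η ≤ ∣ seq x i - seq y i ∣ → ∣ ∣ seq x i ∣ - ∣ seq y i ∣ ∣ < η → ∣ ∣ seq x i ∣ - ∣ seq y i ∣ ∣ < ε′ →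
        ∣ seq x i + seq y i ∣ < ε′
      close i {ε′} η≤ <η <ε′ =
        [ (λ eq → ⊥-elim (ℚ.<-irrefl refl (ℚ.≤-<-trans η≤ (subst (_< η) eq <η)))) , (λ eq → subst (_< ε′) eq <ε′) ]′
        (∣∣p∣-∣q∣∣ (seq x i) (seq y i))
      apart⇒⊥ : ¬ (∃[ N ] (∀ i → N ℕ.≤ i → η ≤ ∣ seq x i - seq y i ∣))
      apart⇒⊥ (N , apart) = ¬N+ (λ ε′ 0<ε′ →
        let N₁ , h₁ = ∣x∣≃∣y∣ η (0<½* (0<½* 0<ε))
            N₂ , h₂ = ∣x∣≃∣y∣ ε′ 0<ε′
        in N ℕ.⊔ (N₁ ℕ.⊔ N₂) , λ i N≤i →
          let N₁₂≤i = ℕ.m⊔n≤o⇒n≤o N (N₁ ℕ.⊔ N₂) N≤i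
          in close i (apart i (ℕ.m⊔n≤o⇒m≤o N (N₁ ℕ.⊔ N₂) N≤i)) (h₁ i (ℕ.m⊔n≤o⇒m≤o N₁ N₂ N₁₂≤i)) (h₂ i (ℕ.m⊔n≤o⇒n≤o N₁ N₂ N₁₂≤i)))

  ¬¬-decide-all : ∀ {n} (P : Fin n → Set) → ¬ ¬ (∀ i → Dec (P i))
  ¬¬-decide-all {zero}  P k = k λ ()
  ¬¬-decide-all {suc n} P k = ¬¬-decide-all (P ∘ suc) (λ rest →
    k′ (no (λ p → k′ (yes p) rest)) rest)
    where
    k′ : Dec (P zero) → ¬ (∀ i → Dec (P (suc i)))
    k′ d rest = k λ { zero → d ; (suc i) → rest i }

  ¬¬-decide-all₂ : ∀ {m n} (P : Fin m → Fin n → Set) → ¬ ¬ (∀ i j → Dec (P i j))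
  ¬¬-decide-all₂ {zero}  P k = k λ ()
  ¬¬-decide-all₂ {suc m} P k = ¬¬-decide-all (P zero) (λ row →
    ¬¬-decide-all₂ (P ∘ suc) (λ rest → k λ { zero → row ; (suc i) → rest i }))

  -- The equality to be proved says that a real number is null, hence is stable. Under a double
  -- negation the finitely many relations between vertices become decidable, as the combinatorial
  -- argument demands.
  rigid-if-one-class : ∀ {n} (G : Graph n) →
    (∀ {_≈_ _≋_ : Fin n → Fin n → Set} → IsDecEquivalence _≈_ → IsDecEquivalence _≋_ →
      (∀ {u v} → u ≈ v → u ≋ v → u ≡ v) →
      (∀ u v → SimpleGraph._~_ G u v → u ≈ v ⊎ u ≋ v) → (∀ u v → u ≈ v) ⊎ (∀ u v → u ≋ v)) →
    GloballyRigid G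
  rigid-if-one-class {n} G one-class f g f-injective g-injective isometric x y =
    Null-stable (Defs.∣ f x Defs.- f y ∣ Defs.- Defs.∣ g x Defs.- g y ∣) (λ ¬goal →
      ¬¬-decide-all₂ Same (λ same? →
      ¬¬-decide-all₂ Opposite (λ opposite? →
      ¬goal (conclude (one-class (same-equiv same?) (opposite-equiv opposite?) both (covers same? opposite?))))))
    where
    d e : Fin n → Fin n → ℕ → ℚ
    d u v i = seq (f u) i - seq (f v) i
    e u v i = seq (g u) i - seq (g v) i
    Same Opposite : Fin n → Fin n → Set
    Same     u v = Null (λ i → d u v i - e u v i)
    Opposite u v = Null (λ i → d u v i + e u v i)

    same-equiv : (∀ u v → Dec (Same u v)) → IsDecEquivalence Same
    same-equiv same? = record
      { ≈-refl  = λ u → Null-cong (λ i → r (seq (f u) i) (seq (g u) i)) Null-0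
      ; ≈-sym   = λ {u} {v} uv → Null-cong (λ i → s (seq (f u) i) (seq (f v) i) (seq (g u) i) (seq (g v) i)) (Null-neg uv)
      ; ≈-trans = λ {u} {v} {w} uv vw → Null-cong (λ i → t (seq (f u) i) (seq (f v) i) (seq (f w) i) (seq (g u) i) (seq (g v) i) (seq (g w) i)) (Null-+ uv vw)
      ; _≈?_    = same?
      }
      where
      r : ∀ a b → 0ℚ ≡ (a - a) - (b - b)
      r = solve-∀ ℚ-ring
      s : ∀ a b c d → - ((a - b) - (c - d)) ≡ (b - a) - (d - c)
      s = solve-∀ ℚ-ring
      t : ∀ a b c a′ b′ c′ → ((a - b) - (a′ - b′)) + ((b - c) - (b′ - c′)) ≡ (a - c) - (a′ - c′)
      t = solve-∀ ℚ-ring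

    opposite-equiv : (∀ u v → Dec (Opposite u v)) → IsDecEquivalence Opposite
    opposite-equiv opposite? = record
      { ≈-refl  = λ u → Null-cong (λ i → r (seq (f u) i) (seq (g u) i)) Null-0
      ; ≈-sym   = λ {u} {v} uv → Null-cong (λ i → s (seq (f u) i) (seq (f v) i) (seq (g u) i) (seq (g v) i)) (Null-neg uv)
      ; ≈-trans = λ {u} {v} {w} uv vw → Null-cong (λ i → t (seq (f u) i) (seq (f v) i) (seq (f w) i) (seq (g u) i) (seq (g v) i) (seq (g w) i)) (Null-+ uv vw)
      ; _≈?_    = opposite?
      }
      where
      r : ∀ a b → 0ℚ ≡ (a - a) + (b - b)
      r = solve-∀ ℚ-ring
      s : ∀ a b c d → - ((a - b) + (c - d)) ≡ (b - a) + (d - c)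
      s = solve-∀ ℚ-ring
      t : ∀ a b c a′ b′ c′ → ((a - b) + (a′ - b′)) + ((b - c) + (b′ - c′)) ≡ (a - c) + (a′ - c′)
      t = solve-∀ ℚ-ring

    both : ∀ {u v} → Same u v → Opposite u v → u ≡ v
    both {u} {v} same opposite = f-injective (Null-half (Null-cong (λ i → lem (d u v i) (e u v i)) (Null-+ same opposite)))
      where
      lem : ∀ a b → (a - b) + (a + b) ≡ a + a
      lem = solve-∀ ℚ-ring

    covers : (∀ u v → Dec (Same u v)) → (∀ u v → Dec (Opposite u v)) → ∀ u v → SimpleGraph._~_ G u v → Same u v ⊎ Opposite u v
    covers same? opposite? u v u~v = by-cases (same? u v) (opposite? u v)
      where
      by-cases : Dec (Same u v) → Dec (Opposite u v) → Same u v ⊎ Opposite u v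
      by-cases (yes same) _              = inj₁ same
      by-cases (no _)     (yes opposite) = inj₂ opposite
      by-cases (no ¬same) (no ¬opposite) =
        ⊥-elim (∣x∣≃∣y∣⇒± (f u Defs.- f v) (g u Defs.- g v) (isometric u v u~v) ¬same ¬opposite)

    conclude : (∀ u v → Same u v) ⊎ (∀ u v → Opposite u v) → Null (λ i → ∣ d x y i ∣ - ∣ e x y i ∣)
    conclude (inj₁ same)     = Null-dominated (λ i → ∣∣p∣-∣q∣∣≤∣p-q∣ (d x y i) (e x y i)) (same x y)
    conclude (inj₂ opposite) = Null-dominated (λ i → subst (λ t → ∣ ∣ d x y i ∣ - t ∣ ≤ ∣ d x y i + e x y i ∣) (ℚ.∣-p∣≡∣p∣ (e x y i))
      (ℚ.≤-trans (∣∣p∣-∣q∣∣≤∣p-q∣ (d x y i) (- e x y i)) (ℚ.≤-reflexive (cong ∣_∣ (lem (d x y i) (e x y i)))))) (opposite x y)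
      where
      lem : ∀ a b → a - - b ≡ a + b
      lem = solve-∀ ℚ-ring

-- Sums over subsets

module _ where
  open Data.Rational using (_+_; _*_; _-_; -_; _≤_; _<_)
  open ℚ.≤-Reasoning

  subsets : ∀ n → List (Vec Bool n)
  subsets zero    = [] ∷ []
  subsets (suc n) = List.map (true ∷_) (subsets n) List.++ List.map (false ∷_) (subsets n)

  ∈-subsets : ∀ {n} (W : Vec Bool n) → W ∈ subsets n
  ∈-subsets []          = here refl
  ∈-subsets (true  ∷ W) = ∈.∈-++⁺ˡ (∈.∈-map⁺ (true ∷_) (∈-subsets W))
  ∈-subsets (false ∷ W) = ∈.∈-++⁺ʳ (List.map (true ∷_) (subsets _)) (∈.∈-map⁺ (false ∷_) (∈-subsets W))

  member : ∀ {n} → Vec Bool n → Fin n → ℕ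
  member W u = if lookup W u then 1 else 0

  size : ∀ {n} → Vec Bool n → ℕ
  size {n} W = ∑[ u < n ] (member W u)

  ∑-subsets-suc : ∀ {n} (f : Vec Bool (suc n) → ℚ) →
    ∑ℚ (subsets (suc n)) f ≡ ∑ℚ (subsets n) (λ W → f (true ∷ W)) + ∑ℚ (subsets n) (λ W → f (false ∷ W))
  ∑-subsets-suc {n} f = trans (∑ℚ-++ (List.map (true ∷_) (subsets n)) (List.map (false ∷_) (subsets n)) f)
    (cong₂ _+_ (∑ℚ-map (true ∷_) (subsets n) f) (∑ℚ-map (false ∷_) (subsets n) f))

  ∑-subsets-const : ∀ n c → ∑ℚ (subsets n) (λ _ → c) ≡ ι 2 ^ n * c
  ∑-subsets-const zero    c = lem c
    where
    lem : ∀ c → c + 0ℚ ≡ 1ℚ * c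
    lem = solve-∀ ℚ-ring
  ∑-subsets-const (suc n) c = begin-equality
    ∑ℚ (subsets (suc n)) (λ _ → c)                              ≡⟨ ∑-subsets-suc {n} (λ _ → c) ⟩
    ∑ℚ (subsets n) (λ _ → c) + ∑ℚ (subsets n) (λ _ → c)         ≡⟨ cong (λ s → s + s) (∑-subsets-const n c) ⟩
    ι 2 ^ n * c + ι 2 ^ n * c                                   ≡⟨ lem (ι 2 ^ n) c ⟩
    ι 2 * ι 2 ^ n * c                                           ∎
    where
    lem : ∀ p c → p * c + p * c ≡ (1ℚ + (1ℚ + 0ℚ)) * p * c
    lem = solve-∀ ℚ-ring

  -- The product (j + 1)...(j + s); in particular `rising 0 s` is s!.
  rising : ℕ → ℕ → ℚ
  rising j zero    = 1ℚ
  rising j (suc s) = ι (suc j) * rising (suc j) s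

  0≤rising : ∀ j s → 0ℚ ≤ rising j s
  0≤rising j zero    = 0≤1
  0≤rising j (suc s) = 0≤* (0≤ι (suc j)) (0≤rising (suc j) s)

  rising-last : ∀ j s → rising j (suc s) ≡ rising j s * ι (j ℕ.+ suc s)
  rising-last j zero    = trans (ℚ.*-comm (ι (suc j)) 1ℚ) (cong (λ k → 1ℚ * ι k) (ℕ.+-comm 1 j))
  rising-last j (suc s) = begin-equality
    ι (suc j) * rising (suc j) (suc s)                      ≡⟨ cong (ι (suc j) *_) (rising-last (suc j) s) ⟩
    ι (suc j) * (rising (suc j) s * ι (suc j ℕ.+ suc s))    ≡⟨ ℚ.*-assoc (ι (suc j)) (rising (suc j) s) _ ⟨
    rising j (suc s) * ι (suc j ℕ.+ suc s)                  ≡⟨ cong (λ k → rising j (suc s) * ι k) (ℕ.+-suc j (suc s)) ⟨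
    rising j (suc s) * ι (j ℕ.+ suc (suc s))                ∎

  -- A weak Stirling bound, obtained from (1 + 1/s)^s ≤ 3 one factor at a time.
  s^s≤3^s*s! : ∀ s → ι s ^ s ≤ 3ℚ ^ s * rising 0 s
  s^s≤3^s*s! zero    = ℚ.≤ᵇ⇒≤ _
  s^s≤3^s*s! (suc s) = begin
    ι (suc s) * ι (suc s) ^ s                    ≤⟨ *-monoʳ (0≤ι (suc s)) (next s) ⟩
    ι (suc s) * (3ℚ * ι s ^ s)                   ≤⟨ *-monoʳ (0≤ι (suc s)) (*-monoʳ (0≤ι 3) (s^s≤3^s*s! s)) ⟩
    ι (suc s) * (3ℚ * (3ℚ ^ s * rising 0 s))     ≡⟨ lem (ι (suc s)) 3ℚ (3ℚ ^ s) (rising 0 s) ⟩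
    3ℚ * 3ℚ ^ s * (rising 0 s * ι (suc s))       ≡⟨ cong (3ℚ * 3ℚ ^ s *_) (rising-last 0 s) ⟨
    3ℚ ^ suc s * rising 0 (suc s)                ∎
    where
    lem : ∀ a t p r → a * (t * (p * r)) ≡ t * p * (r * a)
    lem = solve-∀ ℚ-ring
    next : ∀ s → ι (suc s) ^ s ≤ 3ℚ * ι s ^ s
    next zero    = ℚ.≤ᵇ⇒≤ _
    next s@(suc k) = begin
      (1ℚ + ι s) ^ s             ≡⟨ cong (_^ s) factor ⟩
      ((1ℚ + σ) * ι s) ^ s       ≡⟨ ^-distrib-* (1ℚ + σ) (ι s) s ⟩
      (1ℚ + σ) ^ s * ι s ^ s     ≤⟨ *-monoˡ (0≤^ s (0≤ι s)) ([1+v]^n≤3 σ s (proj₂ (proj₂ inv)) (ℚ.≤-reflexive sσ≡1)) ⟩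
      3ℚ * ι s ^ s               ∎
      where
      inv = inverse s (ℕ.s≤s ℕ.z≤n)
      σ = proj₁ inv
      sσ≡1 : ι s * σ ≡ 1ℚ
      sσ≡1 = proj₁ (proj₂ inv)
      factor : 1ℚ + ι s ≡ (1ℚ + σ) * ι s
      factor = begin-equality
        1ℚ + ι s           ≡⟨ cong (_+ ι s) sσ≡1 ⟨
        ι s * σ + ι s      ≡⟨ lem′ (ι s) σ ⟩
        (1ℚ + σ) * ι s     ∎
        where
        lem′ : ∀ s σ → s * σ + s ≡ (1ℚ + σ) * s
        lem′ = solve-∀ ℚ-ring

  -- An exponential generating function: without the condition on n τ the
  -- bound would be (1 - n τ)^-(j+1).
  ∑-rising : ∀ n j τ → 0ℚ ≤ τ → ι 5 * (ι n * τ) ≤ 1ℚ →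
    ∑ℚ (subsets n) (λ W → rising j (size W) * τ ^ size W) ≤ (1ℚ + ι 2 * (ι n * τ)) ^ suc j
  ∑-rising zero    j τ 0≤τ 5nτ≤1 = begin
    1ℚ * 1ℚ + 0ℚ                          ≡⟨⟩
    1ℚ                                    ≡⟨ 1^ (suc j) ⟨
    1ℚ ^ suc j                            ≡⟨ cong (_^ suc j) (lem τ) ⟩
    (1ℚ + ι 2 * (0ℚ * τ)) ^ suc j         ∎
    where
    lem : ∀ τ → 1ℚ ≡ 1ℚ + (1ℚ + (1ℚ + 0ℚ)) * (0ℚ * τ)
    lem = solve-∀ ℚ-ring
  ∑-rising (suc n) j τ 0≤τ 5nτ≤1 = begin
    ∑ℚ (subsets (suc n)) (λ W → rising j (size W) * τ ^ size W)
      ≡⟨ ∑-subsets-suc {n} (λ W → rising j (size W) * τ ^ size W) ⟩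
    ∑ℚ (subsets n) (λ W → ι (suc j) * rising (suc j) (size W) * (τ * τ ^ size W)) + ∑ℚ (subsets n) (λ W → rising j (size W) * τ ^ size W)
      ≡⟨ cong (_+ ∑ℚ (subsets n) (λ W → rising j (size W) * τ ^ size W))
           (trans (∑ℚ-cong (subsets n) (λ W _ → swap (ι (suc j)) (rising (suc j) (size W)) τ (τ ^ size W)))
             (∑ℚ-* (subsets n) (ι (suc j) * τ) (λ W → rising (suc j) (size W) * τ ^ size W))) ⟩
    ι (suc j) * τ * ∑ℚ (subsets n) (λ W → rising (suc j) (size W) * τ ^ size W) + ∑ℚ (subsets n) (λ W → rising j (size W) * τ ^ size W)
      ≤⟨ ℚ.+-mono-≤ (*-monoʳ (0≤* (0≤ι (suc j)) 0≤τ) (∑-rising n (suc j) τ 0≤τ 5nτ≤1′)) (∑-rising n j τ 0≤τ 5nτ≤1′) ⟩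
    ι (suc j) * τ * (D * (D * D ^ j)) + D * D ^ j
      -- Raising the index j costs one extra factor `D`; since D² ≤ 2, the new element contributes
      -- at most 2τ per unit of `ι (suc j)`, as `bernoulli⁺` expects.
      ≤⟨ ≤-by (ι (suc j) * τ * D ^ j * (ι 2 - D * D)) (0≤* (0≤* (0≤* (0≤ι (suc j)) 0≤τ) (0≤^ j 0≤D)) (a≤b⇒0≤b-a D²≤2)) (lem (ι (suc j)) τ D (D ^ j)) ⟩
    D ^ j * (D + ι (suc j) * (ι 2 * τ))
      ≤⟨ bernoulli⁺ (ι 2 * τ) D j (0≤* (0≤ι 2) 0≤τ) 0≤D ⟩
    (D + ι 2 * τ) ^ suc j
      ≡⟨ cong (_^ suc j) (lem′ (ι n) τ) ⟩
    (1ℚ + ι 2 * (ι (suc n) * τ)) ^ suc j ∎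
    where
    D = 1ℚ + ι 2 * (ι n * τ)
    0≤nτ : 0ℚ ≤ ι n * τ
    0≤nτ = 0≤* (0≤ι n) 0≤τ
    0≤D : 0ℚ ≤ D
    0≤D = 0≤+ 0≤1 (0≤* (0≤ι 2) 0≤nτ)
    5nτ≤1′ : ι 5 * (ι n * τ) ≤ 1ℚ
    5nτ≤1′ = ℚ.≤-trans (*-monoʳ (0≤ι 5) (*-monoˡ 0≤τ (ι-mono (ℕ.n≤1+n n)))) 5nτ≤1
    -- With y = nτ ≤ 1/5, D is at most 7/5. The constants are a certificate: 2 - (1 + 2y)² is a
    -- combination of 1 - 5y, (1 - 5y)y and 1 with coefficients 24/25, 4/5 and 1/25.
    D²≤2 : D * D ≤ ι 2
    D²≤2 = 0≤b-a⇒a≤b (begin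
      0ℚ ≤⟨ 0≤+ (0≤* 0≤c₁ (a≤b⇒0≤b-a 5nτ≤1′)) (0≤+ (0≤* 0≤c₂ (0≤* (a≤b⇒0≤b-a 5nτ≤1′) 0≤nτ)) 0≤c₃) ⟩
      c₁ * (1ℚ - ι 5 * (ι n * τ)) + (c₂ * ((1ℚ - ι 5 * (ι n * τ)) * (ι n * τ)) + c₃) ≡⟨ poly (ι n * τ) ⟩
      ι 2 - D * D ∎)
      where
      c₁ c₂ c₃ : ℚ
      c₁ = ℤ.+ 24 ℚ./ 25
      c₂ = ℤ.+ 4 ℚ./ 5
      c₃ = ℤ.+ 1 ℚ./ 25
      0≤c₁ : 0ℚ ≤ c₁
      0≤c₁ = ℚ.≤ᵇ⇒≤ _
      0≤c₂ : 0ℚ ≤ c₂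
      0≤c₂ = ℚ.≤ᵇ⇒≤ _
      0≤c₃ : 0ℚ ≤ c₃
      0≤c₃ = ℚ.≤ᵇ⇒≤ _
      poly : ∀ y → (ℤ.+ 24 ℚ./ 25) * (1ℚ - (1ℚ + (1ℚ + (1ℚ + (1ℚ + (1ℚ + 0ℚ))))) * y)
        + ((ℤ.+ 4 ℚ./ 5) * ((1ℚ - (1ℚ + (1ℚ + (1ℚ + (1ℚ + (1ℚ + 0ℚ))))) * y) * y) + (ℤ.+ 1 ℚ./ 25))
        ≡ (1ℚ + (1ℚ + 0ℚ)) - (1ℚ + (1ℚ + (1ℚ + 0ℚ)) * y) * (1ℚ + (1ℚ + (1ℚ + 0ℚ)) * y)
      poly = solve-∀ ℚ-ring
    swap : ∀ a r t p → a * r * (t * p) ≡ a * t * (r * p)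
    swap = solve-∀ ℚ-ring
    lem : ∀ a t D p → a * t * (D * (D * p)) + D * p + a * t * p * ((1ℚ + (1ℚ + 0ℚ)) - D * D) ≡ p * (D + a * ((1ℚ + (1ℚ + 0ℚ)) * t))
    lem = solve-∀ ℚ-ring
    lem′ : ∀ n t → 1ℚ + (1ℚ + (1ℚ + 0ℚ)) * (n * t) + (1ℚ + (1ℚ + 0ℚ)) * t ≡ 1ℚ + (1ℚ + (1ℚ + 0ℚ)) * ((1ℚ + n) * t)
    lem′ = solve-∀ ℚ-ring

  -- The number of sets of size s is at most n^s/s!, and s^s exceeds s! by at most 3^s, so the sum
  -- is dominated by a geometric series in 3nT. The leading 1 is the empty set.
  ∑-[sT]^s : ∀ n T → 0ℚ ≤ T → ι 15 * (ι n * T) ≤ 1ℚ →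
    ∑ℚ (subsets n) (λ W → (ι (size W) * T) ^ size W) ≤ 1ℚ + ι 6 * (ι n * T)
  ∑-[sT]^s n T 0≤T 15nT≤1 = begin
    ∑ℚ (subsets n) (λ W → (ι (size W) * T) ^ size W)
      ≤⟨ ∑ℚ-mono (subsets n) (λ W _ → term (size W)) ⟩
    ∑ℚ (subsets n) (λ W → rising 0 (size W) * (3ℚ * T) ^ size W)
      ≤⟨ ∑-rising n 0 (3ℚ * T) (0≤* (0≤ι 3) 0≤T) (ℚ.≤-trans (ℚ.≤-reflexive (lem (ι n) T)) 15nT≤1) ⟩
    (1ℚ + ι 2 * (ι n * (3ℚ * T))) ^ 1
      ≡⟨ lem′ (ι n) T ⟩
    1ℚ + ι 6 * (ι n * T) ∎
    where
    lem : ∀ n T → ι 5 * (n * (ι 3 * T)) ≡ ι 15 * (n * T)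
    lem n T = trans (l (ι 5) (ι 3) n T) refl
      where
      l : ∀ a b n T → a * (n * (b * T)) ≡ (a * b) * (n * T)
      l = solve-∀ ℚ-ring
    lem′ : ∀ n T → (1ℚ + ι 2 * (n * (ι 3 * T))) * 1ℚ ≡ 1ℚ + ι 6 * (n * T)
    lem′ n T = trans (ℚ.*-identityʳ _) (cong (1ℚ +_) (trans (l (ι 2) (ι 3) n T) refl))
      where
      l : ∀ a b n T → a * (n * (b * T)) ≡ (a * b) * (n * T)
      l = solve-∀ ℚ-ring
    term : ∀ s → (ι s * T) ^ s ≤ rising 0 s * (3ℚ * T) ^ s
    term s = begin
      (ι s * T) ^ s                     ≡⟨ ^-distrib-* (ι s) T s ⟩
      ι s ^ s * T ^ s                   ≤⟨ *-monoˡ (0≤^ s 0≤T) (s^s≤3^s*s! s) ⟩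
      3ℚ ^ s * rising 0 s * T ^ s       ≡⟨ l (3ℚ ^ s) (rising 0 s) (T ^ s) ⟩
      rising 0 s * (3ℚ ^ s * T ^ s)     ≡⟨ cong (rising 0 s *_) (^-distrib-* 3ℚ T s) ⟨
      rising 0 s * (3ℚ * T) ^ s         ∎
      where
      l : ∀ a b c → a * b * c ≡ b * (a * c)
      l = solve-∀ ℚ-ring

-- Probability estimates

module _ where
  open Data.Nat using (_+_; _*_; _≤_; _<_; z≤n; s≤s)
  open ≡-Reasoning

  member≤1 : ∀ {n} (W : Vec Bool n) u → member W u ≤ 1
  member≤1 W u = by-cases (lookup W u)
    where
    by-cases : ∀ b → (if b then 1 else 0) ≤ 1
    by-cases true  = s≤s z≤n
    by-cases false = z≤n

  ∁ : ∀ {n} → Vec Bool n → Vec Bool n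
  ∁ = Vec.map not

  between : ∀ {n} → Vec Bool n → Vec Bool n → Fin n → Fin n → ℕ
  between S T u v = member S u * member T v

  member-∁ : ∀ {n} (W : Vec Bool n) u → member W u + member (∁ W) u ≡ 1
  member-∁ W u rewrite Vec.lookup-map u not W = by-cases (lookup W u)
    where
    by-cases : ∀ b → (if b then 1 else 0) + (if not b then 1 else 0) ≡ 1
    by-cases true  = refl
    by-cases false = refl

  size-∁ : ∀ {n} (W : Vec Bool n) → size W + size (∁ W) ≡ n
  size-∁ {n} W = trans (sym (∑-distrib-+ (member W) (member (∁ W)))) (trans (sum-cong-≗ (member-∁ W)) (∑-1 n))

  ∑²-between : ∀ {n} (S T : Vec Bool n) → ∑² (between S T) ≡ size S * size T
  ∑²-between {n} S T = begin
    ∑² (between S T)                    ≡⟨ sum-cong-≗ (λ u → *-distribˡ-sum (member S u) (member T)) ⟨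
    ∑[ u < n ] (member S u * size T)    ≡⟨ *-distribʳ-sum (size T) (member S) ⟨
    size S * size T                     ∎

  Disjoint : ∀ {n} → Vec Bool n → Vec Bool n → Set
  Disjoint S T = ∀ u → member S u * member T u ≡ 0

  ∁-disjoint : ∀ {n} (W : Vec Bool n) → Disjoint W (∁ W)
  ∁-disjoint W u = lem (member W u) (member (∁ W) u) (member-∁ W u)
    where
    lem : ∀ a b → a + b ≡ 1 → a * b ≡ 0
    lem zero          b _  = refl
    lem (suc zero)    zero    _ = refl
    lem (suc (suc a)) b ()

  kind-between : ∀ {n} (S T : Vec Bool n) → Disjoint S T → ∀ a b → Kind (between S T a b + between S T b a) 0
  kind-between S T disjoint a b =
    lem (member≤1 S a) (member≤1 T b) (member≤1 S b) (member≤1 T a) (disjoint a)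
    where
    lem : ∀ {p q r s} → p ≤ 1 → q ≤ 1 → r ≤ 1 → s ≤ 1 → p * s ≡ 0 → Kind (p * q + r * s) 0
    lem z≤n       _         z≤n       _         _ = neutral refl refl
    lem z≤n       _         (s≤s z≤n) z≤n       _ = neutral refl refl
    lem z≤n       _         (s≤s z≤n) (s≤s z≤n) _ = crossing refl refl
    lem (s≤s z≤n) z≤n       z≤n       z≤n       _ = neutral refl refl
    lem (s≤s z≤n) z≤n       (s≤s z≤n) z≤n       _ = neutral refl refl
    lem (s≤s z≤n) (s≤s z≤n) z≤n       z≤n       _ = crossing refl refl
    lem (s≤s z≤n) (s≤s z≤n) (s≤s z≤n) z≤n       _ = crossing refl refl

  kind-cut : ∀ {n} (W : Vec Bool n) a b →
    Kind (between W (∁ W) a b + between W (∁ W) b a) (between W W a b + between W W b a)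
  kind-cut W a b = lem (member≤1 W a) (member≤1 W b) (member-∁ W a) (member-∁ W b)
    where
    lem : ∀ {p q p′ q′} → p ≤ 1 → q ≤ 1 → p + p′ ≡ 1 → q + q′ ≡ 1 → Kind (p * q′ + q * p′) (p * q + q * p)
    lem z≤n       z≤n       refl refl = neutral refl refl
    lem z≤n       (s≤s z≤n) refl refl = crossing refl refl
    lem (s≤s z≤n) z≤n       refl refl = crossing refl refl
    lem (s≤s z≤n) (s≤s z≤n) refl refl = internal refl refl

-- Choice of the parameters

module _ where
  open Data.Nat using (_+_; _*_; _∸_; _/_; _≤_; _<_; z≤n; s≤s)
  open ℕ.≤-Reasoning

  -- L is the logarithm of n to base 2^86, and the process is observed after
  -- m₁ = 24nL and m₂ = 72nL steps.  At time m₁ a given vertex is isolated with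
  -- probability at least 2^-85L, while a set of s vertices (s ≤ n/24) sends at
  -- most s edges to its complement with probability at most (24 · 2^-44L)^s; what
  -- matters is 85 < 86 and 44 > 86/2.
  record Regime (n L K : ℕ) : Set where
    field
      1≤K     : 1 ≤ K
      1152≤L  : 1152 ≤ L
      p^86≤n  : (2 ℕ.^ L) ℕ.^ 86 ≤ n
      n≤Kp^86 : n ≤ K * (2 ℕ.^ L) ℕ.^ 86
      -- 432 = 18 * 24: the factor 24 is the inverse of the crossing weight, and 18 = 3 * 6 arises
      -- when summing over all sets. One L comes from the internal weight, the other from the wish
      -- to bound each failure by 1/L.
      432KL²≤p : 432 * (K * (L * L)) ≤ 2 ℕ.^ L

  module Parameters {n L K : ℕ} (regime : Regime n L K) where
    open Regime regime public

    pℕ : ℕ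
    pℕ = 2 ℕ.^ L

    1≤L : 1 ≤ L
    1≤L = ℕ.≤-trans (ℕ.s≤s ℕ.z≤n) 1152≤L

    1≤pℕ : 1 ≤ pℕ
    1≤pℕ = ℕ.m^n>0 2 L

    p≤n : pℕ ≤ n
    p≤n = ℕ.≤-trans (ℕ.≤-trans (ℕ.≤-reflexive (sym (ℕ.^-identityʳ pℕ)))
      (ℕ.^-monoʳ-≤ pℕ {{ℕ.>-nonZero 1≤pℕ}} (ℕ.s≤s {0} {85} ℕ.z≤n))) p^86≤n

    L²≤KL² : L * L ≤ K * (L * L)
    L²≤KL² = ℕ.≤-trans (ℕ.≤-reflexive (sym (ℕ.*-identityˡ (L * L)))) (ℕ.*-monoˡ-≤ (L * L) 1≤K)

    1152L≤n : 1152 * L ≤ n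
    1152L≤n = ℕ.≤-trans (ℕ.*-monoˡ-≤ L 1152≤L) (ℕ.≤-trans L²≤KL² (ℕ.≤-trans (ℕ.m≤n*m (K * (L * L)) 432) (ℕ.≤-trans 432KL²≤p p≤n)))

    L≤p : L ≤ pℕ
    L≤p = ℕ.≤-trans (ℕ.m≤m*n L L {{ℕ.>-nonZero 1≤L}}) (ℕ.≤-trans L²≤KL² (ℕ.≤-trans (ℕ.m≤n*m (K * (L * L)) 432) 432KL²≤p))

    1≤n : 1 ≤ n
    1≤n = ℕ.≤-trans 1≤pℕ p≤n

    m₁ m₂ t : ℕ
    m₁ = 24 * (n * L)
    m₂ = 72 * (n * L)
    t  = n / 24

    N lo : ℕ
    N  = n C 2
    lo = N ∸ m₂

    2N+n≡n² : 2 * N + n ≡ n * n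
    2N+n≡n² = 2*nC2+n≡n² n

    -- Terms of order nL, such as `m₁` and `m₂`, are absorbed into n² through 1152L ≤ n.
    n*[aL+b]≤n² : ∀ a b → a + b ≤ 1152 → n * (a * L + b) ≤ n * n
    n*[aL+b]≤n² a b a+b≤ = ℕ.*-monoʳ-≤ n (ℕ.≤-trans (ℕ.+-monoʳ-≤ (a * L) (ℕ.m≤m*n b L {{ℕ.>-nonZero 1≤L}}))
      (ℕ.≤-trans (ℕ.≤-reflexive (sym (ℕ.*-distribʳ-+ L a b))) (ℕ.≤-trans (ℕ.*-monoˡ-≤ L a+b≤) 1152L≤n)))

    m₂≤N : m₂ ≤ N
    m₂≤N = ℕ.*-cancelˡ-≤ 2 (ℕ.+-cancelʳ-≤ n _ _ (ℕ.≤-trans (ℕ.≤-reflexive (lem n L))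
      (ℕ.≤-trans (n*[aL+b]≤n² 144 1 (ℕ.≤ᵇ⇒≤ 145 1152 _)) (ℕ.≤-reflexive (sym 2N+n≡n²)))))
      where
      lem : ∀ n L → 2 * (72 * (n * L)) + n ≡ n * (144 * L + 1)
      lem = ℕ-solve

    m₁≤m₂ : m₁ ≤ m₂
    m₁≤m₂ = ℕ.*-monoˡ-≤ (n * L) (ℕ.≤ᵇ⇒≤ 24 72 _)

    m₁≤N : m₁ ≤ N
    m₁≤N = ℕ.≤-trans m₁≤m₂ m₂≤N

    i₁ i₂ : Fin (suc N)
    i₁ = Fin.fromℕ< (ℕ.s≤s m₁≤N)
    i₂ = Fin.fromℕ< (ℕ.s≤s m₂≤N)

    toℕ-i₁ : toℕ i₁ ≡ m₁
    toℕ-i₁ = Fin.toℕ-fromℕ< (ℕ.s≤s m₁≤N)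

    toℕ-i₂ : toℕ i₂ ≡ m₂
    toℕ-i₂ = Fin.toℕ-fromℕ< (ℕ.s≤s m₂≤N)

    n²≤8lo : n * n ≤ 8 * lo
    n²≤8lo = ℕ.+-cancelʳ-≤ (8 * m₂ + 4 * n) _ _ (begin
      n * n + (8 * m₂ + 4 * n)              ≡⟨ cong (n * n +_) (lem₁ n L) ⟩
      n * n + n * (576 * L + 4)             ≤⟨ ℕ.+-monoʳ-≤ (n * n) (n*[aL+b]≤n² 576 4 (ℕ.≤ᵇ⇒≤ 580 1152 _)) ⟩
      n * n + n * n                             ≤⟨ ℕ.m≤m+n _ (2 * (n * n)) ⟩
      n * n + n * n + 2 * (n * n)         ≡⟨ lem₂ (n * n) ⟩
      4 * (n * n)                                 ≡⟨ cong (4 *_) 2N+n≡n² ⟨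
      4 * (2 * N + n)                           ≡⟨ cong (λ k → 4 * (2 * k + n)) (ℕ.m∸n+n≡m m₂≤N) ⟨
      4 * (2 * (lo + m₂) + n)                 ≡⟨ lem₃ lo m₂ n ⟩
      8 * lo + (8 * m₂ + 4 * n)             ∎)
      where
      lem₁ : ∀ n L → 8 * (72 * (n * L)) + 4 * n ≡ n * (576 * L + 4)
      lem₁ = ℕ-solve
      lem₂ : ∀ a → a + a + 2 * a ≡ 4 * a
      lem₂ = ℕ-solve
      lem₃ : ∀ a b c → 4 * (2 * (a + b) + c) ≡ 8 * a + (8 * b + 4 * c)
      lem₃ = ℕ-solve

    24t≤n : 24 * t ≤ n
    24t≤n = ℕ.≤-trans (ℕ.≤-reflexive (ℕ.*-comm 24 t)) (ℕ.m/n*n≤m n 24)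

    n≤24[1+t] : n ≤ 24 * suc t
    n≤24[1+t] = ℕ.≤-trans (ℕ.≤-reflexive (ℕ.m≡m%n+[m/n]*n n 24))
      (ℕ.≤-trans (ℕ.+-monoˡ-≤ (t * 24) (ℕ.<⇒≤ (ℕ.m%n<n n 24))) (ℕ.≤-reflexive (lem t)))
      where
      lem : ∀ t → 24 + t * 24 ≡ 24 * suc t
      lem = ℕ-solve


    -- Sets of n/24 vertices would allow about 288 in place of 1104. The larger constant covers
    -- rounding once t ≥ 3, and 1104 = 23 * 48 cancels well against the factor 23/24 of the crossing
    -- weight.
    N≤1104[ST-S] : ∀ {a b} → t ≤ a → t ≤ b → N + 1104 * a ≤ 1104 * (a * b)
    N≤1104[ST-S] {a} {b} t≤a t≤b = ℕ.*-cancelˡ-≤ 2 (begin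
      2 * (N + 1104 * a)                                   ≡⟨ ℕ.*-distribˡ-+ 2 N (1104 * a) ⟩
      2 * N + 2 * (1104 * a)                               ≤⟨ ℕ.+-monoˡ-≤ (2 * (1104 * a)) 2N≤ ⟩
      24 * suc t * (24 * suc t) + 2 * (1104 * a)           ≤⟨ lem t a b 3≤t t≤a t≤b ⟩
      2 * (1104 * (a * b))                                 ∎)
      where
      2N≤ : 2 * N ≤ 24 * suc t * (24 * suc t)
      2N≤ = ℕ.≤-trans (ℕ.m≤m+n (2 * N) n) (ℕ.≤-trans (ℕ.≤-reflexive 2N+n≡n²) (ℕ.*-mono-≤ n≤24[1+t] n≤24[1+t]))
      3≤t : 3 ≤ t
      3≤t = ℕ.≮⇒≥ (λ t<3 → ℕ.<⇒≱ (ℕ.≤-<-trans (ℕ.≤-trans n≤24[1+t] (ℕ.*-monoʳ-≤ 24 t<3)) (ℕ.≤ᵇ⇒≤ 73 1152 _))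
        (ℕ.≤-trans (ℕ.m≤m*n 1152 L {{ℕ.>-nonZero 1≤L}}) 1152L≤n))
      lem : ∀ t a b → 3 ≤ t → t ≤ a → t ≤ b → 24 * suc t * (24 * suc t) + 2 * (1104 * a) ≤ 2 * (1104 * (a * b))
      lem (suc (suc (suc r))) a (suc b) (s≤s (s≤s (s≤s _))) t≤a (s≤s t≤b) = begin
        24 * (4 + r) * (24 * (4 + r)) + 2 * (1104 * a)        ≤⟨ ℕ.+-monoˡ-≤ (2 * (1104 * a)) (ℕ.≤-trans (ℕ.m≤m+n (24 * (4 + r) * (24 * (4 + r))) (1632 * (r * r) + 6432 * r + 4032)) (ℕ.≤-reflexive (ring₁ r))) ⟩
        2208 * ((3 + r) * (2 + r)) + 2 * (1104 * a)           ≤⟨ ℕ.+-monoˡ-≤ (2 * (1104 * a)) (ℕ.*-monoʳ-≤ 2208 (ℕ.*-mono-≤ t≤a t≤b)) ⟩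
        2208 * (a * b) + 2 * (1104 * a)                       ≡⟨ ring₂ a b ⟩
        2 * (1104 * (a * suc b))                              ∎
        where
        ring₁ : ∀ r → 24 * (4 + r) * (24 * (4 + r)) + (1632 * (r * r) + 6432 * r + 4032) ≡ 2208 * ((3 + r) * (2 + r))
        ring₁ = ℕ-solve
        ring₂ : ∀ a b → 2208 * (a * b) + 2 * (1104 * a) ≡ 2 * (1104 * (a * suc b))
        ring₂ = ℕ-solve

-- Decay for a single cut

module _ where
  open Data.Rational using (_+_; _*_; _-_; -_; _≤_; _<_)
  open ℚ.≤-Reasoning

  1/24≤1 : recip 23 ≤ 1ℚ
  1/24≤1 = ℚ.≤ᵇ⇒≤ _

  -- With Y = 1 internal edges carry no weight, so the gain `D` vanishes. The crossing weight 1/24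
  -- keeps 23/24 of the crossing probability and costs 24 per permitted edge.
  cut-weights : ∀ {n lo} (S T : Vec Bool n) → Disjoint S T → ∀ A → 0ℚ ≤ A → A ≤ 1ℚ →
    A * ι (n C 2) ≤ (1ℚ - recip 23) * (ι (size S ℕ.* size T) - ι (size S)) →
    Weights (between S T) (λ _ _ → 0) (size S) lo
  cut-weights {n} {lo} S T disjoint A 0≤A A≤1 A-bound = record
    { x = recip 23 ; w = ι 24 ; Y = 1ℚ ; v = 1ℚ ; A = A ; D = 0ℚ
    ; irrefl-χ = disjoint
    ; kind     = kind-between S T disjoint
    ; 0≤x = 0≤recip 23
    ; x≤1 = 1/24≤1
    ; 0≤w = 0≤ι 24
    ; wx≡1 = ι-recip 23
    ; 1≤Y = ℚ.≤-refl
    ; 0≤v = 0≤1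
    ; vY≡1 = refl
    ; 0≤A = 0≤A
    ; A≤1 = A≤1
    ; 0≤D = ℚ.≤-refl
    ; A-bound = ℚ.≤-trans A-bound (ℚ.≤-reflexive (cong (λ z → (1ℚ - recip 23) * (ι z - ι (size S))) (sym (∑²-between S T))))
    ; D-bound = ℚ.≤-reflexive (trans (ℚ.*-zeroˡ (ι (∑² {n} (λ _ _ → 0)))) (sym (ℚ.*-zeroˡ (ι lo))))
    }

  -- A degenerate case of the two-time estimate: both times coincide and the second event, at least
  -- 0 internal pairs, is certain.
  cut-bound : ∀ {n} (S T : Vec Bool n) → Disjoint S T → ∀ A → 0ℚ ≤ A → A ≤ 1ℚ →
    A * ι (n C 2) ≤ (1ℚ - recip 23) * (ι (size S ℕ.* size T) - ι (size S)) →
    (i : Fin (suc (n C 2))) →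
    𝔼 (n C 2) (emptyGraph n) (λ ω → ι ⟦ cnt (between S T) (lookup ω i) ℕ.≤? size S ⟧) ≤ (1ℚ - A) ^ toℕ i * ι 24 ^ size S
  cut-bound {n} S T disjoint A 0≤A A≤1 A-bound i = begin
    𝔼 (n C 2) (emptyGraph n) (λ ω → ι ⟦ cnt (between S T) (lookup ω i) ℕ.≤? size S ⟧)
      ≤⟨ 𝔼-mono (n C 2) (emptyGraph n) (λ ω _ → ℚ.≤-reflexive (sym (ℚ.*-identityʳ (ι ⟦ cnt (between S T) (lookup ω i) ℕ.≤? size S ⟧)))) ⟩
    𝔼 (n C 2) (emptyGraph n) (λ ω → ι ⟦ cnt (between S T) (lookup ω i) ℕ.≤? size S ⟧ * ι ⟦ 0 ℕ.≤? cnt {n} (λ _ _ → 0) (lookup ω i) ⟧)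
      ≤⟨ sparse-bound 0 i i 0 (sym (ℕ.+-identityʳ (toℕ i))) (ℕ.≤-trans (ℕ.≤-reflexive (ℕ.+-identityʳ (toℕ i))) (ℕ.≤-pred (Fin.toℕ<n i))) ⟩
    (1ℚ - A + 0ℚ) ^ toℕ i * (1ℚ * ι 24 ^ size S * 1ℚ)
      ≡⟨ cong₂ (λ a b → a ^ toℕ i * b) (ℚ.+-identityʳ (1ℚ - A)) (trans (ℚ.*-identityʳ (1ℚ * ι 24 ^ size S)) (ℚ.*-identityˡ (ι 24 ^ size S))) ⟩
    (1ℚ - A) ^ toℕ i * ι 24 ^ size S ∎
    where open Potential {lo = 0} (cut-weights S T disjoint A 0≤A A≤1 A-bound)

  module Estimates {n L K : ℕ} (regime : Regime n L K) where

    open Parameters regime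

    h p : ℚ
    h = ½^ L
    p = ι 2 ^ L

    p≡ιp : ι pℕ ≡ p
    p≡ιp = ι-^ 2 L

    0≤h : 0ℚ ≤ h
    0≤h = 0≤^ L (ℚ.≤ᵇ⇒≤ _)

    h≤1 : h ≤ 1ℚ
    h≤1 = ^≤1 L (ℚ.≤ᵇ⇒≤ _) (ℚ.≤ᵇ⇒≤ _)

    ph≡1 : p * h ≡ 1ℚ
    ph≡1 = trans (sym (^-distrib-* (ι 2) ℚ.½ L)) (1^ L)

    p^k*h^k≡1 : ∀ k → p ^ k * h ^ k ≡ 1ℚ
    p^k*h^k≡1 k = trans (sym (^-distrib-* p h k)) (trans (cong (_^ k) ph≡1) (1^ k))

    n*h^86≤K : ι n * h ^ 86 ≤ ι K
    n*h^86≤K = begin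
      ι n * h ^ 86                        ≤⟨ *-monoˡ (0≤^ 86 0≤h) (ι-mono n≤Kp^86) ⟩
      ι (K ℕ.* pℕ ℕ.^ 86) * h ^ 86        ≡⟨ cong (_* h ^ 86) (trans (ι-* K (pℕ ℕ.^ 86)) (cong (ι K *_) (trans (ι-^ pℕ 86) (cong (_^ 86) p≡ιp)))) ⟩
      ι K * p ^ 86 * h ^ 86               ≡⟨ ℚ.*-assoc (ι K) (p ^ 86) (h ^ 86) ⟩
      ι K * (p ^ 86 * h ^ 86)             ≡⟨ cong (ι K *_) (p^k*h^k≡1 86) ⟩
      ι K * 1ℚ                            ≡⟨ ℚ.*-identityʳ (ι K) ⟩
      ι K                                 ∎

    432KL²h≤1 : ι 432 * (ι K * (ι L * ι L)) * h ≤ 1ℚ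
    432KL²h≤1 = begin
      ι 432 * (ι K * (ι L * ι L)) * h              ≡⟨ cong (_* h) (trans (ι-* 432 (K ℕ.* (L ℕ.* L))) (cong (ι 432 *_) (trans (ι-* K (L ℕ.* L)) (cong (ι K *_) (ι-* L L))))) ⟨
      ι (432 ℕ.* (K ℕ.* (L ℕ.* L))) * h            ≤⟨ *-monoˡ 0≤h (ι-mono 432KL²≤p) ⟩
      ι pℕ * h                                     ≡⟨ cong (_* h) p≡ιp ⟩
      p * h                                        ≡⟨ ph≡1 ⟩
      1ℚ                                           ∎

    -- `ν` and `l` invert n and L. `b` plays the role of n^(-1/2), up to a constant depending on
    -- `K`.
    ν l b ρ : ℚ
    ν = proj₁ (inverse n 1≤n)
    l = proj₁ (inverse L 1≤L)
    b = h ^ 43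
    ρ = (ℤ.+ 1 ℚ./ 6) * ν

    nν≡1 : ι n * ν ≡ 1ℚ
    nν≡1 = proj₁ (proj₂ (inverse n 1≤n))

    Ll≡1 : ι L * l ≡ 1ℚ
    Ll≡1 = proj₁ (proj₂ (inverse L 1≤L))

    0≤ν : 0ℚ ≤ ν
    0≤ν = proj₂ (proj₂ (inverse n 1≤n))

    0≤l : 0ℚ ≤ l
    0≤l = proj₂ (proj₂ (inverse L 1≤L))

    0≤b : 0ℚ ≤ b
    0≤b = 0≤^ 43 0≤h

    0≤ρ : 0ℚ ≤ ρ
    0≤ρ = 0≤* {ℤ.+ 1 ℚ./ 6} {ν} (ℚ.≤ᵇ⇒≤ _) 0≤ν

    6nρ≡1 : ι (6 ℕ.* n) * ρ ≡ 1ℚ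
    6nρ≡1 = begin-equality
      ι (6 ℕ.* n) * ρ                          ≡⟨ cong (_* ρ) (ι-* 6 n) ⟩
      ι 6 * ι n * ((ℤ.+ 1 ℚ./ 6) * ν)          ≡⟨ lem (ι 6) (ι n) (ℤ.+ 1 ℚ./ 6) ν ⟩
      ι 6 * (ℤ.+ 1 ℚ./ 6) * (ι n * ν)          ≡⟨ cong (ι 6 * (ℤ.+ 1 ℚ./ 6) *_) nν≡1 ⟩
      1ℚ                                       ∎
      where
      lem : ∀ a b c d → a * b * (c * d) ≡ a * c * (b * d)
      lem = solve-∀ ℚ-ring

    -- 11s/(6n) is 23/24 * 2 * 22/23 * s/n. The factors are the crossing weight, the inverse density
    -- of pairs, and the share of vertices outside a set with 23s < n.
    rate : ℕ → ℚ
    rate s = ι (11 ℕ.* s) * ρ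

    0≤rate : ∀ s → 0ℚ ≤ rate s
    0≤rate s = 0≤* (0≤ι (11 ℕ.* s)) 0≤ρ

    rate≤½ : ∀ s → 23 ℕ.* s ℕ.≤ n → rate s ≤ ℚ.½
    rate≤½ s 23s≤n = *-cancel-≤ (ι 2) (0<ι {2} (ℕ.s≤s ℕ.z≤n)) (begin
      ι 2 * (ι (11 ℕ.* s) * ρ)   ≡⟨ ℚ.*-assoc (ι 2) (ι (11 ℕ.* s)) ρ ⟨
      ι 2 * ι (11 ℕ.* s) * ρ     ≡⟨ cong (_* ρ) (ι-* 2 (11 ℕ.* s)) ⟨
      ι (2 ℕ.* (11 ℕ.* s)) * ρ   ≤⟨ *-monoˡ 0≤ρ (ι-mono (ℕ.≤-trans (ℕ.≤-reflexive (lem s)) (ℕ.≤-trans (ℕ.*-monoˡ-≤ s (ℕ.≤ᵇ⇒≤ 22 23 _)) (ℕ.≤-trans 23s≤n (ℕ.m≤n*m n 6))))) ⟩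
      ι (6 ℕ.* n) * ρ            ≡⟨ 6nρ≡1 ⟩
      1ℚ                         ∎)
      where
      lem : ∀ s → 2 ℕ.* (11 ℕ.* s) ≡ 22 ℕ.* s
      lem = ℕ-solve

    rate≤1 : ∀ s → 23 ℕ.* s ℕ.≤ n → rate s ≤ 1ℚ
    rate≤1 s 23s≤n = ℚ.≤-trans (rate≤½ s 23s≤n) (ℚ.≤ᵇ⇒≤ _)

    -- Bernoulli splits one step of rate 11s/(6n) into 11s steps of rate 1/(6n), and 6n of the
    -- latter halve. The exponent 44 is 11 * 24 / 6.
    [1-rate]^m₁≤ : ∀ s → 23 ℕ.* s ℕ.≤ n → (1ℚ - rate s) ^ m₁ ≤ (h ^ 44) ^ s
    [1-rate]^m₁≤ s 23s≤n = begin
      (1ℚ - rate s) ^ m₁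
        ≤⟨ ^-mono m₁ (a≤b⇒0≤b-a (rate≤1 s 23s≤n)) (bernoulli ρ (11 ℕ.* s) 0≤ρ ρ≤1) ⟩
      ((1ℚ - ρ) ^ (11 ℕ.* s)) ^ m₁
        ≡⟨ ^-assocʳ (1ℚ - ρ) (11 ℕ.* s) m₁ ⟩
      (1ℚ - ρ) ^ (11 ℕ.* s ℕ.* m₁)
        ≡⟨ cong ((1ℚ - ρ) ^_) (lem s n L) ⟩
      (1ℚ - ρ) ^ (6 ℕ.* n ℕ.* (L ℕ.* 44 ℕ.* s))
        ≡⟨ ^-assocʳ (1ℚ - ρ) (6 ℕ.* n) (L ℕ.* 44 ℕ.* s) ⟨
      ((1ℚ - ρ) ^ (6 ℕ.* n)) ^ (L ℕ.* 44 ℕ.* s)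
        ≤⟨ ^-mono (L ℕ.* 44 ℕ.* s) (0≤^ (6 ℕ.* n) (a≤b⇒0≤b-a ρ≤1)) ([1-1/n]^n≤½ ρ (6 ℕ.* n) 0≤ρ ρ≤1 (ℚ.≤-reflexive (sym 6nρ≡1))) ⟩
      ℚ.½ ^ (L ℕ.* 44 ℕ.* s)
        ≡⟨ ^-assocʳ ℚ.½ (L ℕ.* 44) s ⟨
      (ℚ.½ ^ (L ℕ.* 44)) ^ s
        ≡⟨ cong (_^ s) (^-assocʳ ℚ.½ L 44) ⟨
      (h ^ 44) ^ s ∎
      where
      ρ≤1 : ρ ≤ 1ℚ
      ρ≤1 = begin
        ρ                 ≡⟨ ℚ.*-identityˡ ρ ⟨
        1ℚ * ρ            ≤⟨ *-monoˡ 0≤ρ (1≤ι (ℕ.≤-trans 1≤n (ℕ.m≤n*m n 6))) ⟩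
        ι (6 ℕ.* n) * ρ   ≡⟨ 6nρ≡1 ⟩
        1ℚ                ∎
      lem : ∀ s n L → 11 ℕ.* s ℕ.* (24 ℕ.* (n ℕ.* L)) ≡ 6 ℕ.* n ℕ.* (L ℕ.* 44 ℕ.* s)
      lem = ℕ-solve

    rate-bound : ∀ s s′ → s ℕ.+ s′ ≡ n → 23 ℕ.* s ℕ.+ 1 ℕ.≤ n →
      rate s * ι N ≤ (1ℚ - recip 23) * (ι (s ℕ.* s′) - ι s)
    rate-bound s s′ s+s′≡n 23s<n = begin
      rate s * ι N
        ≡⟨ cong (λ a → a * ρ * ι N) (ι-* 11 s) ⟩
      ι 11 * S * ((ℤ.+ 1 ℚ./ 6) * ν) * ι N
        ≡⟨ lem₁ (ι 11) S (ℤ.+ 1 ℚ./ 6) ν (ι N) ⟩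
      ι 11 * (ℤ.+ 1 ℚ./ 6) * ℚ.½ * S * (ν * (ι 2 * ι N))
        ≡⟨ cong (ι 11 * (ℤ.+ 1 ℚ./ 6) * ℚ.½ * S *_) ν2N ⟩
      ι 11 * (ℤ.+ 1 ℚ./ 6) * ℚ.½ * S * (n′ - 1ℚ)
        -- The two sides differ exactly by this multiple of n - 23s - 1.
        ≤⟨ ≤-by ((ℤ.+ 1 ℚ./ 24) * S * (n′ - (ι 23 * S + 1ℚ)))
             (0≤* (0≤* {ℤ.+ 1 ℚ./ 24} {S} (ℚ.≤ᵇ⇒≤ _) (0≤ι s)) (a≤b⇒0≤b-a 23S+1≤n)) (lem₂ S n′) ⟩
      (1ℚ - recip 23) * (S * (n′ - S) - S)
        ≡⟨ cong (λ a → (1ℚ - recip 23) * (S * a - S)) S′≡ ⟨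
      (1ℚ - recip 23) * (S * ι s′ - S)
        ≡⟨ cong (λ a → (1ℚ - recip 23) * (a - S)) (ι-* s s′) ⟨
      (1ℚ - recip 23) * (ι (s ℕ.* s′) - ι s) ∎
      where
      S = ι s
      n′ = ι n
      lem₁ : ∀ a S c ν N → a * S * (c * ν) * N ≡ a * c * ℚ.½ * S * (ν * ((1ℚ + (1ℚ + 0ℚ)) * N))
      lem₁ = solve-∀ ℚ-ring
      ν2N : ν * (ι 2 * ι N) ≡ n′ - 1ℚ
      ν2N = begin-equality
        ν * (ι 2 * ι N)              ≡⟨ cong (ν *_) (ι-* 2 N) ⟨
        ν * ι (2 ℕ.* N)              ≡⟨ lemν ν (ι (2 ℕ.* N)) n′ ⟩
        ν * (ι (2 ℕ.* N) + n′) - n′ * ν  ≡⟨ cong₂ (λ a b → ν * a - b) (trans (sym (ι-+ (2 ℕ.* N) n)) (trans (cong ι 2N+n≡n²) (ι-* n n))) nν≡1 ⟩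
        ν * (n′ * n′) - 1ℚ           ≡⟨ cong (_- 1ℚ) (lemν′ ν n′) ⟩
        n′ * ν * n′ - 1ℚ             ≡⟨ cong (λ a → a * n′ - 1ℚ) nν≡1 ⟩
        1ℚ * n′ - 1ℚ                 ≡⟨ cong (_- 1ℚ) (ℚ.*-identityˡ n′) ⟩
        n′ - 1ℚ                      ∎
        where
        lemν : ∀ ν a n → ν * a ≡ ν * (a + n) - n * ν
        lemν = solve-∀ ℚ-ring
        lemν′ : ∀ ν n → ν * (n * n) ≡ n * ν * n
        lemν′ = solve-∀ ℚ-ring
      S′≡ : ι s′ ≡ n′ - S
      S′≡ = trans (lem (ι s′) S) (cong (_- S) (trans (sym (ι-+ s s′)) (cong ι s+s′≡n)))
        where
        lem : ∀ a b → a ≡ b + a - b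
        lem = solve-∀ ℚ-ring
      23S+1≤n : ι 23 * S + 1ℚ ≤ n′
      23S+1≤n = ℚ.≤-trans (ℚ.≤-reflexive (sym (trans (ι-+ (23 ℕ.* s) 1) (cong (_+ 1ℚ) (ι-* 23 s))))) (ι-mono 23s<n)
      lem₂ : ∀ S n → ι 11 * (ℤ.+ 1 ℚ./ 6) * ℚ.½ * S * (n - 1ℚ) + (ℤ.+ 1 ℚ./ 24) * S * (n - (ι 23 * S + 1ℚ)) ≡ (1ℚ - recip 23) * (S * (n - S) - S)
      lem₂ S n = lem S n
        where
        lem : ∀ S n → (ℤ.+ 11 ℚ./ 12) * S * (n - 1ℚ) + (ℤ.+ 1 ℚ./ 24) * S * (n - ((ℤ.+ 23 ℚ./ 1) * S + 1ℚ)) ≡ (1ℚ - (ℤ.+ 1 ℚ./ 24)) * (S * (n - S) - S)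
        lem = solve-∀ ℚ-ring

-- Union bounds over vertices, pairs of sets and islands

module _ where
  open Data.Rational using (_+_; _*_; _-_; -_; _≤_; _<_)
  open ℚ.≤-Reasoning

  disjoint? : ∀ {n} (S T : Vec Bool n) → Dec (Disjoint S T)
  disjoint? S T = Fin.all? (λ u → member S u ℕ.* member T u ℕ.≟ 0)

  single : ∀ {n} → Fin n → Vec Bool n
  single v = Vec.tabulate (λ u → does (u Fin.≟ v))

  member-single : ∀ {n} (v u : Fin n) → member (single v) u ≡ ⟦ u Fin.≟ v ⟧
  member-single v u = cong (λ b → if b then 1 else 0) (Vec.lookup∘tabulate (λ u → does (u Fin.≟ v)) u)

  size-single : ∀ {n} (v : Fin n) → size (single v) ≡ 1
  size-single v = trans (sum-cong-≗ (λ u → trans (member-single v u) (sym (ℕ.*-identityʳ ⟦ u Fin.≟ v ⟧)))) (∑-δ v (λ _ → 1))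

  LargeDisjoint : ∀ {n} → ℕ → Vec Bool n → Vec Bool n → Set
  LargeDisjoint t S T = Disjoint S T × t ℕ.≤ size S × t ℕ.≤ size T

  largeDisjoint? : ∀ {n} t (S T : Vec Bool n) → Dec (LargeDisjoint t S T)
  largeDisjoint? t S T = disjoint? S T ×-dec ((t ℕ.≤? size S) ×-dec (t ℕ.≤? size T))

  Small : ∀ {n} → ℕ → Vec Bool n → Set
  Small t W = 1 ℕ.≤ size W × size W ℕ.< t

  small? : ∀ {n} t (W : Vec Bool n) → Dec (Small t W)
  small? t W = (1 ℕ.≤? size W) ×-dec (size W ℕ.<? t)

  [1-v]^m≤½^k : ∀ v X {m k} → 0ℚ ≤ v → v ≤ 1ℚ → 1ℚ ≤ ι X * v → X ℕ.* k ℕ.≤ m → (1ℚ - v) ^ m ≤ ℚ.½ ^ k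
  [1-v]^m≤½^k v X {m} {k} 0≤v v≤1 1≤Xv Xk≤m = begin
    (1ℚ - v) ^ m              ≤⟨ ^-antitone (a≤b⇒0≤b-a v≤1) (≤-by v 0≤v (lem v)) Xk≤m ⟩
    (1ℚ - v) ^ (X ℕ.* k)      ≡⟨ ^-assocʳ (1ℚ - v) X k ⟨
    ((1ℚ - v) ^ X) ^ k        ≤⟨ ^-mono k (0≤^ X (a≤b⇒0≤b-a v≤1)) ([1-1/n]^n≤½ v X 0≤v v≤1 1≤Xv) ⟩
    ℚ.½ ^ k                   ∎
    where
    lem : ∀ v → 1ℚ - v + v ≡ 1ℚ
    lem = solve-∀ ℚ-ring

  𝔼₀ : ∀ n → (Trajectories n (n C 2) → ℚ) → ℚ
  𝔼₀ n = 𝔼 (n C 2) (emptyGraph n)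

  𝔼₀-const : ∀ n c → 𝔼₀ n (λ _ → c) ≡ c
  𝔼₀-const n c = 𝔼-const (n C 2) (emptyGraph n) (ℕ.≤-reflexive (sym (#nonEdges-empty n))) c

  module Bounds {n L K : ℕ} (regime : Regime n L K) where
    open Parameters regime
    open Estimates regime

    cut-bound-∁ : ∀ W → 23 ℕ.* size W ℕ.+ 1 ℕ.≤ n → (i : Fin (suc N)) →
      𝔼₀ n (λ ω → ι ⟦ cnt (between W (∁ W)) (lookup ω i) ℕ.≤? size W ⟧) ≤ (1ℚ - rate (size W)) ^ toℕ i * ι 24 ^ size W
    cut-bound-∁ W 23s<n = cut-bound W (∁ W) (∁-disjoint W) (rate (size W)) (0≤rate (size W))
      (rate≤1 (size W) (ℕ.≤-trans (ℕ.m≤m+n _ 1) 23s<n)) (rate-bound (size W) (size (∁ W)) (size-∁ W) 23s<n)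

    1≤ιL : 1ℚ ≤ ι L
    1≤ιL = 1≤ι 1≤L

    L*24Kh≤1 : ι L * (ι 24 * ι K * h) ≤ 1ℚ
    L*24Kh≤1 = begin
      ι L * (ι 24 * ι K * h)                 ≡⟨ lem₁ (ι L) (ι 24) (ι K) h ⟩
      ι 24 * (ι K * (ι L * 1ℚ)) * h          ≤⟨ *-monoˡ 0≤h (*-mono (0≤ι 24) (0≤* (0≤ι K) (0≤* (0≤ι L) (0≤ι L)))
                                                  (ι-mono (ℕ.≤ᵇ⇒≤ 24 432 _)) (*-monoʳ (0≤ι K) (*-monoʳ (0≤ι L) 1≤ιL))) ⟩
      ι 432 * (ι K * (ι L * ι L)) * h        ≤⟨ 432KL²h≤1 ⟩
      1ℚ                                     ∎
      where
      lem₁ : ∀ l c k h → l * (c * k * h) ≡ c * (k * (l * 1ℚ)) * h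
      lem₁ = solve-∀ ℚ-ring

    low-degree : Fin n → Trajectories n N → ℚ
    low-degree v ω = ι ⟦ cnt (between (single v) (∁ (single v))) (lookup ω i₂) ℕ.≤? size (single v) ⟧

    -- A degree below 2 is a singleton with at most one edge in its cut. Since m₂ = 3m₁, the decay
    -- is h^132; already h^87 beats the n vertices and leaves one factor h to outweigh L.
    low-degree-bound : ∀ v → 𝔼₀ n (low-degree v) ≤ h ^ 86 * h * ι 24
    low-degree-bound v = begin
      𝔼₀ n (low-degree v)
        ≤⟨ cut-bound-∁ (single v) (subst (λ s → 23 ℕ.* s ℕ.+ 1 ℕ.≤ n) (sym (size-single v)) 24≤n) i₂ ⟩
      (1ℚ - rate (size (single v))) ^ toℕ i₂ * ι 24 ^ size (single v)
        ≡⟨ cong₂ (λ s m → (1ℚ - rate s) ^ m * ι 24 ^ s) (size-single v) (trans toℕ-i₂ (lem n L)) ⟩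
      (1ℚ - rate 1) ^ (m₁ ℕ.* 3) * (ι 24 * 1ℚ)
        ≡⟨ cong₂ _*_ (sym (^-assocʳ (1ℚ - rate 1) m₁ 3)) (ℚ.*-identityʳ (ι 24)) ⟩
      ((1ℚ - rate 1) ^ m₁) ^ 3 * ι 24
        ≤⟨ *-monoˡ (0≤ι 24) (^-mono 3 (0≤^ m₁ (a≤b⇒0≤b-a (rate≤1 1 23≤n))) ([1-rate]^m₁≤ 1 23≤n)) ⟩
      ((h ^ 44) ^ 1) ^ 3 * ι 24
        ≡⟨ cong (_* ι 24) (trans (^-assocʳ (h ^ 44) 1 3) (^-assocʳ h 44 3)) ⟩
      h ^ 132 * ι 24
        ≤⟨ *-monoˡ (0≤ι 24) (^-antitone 0≤h h≤1 (ℕ.≤ᵇ⇒≤ 87 132 _)) ⟩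
      h ^ 87 * ι 24
        ≡⟨ cong (_* ι 24) (trans (^-homo-* h 86 1) (cong (h ^ 86 *_) (ℚ.*-identityʳ h))) ⟩
      h ^ 86 * h * ι 24 ∎
      where
      24≤n : 24 ℕ.≤ n
      24≤n = ℕ.≤-trans (ℕ.≤-trans (ℕ.≤ᵇ⇒≤ 24 1152 _) (ℕ.m≤m*n 1152 L {{ℕ.>-nonZero 1≤L}})) 1152L≤n
      23≤n : 23 ℕ.≤ n
      23≤n = ℕ.≤-trans (ℕ.n≤1+n 23) 24≤n
      lem : ∀ n L → 72 ℕ.* (n ℕ.* L) ≡ 24 ℕ.* (n ℕ.* L) ℕ.* 3
      lem = ℕ-solve

    low-degrees-bound : ι L * ∑ℚ (List.allFin n) (λ v → 𝔼₀ n (low-degree v)) ≤ 1ℚ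
    low-degrees-bound = begin
      ι L * ∑ℚ (List.allFin n) (λ v → 𝔼₀ n (low-degree v))
        ≤⟨ *-monoʳ (0≤ι L) (∑ℚ-mono (List.allFin n) (λ v _ → low-degree-bound v)) ⟩
      ι L * ∑ℚ (List.allFin n) (λ _ → h ^ 86 * h * ι 24)
        ≡⟨ cong (ι L *_) (trans (∑ℚ-const (List.allFin n) (h ^ 86 * h * ι 24)) (cong (λ k → ι k * (h ^ 86 * h * ι 24)) {length (List.allFin n)} {n} (List.length-tabulate id))) ⟩
      ι L * (ι n * (h ^ 86 * h * ι 24))
        ≡⟨ cong (ι L *_) (lem (ι n) (h ^ 86) h (ι 24)) ⟩
      ι L * (ι 24 * (ι n * h ^ 86) * h)
        ≤⟨ *-monoʳ (0≤ι L) (*-monoˡ 0≤h (*-monoʳ (0≤ι 24) n*h^86≤K)) ⟩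
      ι L * (ι 24 * ι K * h)
        ≤⟨ L*24Kh≤1 ⟩
      1ℚ ∎
      where
      lem : ∀ n a h c → n * (a * h * c) ≡ c * (n * a) * h
      lem = solve-∀ ℚ-ring

    few-between : Vec Bool n → Vec Bool n → Trajectories n N → ℚ
    few-between S T ω = ι ⟦ largeDisjoint? t S T ×-dec (cnt (between S T) (lookup ω i₁) ℕ.≤? size S) ⟧

    -- 1152 = 24 * 48, so `α` times 1104 = 23 * 48 is exactly 23/24. `β` bounds the failure
    -- probability of one pair of large sets.
    α β : ℚ
    α = ℤ.+ 1 ℚ./ 1152
    β = ℚ.½ ^ (24 ℕ.* n) * ι 24 ^ n

    0≤β : 0ℚ ≤ β
    0≤β = 0≤* (0≤^ (24 ℕ.* n) (ℚ.≤ᵇ⇒≤ _)) (0≤^ n (0≤ι 24))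

    few-between-bound : ∀ S T → 𝔼₀ n (few-between S T) ≤ β
    few-between-bound S T = by-cases (largeDisjoint? t S T)
      where
      by-cases : (d : Dec (LargeDisjoint t S T)) →
        𝔼₀ n (λ ω → ι ⟦ d ×-dec (cnt (between S T) (lookup ω i₁) ℕ.≤? size S) ⟧) ≤ β
      by-cases (no _) = ℚ.≤-trans (ℚ.≤-reflexive (𝔼₀-const n 0ℚ)) 0≤β
      by-cases (yes (disjoint , t≤S , t≤T)) = begin
        𝔼₀ n (λ ω → ι ⟦ cnt (between S T) (lookup ω i₁) ℕ.≤? size S ⟧)
          ≤⟨ cut-bound S T disjoint α (ℚ.≤ᵇ⇒≤ _) (ℚ.≤ᵇ⇒≤ _) α-bound i₁ ⟩
        (1ℚ - α) ^ toℕ i₁ * ι 24 ^ size S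
          ≤⟨ *-mono (0≤^ (toℕ i₁) (ℚ.≤ᵇ⇒≤ _)) (0≤^ n (0≤ι 24)) decay (^-monotone (ι-mono {1} {24} (ℕ.s≤s ℕ.z≤n)) size≤n) ⟩
        β ∎
        where
        size≤n : size S ℕ.≤ n
        size≤n = ℕ.≤-trans (ℕ.m≤m+n (size S) (size (∁ S))) (ℕ.≤-reflexive (size-∁ S))
        decay : (1ℚ - α) ^ toℕ i₁ ≤ ℚ.½ ^ (24 ℕ.* n)
        -- The time m₁ = 24nL contains 24n blocks of 1152 steps because L ≥ 1152, and each block
        -- halves.
        decay = [1-v]^m≤½^k α 1152 {toℕ i₁} {24 ℕ.* n} (ℚ.≤ᵇ⇒≤ _) (ℚ.≤ᵇ⇒≤ _) (ℚ.≤-reflexive (sym (ι-recip 1151)))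
          (ℕ.≤-trans (ℕ.≤-reflexive (lem n)) (ℕ.≤-trans (ℕ.*-monoʳ-≤ 24 (ℕ.*-monoʳ-≤ n 1152≤L)) (ℕ.≤-reflexive (sym toℕ-i₁))))
          where
          lem : ∀ n → 1152 ℕ.* (24 ℕ.* n) ≡ 24 ℕ.* (n ℕ.* 1152)
          lem = ℕ-solve
        α-bound : α * ι (n C 2) ≤ (1ℚ - recip 23) * (ι (size S ℕ.* size T) - ι (size S))
        α-bound = begin
          α * ι N                                  ≤⟨ *-monoʳ {ι N} {ι 1104 * (ι (size S ℕ.* size T) - ι (size S))} {α} (ℚ.≤ᵇ⇒≤ _) (0≤b-a⇒a≤b (ℚ.≤-trans (a≤b⇒0≤b-a (ι-mono (N≤1104[ST-S] t≤S t≤T)))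
                                                       (ℚ.≤-reflexive expand))) ⟩
          α * (ι 1104 * (ι (size S ℕ.* size T) - ι (size S)))
                                                   ≡⟨ ℚ.*-assoc α (ι 1104) (ι (size S ℕ.* size T) - ι (size S)) ⟨
          α * ι 1104 * (ι (size S ℕ.* size T) - ι (size S)) ∎
          where
          expand : ι (1104 ℕ.* (size S ℕ.* size T)) - ι (N ℕ.+ 1104 ℕ.* size S) ≡ ι 1104 * (ι (size S ℕ.* size T) - ι (size S)) - ι N
          expand = trans (cong₂ _-_ (ι-* 1104 (size S ℕ.* size T)) (trans (ι-+ N (1104 ℕ.* size S)) (cong (λ y → ι N + y) (ι-* 1104 (size S)))))
            (ring (ι 1104) (ι (size S ℕ.* size T)) (ι N) (ι (size S)))
            where
            ring : ∀ c x N s → c * x - (N + c * s) ≡ c * (x - s) - N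
            ring = solve-∀ ℚ-ring

    L*½^n≤1 : ι L * ℚ.½ ^ n ≤ 1ℚ
    L*½^n≤1 = begin
      ι L * ℚ.½ ^ n    ≤⟨ *-mono (0≤ι L) 0≤h (ι-mono L≤p) (^-antitone {ℚ.½} {L} {n} (ℚ.≤ᵇ⇒≤ _) (ℚ.≤ᵇ⇒≤ _) L≤n) ⟩
      ι pℕ * h         ≡⟨ cong (_* h) p≡ιp ⟩
      p * h            ≡⟨ ph≡1 ⟩
      1ℚ               ∎
      where
      L≤n : L ℕ.≤ n
      L≤n = ℕ.≤-trans (ℕ.m≤n*m L 1152) 1152L≤n

    few-betweens-bound : ι L * ∑ℚ (subsets n) (λ S → ∑ℚ (subsets n) (λ T → 𝔼₀ n (few-between S T))) ≤ 1ℚ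
    few-betweens-bound = begin
      ι L * ∑ℚ (subsets n) (λ S → ∑ℚ (subsets n) (λ T → 𝔼₀ n (few-between S T)))
        ≤⟨ *-monoʳ (0≤ι L) (∑ℚ-mono (subsets n) (λ S _ → ∑ℚ-mono (subsets n) (λ T _ → few-between-bound S T))) ⟩
      ι L * ∑ℚ (subsets n) (λ S → ∑ℚ (subsets n) (λ T → β))
        ≡⟨ cong (ι L *_) (trans (∑ℚ-cong (subsets n) (λ S _ → ∑-subsets-const n β)) (∑-subsets-const n (ι 2 ^ n * β))) ⟩
      ι L * (ι 2 ^ n * (ι 2 ^ n * β))
        ≤⟨ *-monoʳ (0≤ι L) total ⟩
      ι L * ℚ.½ ^ n
        ≤⟨ L*½^n≤1 ⟩
      1ℚ ∎
      where
      collect : ∀ a b c d k → a ^ k * (b ^ k * ((c ^ k) * d ^ k)) ≡ (a * (b * (c * d))) ^ k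
      collect a b c d k = sym (trans (^-distrib-* a (b * (c * d)) k) (cong (a ^ k *_)
        (trans (^-distrib-* b (c * d) k) (cong (b ^ k *_) (^-distrib-* c d k)))))
      total : ι 2 ^ n * (ι 2 ^ n * β) ≤ ℚ.½ ^ n
      total = begin
        ι 2 ^ n * (ι 2 ^ n * (ℚ.½ ^ (24 ℕ.* n) * ι 24 ^ n))
          ≡⟨ cong (λ y → ι 2 ^ n * (ι 2 ^ n * (y * ι 24 ^ n))) (^-assocʳ ℚ.½ 24 n) ⟨
        ι 2 ^ n * (ι 2 ^ n * ((ℚ.½ ^ 24) ^ n * ι 24 ^ n))
          ≡⟨ collect (ι 2) (ι 2) (ℚ.½ ^ 24) (ι 24) n ⟩
        (ι 2 * (ι 2 * (ℚ.½ ^ 24 * ι 24))) ^ n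
          -- A closed computation: 2 * 2 * 24 / 2^24 ≤ 1/2, where the two factors 2 count the
          -- subsets `S` and `T`.
          ≤⟨ ^-mono n (ℚ.≤ᵇ⇒≤ _) (ℚ.≤ᵇ⇒≤ _) ⟩
        ℚ.½ ^ n ∎

    -- The reward `Y` depends on the size s, ideally about n^(1/2)/(Ls). It must be small enough
    -- that Y²s² is at most a multiple of n/L, so that m₂ steps cost only a constant, and large
    -- enough that its inverse is at most about Ls n^(-1/2).
    record Scale (s : ℕ) : Set where
      field
        Y v : ℚ
        1≤Y : 1ℚ ≤ Y
        0≤v : 0ℚ ≤ v
        vY≡1 : v * Y ≡ 1ℚ
        small-Y : (Y * Y - 1ℚ) * ι (s ℕ.* s) ≤ (ℤ.+ 1 ℚ./ 144) * (ν * l) * ι lo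
        v≤ : v ≤ ι L * ι s * b

    l≤1/1152 : l ≤ ℤ.+ 1 ℚ./ 1152
    l≤1/1152 = *-cancel-≤ (ι L) (0<ι 1≤L) (begin
      ι L * l                          ≡⟨ Ll≡1 ⟩
      1ℚ                               ≡⟨ ι-recip 1151 ⟨
      ι 1152 * recip 1151              ≤⟨ *-monoˡ (0≤recip 1151) (ι-mono 1152≤L) ⟩
      ι L * recip 1151                 ∎)

    0≤D-lo : 0ℚ ≤ (ℤ.+ 1 ℚ./ 144) * (ν * l) * ι lo
    0≤D-lo = 0≤* (0≤* {ℤ.+ 1 ℚ./ 144} {ν * l} (ℚ.≤ᵇ⇒≤ _) (0≤* 0≤ν 0≤l)) (0≤ι lo)

    p^43*b≡1 : p ^ 43 * b ≡ 1ℚ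
    p^43*b≡1 = p^k*h^k≡1 43

    scale : ∀ s → 1 ℕ.≤ s → Scale s
    scale s 1≤s = by-cases (L ℕ.* s ℕ.≤? pℕ ℕ.^ 43)
      where
      q = p ^ 43
      ιq≡ : ι (pℕ ℕ.^ 43) ≡ q
      ιq≡ = trans (ι-^ pℕ 43) (cong (_^ 43) p≡ιp)
      σ = proj₁ (inverse s 1≤s)
      sσ≡1 : ι s * σ ≡ 1ℚ
      sσ≡1 = proj₁ (proj₂ (inverse s 1≤s))
      0≤σ : 0ℚ ≤ σ
      0≤σ = proj₂ (proj₂ (inverse s 1≤s))
      by-cases : Dec (L ℕ.* s ℕ.≤ pℕ ℕ.^ 43) → Scale s
      -- For such large s the ideal reward would fall below 1. Then `ι L * ι s * b` is at least 1
      -- and the trivial reward suffices.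
      by-cases (no Ls≰q) = record
        { Y = 1ℚ ; v = 1ℚ ; 1≤Y = ℚ.≤-refl ; 0≤v = 0≤1 ; vY≡1 = refl
        ; small-Y = ℚ.≤-trans (ℚ.≤-reflexive (ℚ.*-zeroˡ (ι (s ℕ.* s)))) 0≤D-lo
        ; v≤ = begin
            1ℚ                  ≡⟨ p^43*b≡1 ⟨
            q * b               ≡⟨ cong (_* b) ιq≡ ⟨
            ι (pℕ ℕ.^ 43) * b   ≤⟨ *-monoˡ 0≤b (ι-mono (ℕ.<⇒≤ (ℕ.≰⇒> Ls≰q))) ⟩
            ι (L ℕ.* s) * b     ≡⟨ cong (_* b) (ι-* L s) ⟩
            ι L * ι s * b       ∎
        }
      by-cases (yes Ls≤q) = record
        -- Here Y²s² = (q/L)² ≤ n/L², and L ≥ 1152 = 8 * 144 turns this into (1/144) * `lo`/(nL), as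
        -- n² ≤ 8 `lo`.
        { Y = q * (l * σ) ; v = ι L * ι s * b
        ; 1≤Y = begin
            1ℚ                                 ≡⟨ cong₂ _*_ Ll≡1 sσ≡1 ⟨
            (ι L * l) * (ι s * σ)              ≡⟨ lem₁ (ι L) l (ι s) σ ⟩
            (ι L * ι s) * (l * σ)              ≡⟨ cong (_* (l * σ)) (ι-* L s) ⟨
            ι (L ℕ.* s) * (l * σ)              ≤⟨ *-monoˡ (0≤* 0≤l 0≤σ) (ι-mono Ls≤q) ⟩
            ι (pℕ ℕ.^ 43) * (l * σ)            ≡⟨ cong (_* (l * σ)) ιq≡ ⟩
            q * (l * σ)                        ∎
        ; 0≤v = 0≤* (0≤* (0≤ι L) (0≤ι s)) 0≤b
        ; vY≡1 = begin-equality
            ι L * ι s * b * (q * (l * σ))      ≡⟨ lem₂ (ι L) (ι s) b q l σ ⟩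
            (ι L * l) * (ι s * σ) * (q * b)    ≡⟨ cong₂ _*_ (cong₂ _*_ Ll≡1 sσ≡1) p^43*b≡1 ⟩
            1ℚ                                 ∎
        ; small-Y = begin
            (q * (l * σ) * (q * (l * σ)) - 1ℚ) * ι (s ℕ.* s)
              ≤⟨ ≤-by (ι (s ℕ.* s)) (0≤ι (s ℕ.* s)) (lem₃ (q * (l * σ) * (q * (l * σ))) (ι (s ℕ.* s))) ⟩
            q * (l * σ) * (q * (l * σ)) * ι (s ℕ.* s)
              ≡⟨ trans (cong (q * (l * σ) * (q * (l * σ)) *_) (ι-* s s)) (lem₄ q l σ (ι s)) ⟩
            (q * q) * (l * l) * ((ι s * σ) * (ι s * σ))
              ≡⟨ trans (cong (λ o → (q * q) * (l * l) * (o * o)) sσ≡1) (ℚ.*-identityʳ ((q * q) * (l * l))) ⟩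
            (q * q) * (l * l)
              ≤⟨ *-mono (0≤* 0≤q 0≤q) (0≤* (ℚ.≤ᵇ⇒≤ {p = 0ℚ} {q = ℤ.+ 1 ℚ./ 1152} _) 0≤l) q²≤n (*-monoˡ 0≤l l≤1/1152) ⟩
            ι n * ((ℤ.+ 1 ℚ./ 1152) * l)
              ≡⟨ trans (cong (λ o → o * ι n * ((ℤ.+ 1 ℚ./ 1152) * l)) nν≡1) (cong (_* ((ℤ.+ 1 ℚ./ 1152) * l)) (ℚ.*-identityˡ (ι n))) ⟨
            ι n * ν * ι n * ((ℤ.+ 1 ℚ./ 1152) * l)
              ≡⟨ lem₅ (ι n) ν l ⟩
            (ℤ.+ 1 ℚ./ 1152) * (ν * l) * (ι n * ι n)
              ≤⟨ *-monoʳ (0≤* {ℤ.+ 1 ℚ./ 1152} {ν * l} (ℚ.≤ᵇ⇒≤ _) (0≤* 0≤ν 0≤l)) n²≤ ⟩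
            (ℤ.+ 1 ℚ./ 1152) * (ν * l) * ((ℤ.+ 8 ℚ./ 1) * ι lo)
              ≡⟨ lem₆ ν l (ι lo) ⟩
            (ℤ.+ 1 ℚ./ 144) * (ν * l) * ι lo ∎
        ; v≤ = ℚ.≤-refl
        }
        where
        0≤q : 0ℚ ≤ q
        0≤q = 0≤^ 43 (0≤^ L (0≤ι 2))
        q²≤n : q * q ≤ ι n
        q²≤n = begin
          p ^ 43 * p ^ 43      ≡⟨ ^-homo-* p 43 43 ⟨
          p ^ 86               ≡⟨ trans (ι-^ pℕ 86) (cong (_^ 86) p≡ιp) ⟨
          ι (pℕ ℕ.^ 86)        ≤⟨ ι-mono p^86≤n ⟩
          ι n                  ∎
        n²≤ : ι n * ι n ≤ (ℤ.+ 8 ℚ./ 1) * ι lo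
        n²≤ = begin
          ι n * ι n            ≡⟨ ι-* n n ⟨
          ι (n ℕ.* n)          ≤⟨ ι-mono n²≤8lo ⟩
          ι (8 ℕ.* lo)         ≡⟨ ι-* 8 lo ⟩
          ι 8 * ι lo           ∎
        lem₁ : ∀ L l s σ → (L * l) * (s * σ) ≡ (L * s) * (l * σ)
        lem₁ = solve-∀ ℚ-ring
        lem₂ : ∀ L s b q l σ → L * s * b * (q * (l * σ)) ≡ (L * l) * (s * σ) * (q * b)
        lem₂ = solve-∀ ℚ-ring
        lem₃ : ∀ a s → (a - 1ℚ) * s + s ≡ a * s
        lem₃ = solve-∀ ℚ-ring
        lem₄ : ∀ q l σ s → q * (l * σ) * (q * (l * σ)) * (s * s) ≡ (q * q) * (l * l) * ((s * σ) * (s * σ))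
        lem₄ = solve-∀ ℚ-ring
        lem₅ : ∀ n ν l → n * ν * n * ((ℤ.+ 1 ℚ./ 1152) * l) ≡ (ℤ.+ 1 ℚ./ 1152) * (ν * l) * (n * n)
        lem₅ = solve-∀ ℚ-ring
        lem₆ : ∀ ν l x → (ℤ.+ 1 ℚ./ 1152) * (ν * l) * ((ℤ.+ 8 ℚ./ 1) * x) ≡ (ℤ.+ 1 ℚ./ 144) * (ν * l) * x
        lem₆ = solve-∀ ℚ-ring

    -- 144 = 2 * 72 makes 2D * m₂ equal to 1. `θ` collects what an island of size s pays per vertex
    -- apart from the factor s: 24 for the permitted crossing edges, L * b from the inverse reward,
    -- and h^44 from the sparse cut.
    D θ : ℚ
    D = (ℤ.+ 1 ℚ./ 144) * (ν * l)
    θ = ι 24 * ι L * b * h ^ 44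

    0≤D′ : 0ℚ ≤ D
    0≤D′ = 0≤* {ℤ.+ 1 ℚ./ 144} {ν * l} (ℚ.≤ᵇ⇒≤ _) (0≤* 0≤ν 0≤l)

    0≤θ : 0ℚ ≤ θ
    0≤θ = 0≤* (0≤* (0≤* (0≤ι 24) (0≤ι L)) 0≤b) (0≤^ 44 0≤h)

    [1+2D]^m₂≤3 : (1ℚ + (D + D)) ^ m₂ ≤ 3ℚ
    [1+2D]^m₂≤3 = [1+v]^n≤3 (D + D) m₂ (0≤+ 0≤D′ 0≤D′) (ℚ.≤-reflexive (begin-equality
      ι m₂ * (D + D)                          ≡⟨ cong (_* (D + D)) (trans (ι-* 72 (n ℕ.* L)) (cong (ι 72 *_) (ι-* n L))) ⟩
      ι 72 * (ι n * ι L) * (D + D)            ≡⟨ lem (ι n) (ι L) ν l ⟩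
      (ι n * ν) * (ι L * l)                   ≡⟨ cong₂ _*_ nν≡1 Ll≡1 ⟩
      1ℚ                                      ∎))
      where
      lem : ∀ n L ν l → (ℤ.+ 72 ℚ./ 1) * (n * L) * ((ℤ.+ 1 ℚ./ 144) * (ν * l) + (ℤ.+ 1 ℚ./ 144) * (ν * l)) ≡ (n * ν) * (L * l)
      lem = solve-∀ ℚ-ring

    n*θ≤ : ι n * θ ≤ ι 24 * (ι L * ι K) * h
    n*θ≤ = begin
      ι n * (ι 24 * ι L * h ^ 43 * h ^ 44)      ≡⟨ lem (ι n) (ι 24) (ι L) (h ^ 43) (h ^ 44) ⟩
      ι 24 * (ι L * (ι n * (h ^ 43 * h ^ 44)))  ≡⟨ cong (λ y → ι 24 * (ι L * (ι n * y))) (trans (sym (^-homo-* h 43 44)) (trans (^-homo-* h 86 1) (cong (h ^ 86 *_) (ℚ.*-identityʳ h)))) ⟩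
      ι 24 * (ι L * (ι n * (h ^ 86 * h)))       ≡⟨ lem′ (ι 24) (ι L) (ι n) (h ^ 86) h ⟩
      ι 24 * (ι L * (ι n * h ^ 86)) * h         ≤⟨ *-monoˡ 0≤h (*-monoʳ (0≤ι 24) (*-monoʳ (0≤ι L) n*h^86≤K)) ⟩
      ι 24 * (ι L * ι K) * h                    ∎
      where
      lem : ∀ n c L a b → n * (c * L * a * b) ≡ c * (L * (n * (a * b)))
      lem = solve-∀ ℚ-ring
      lem′ : ∀ c L n a h → c * (L * (n * (a * h))) ≡ c * (L * (n * a)) * h
      lem′ = solve-∀ ℚ-ring

    L*18nθ≤1 : ι L * (ι 18 * (ι n * θ)) ≤ 1ℚ
    L*18nθ≤1 = begin
      ι L * (ι 18 * (ι n * θ))                       ≤⟨ *-monoʳ (0≤ι L) (*-monoʳ (0≤ι 18) n*θ≤) ⟩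
      ι L * (ι 18 * (ι 24 * (ι L * ι K) * h))        ≡⟨ lem (ι L) (ι 18) (ι 24) (ι K) h ⟩
      (ι 18 * ι 24) * (ι K * (ι L * ι L)) * h        ≡⟨⟩
      ι 432 * (ι K * (ι L * ι L)) * h                ≤⟨ 432KL²h≤1 ⟩
      1ℚ                                             ∎
      where
      lem : ∀ L a c K h → L * (a * (c * (L * K) * h)) ≡ (a * c) * (K * (L * L)) * h
      lem = solve-∀ ℚ-ring

    15nθ≤1 : ι 15 * (ι n * θ) ≤ 1ℚ
    15nθ≤1 = begin
      ι 15 * (ι n * θ)              ≤⟨ *-monoˡ 0≤nθ (ι-mono (ℕ.≤ᵇ⇒≤ 15 18 _)) ⟩
      ι 18 * (ι n * θ)              ≡⟨ ℚ.*-identityˡ _ ⟨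
      1ℚ * (ι 18 * (ι n * θ))       ≤⟨ *-monoˡ (0≤* (0≤ι 18) 0≤nθ) 1≤ιL ⟩
      ι L * (ι 18 * (ι n * θ))      ≤⟨ L*18nθ≤1 ⟩
      1ℚ                            ∎
      where
      0≤nθ : 0ℚ ≤ ι n * θ
      0≤nθ = 0≤* (0≤ι n) 0≤θ

    isolated-island : Vec Bool n → Trajectories n N → ℚ
    isolated-island W ω = ι ⟦ small? t W ×-dec ((cnt (between W (∁ W)) (lookup ω i₁) ℕ.≤? size W)
      ×-dec (size W ℕ.≤? cnt (between W W) (lookup ω i₂))) ⟧

    module _ (W : Vec Bool n) (1≤s : 1 ℕ.≤ size W) (s<t : size W ℕ.< t) where

      private
        s = size W
        module Y = Scale (scale s 1≤s)

      23s<n : 23 ℕ.* s ℕ.+ 1 ℕ.≤ n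
      23s<n = ℕ.≤-trans (ℕ.≤-trans (ℕ.+-monoʳ-≤ (23 ℕ.* s) 1≤s) (ℕ.≤-trans (ℕ.≤-reflexive (lem s)) (ℕ.*-monoʳ-≤ 24 (ℕ.<⇒≤ s<t)))) 24t≤n
        where
        lem : ∀ s → 23 ℕ.* s ℕ.+ s ≡ 24 ℕ.* s
        lem = ℕ-solve

      23s≤n : 23 ℕ.* s ℕ.≤ n
      23s≤n = ℕ.≤-trans (ℕ.m≤m+n _ 1) 23s<n

      island-weights : Weights (between W (∁ W)) (between W W) s lo
      island-weights = record
        { x = recip 23 ; w = ι 24 ; Y = Y.Y ; v = Y.v ; A = rate s ; D = D
        ; irrefl-χ = ∁-disjoint W
        ; kind     = kind-cut W
        ; 0≤x = 0≤recip 23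
        ; x≤1 = 1/24≤1
        ; 0≤w = 0≤ι 24
        ; wx≡1 = ι-recip 23
        ; 1≤Y = Y.1≤Y
        ; 0≤v = Y.0≤v
        ; vY≡1 = Y.vY≡1
        ; 0≤A = 0≤rate s
        ; A≤1 = rate≤1 s 23s≤n
        ; 0≤D = 0≤D′
        ; A-bound = ℚ.≤-trans (rate-bound s (size (∁ W)) (size-∁ W) 23s<n)
            (ℚ.≤-reflexive (cong (λ z → (1ℚ - recip 23) * (ι z - ι s)) (sym (∑²-between W (∁ W)))))
        ; D-bound = ℚ.≤-trans (ℚ.≤-reflexive (cong (λ z → (Y.Y * Y.Y - 1ℚ) * ι z) (∑²-between W W))) Y.small-Y
        }

      -- The gains from internal pairs before and after m₁ combine to E^m₂ ≤ 3; every other factor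
      -- is an s-th power.
      island-bound : 𝔼₀ n (λ ω → ι ⟦ cnt (between W (∁ W)) (lookup ω i₁) ℕ.≤? s ⟧ * ι ⟦ s ℕ.≤? cnt (between W W) (lookup ω i₂) ⟧)
        ≤ 3ℚ * (ι s * θ) ^ s
      island-bound = begin
        𝔼₀ n (λ ω → ι ⟦ cnt (between W (∁ W)) (lookup ω i₁) ℕ.≤? s ⟧ * ι ⟦ s ℕ.≤? cnt (between W W) (lookup ω i₂) ⟧)
          ≤⟨ sparse-bound s i₁ i₂ d i₂≡i₁+d (ℕ.≤-reflexive (trans (cong (ℕ._+ lo) toℕ-i₂) (ℕ.m+[n∸m]≡n m₂≤N))) ⟩
        (1ℚ - rate s + D) ^ toℕ i₁ * ((1ℚ + D) ^ d * ι 24 ^ s * Y.v ^ s)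
          ≡⟨ cong (λ m → (1ℚ - rate s + D) ^ m * ((1ℚ + D) ^ d * ι 24 ^ s * Y.v ^ s)) toℕ-i₁ ⟩
        (1ℚ - rate s + D) ^ m₁ * ((1ℚ + D) ^ d * ι 24 ^ s * Y.v ^ s)
          ≤⟨ *-mono (0≤^ m₁ 0≤Λ₁) (0≤* (0≤* (0≤^ d 0≤E) (0≤^ s (0≤ι 24))) (0≤^ s 0≤Lsb)) (^-mono m₁ 0≤Λ₁ Λ₁≤)
               (*-mono (0≤* (0≤^ d 0≤Λ₂) (0≤^ s (0≤ι 24))) (0≤^ s 0≤Lsb)
                 (*-monoˡ (0≤^ s (0≤ι 24)) (^-mono d 0≤Λ₂ Λ₂≤)) (^-mono s Y.0≤v Y.v≤)) ⟩
        ((1ℚ - rate s) * E) ^ m₁ * (E ^ d * ι 24 ^ s * (ι L * ι s * b) ^ s)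
          ≡⟨ trans (cong (_* (E ^ d * ι 24 ^ s * (ι L * ι s * b) ^ s)) (^-distrib-* (1ℚ - rate s) E m₁))
               (lem₁ ((1ℚ - rate s) ^ m₁) (E ^ m₁) (E ^ d) (ι 24 ^ s) ((ι L * ι s * b) ^ s)) ⟩
        (E ^ m₁ * E ^ d) * ((1ℚ - rate s) ^ m₁ * (ι 24 ^ s * (ι L * ι s * b) ^ s))
          ≡⟨ cong (_* ((1ℚ - rate s) ^ m₁ * (ι 24 ^ s * (ι L * ι s * b) ^ s))) (trans (sym (^-homo-* E m₁ d)) (cong (E ^_) (ℕ.m+[n∸m]≡n m₁≤m₂))) ⟩
        E ^ m₂ * ((1ℚ - rate s) ^ m₁ * (ι 24 ^ s * (ι L * ι s * b) ^ s))
          ≤⟨ *-mono (0≤^ m₂ 0≤E) (0≤* (0≤^ s (0≤^ 44 0≤h)) (0≤* (0≤^ s (0≤ι 24)) (0≤^ s 0≤Lsb))) [1+2D]^m₂≤3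
               (*-monoˡ (0≤* (0≤^ s (0≤ι 24)) (0≤^ s 0≤Lsb)) ([1-rate]^m₁≤ s 23s≤n)) ⟩
        3ℚ * ((h ^ 44) ^ s * (ι 24 ^ s * (ι L * ι s * b) ^ s))
          ≡⟨ cong (3ℚ *_) (trans (cong ((h ^ 44) ^ s *_) (sym (^-distrib-* (ι 24) (ι L * ι s * b) s))) (sym (^-distrib-* (h ^ 44) (ι 24 * (ι L * ι s * b)) s))) ⟩
        3ℚ * (h ^ 44 * (ι 24 * (ι L * ι s * b))) ^ s
          ≡⟨ cong (λ y → 3ℚ * y ^ s) (lem₂ (h ^ 44) (ι 24) (ι L) (ι s) b) ⟩
        3ℚ * (ι s * θ) ^ s ∎
        where
        open Potential island-weights using (sparse-bound; 0≤Λ₁; 0≤Λ₂)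
        E = 1ℚ + (D + D)
        d = m₂ ℕ.∸ m₁
        0≤E : 0ℚ ≤ E
        0≤E = 0≤+ 0≤1 (0≤+ 0≤D′ 0≤D′)
        0≤Lsb : 0ℚ ≤ ι L * ι s * b
        0≤Lsb = 0≤* (0≤* (0≤ι L) (0≤ι s)) 0≤b
        i₂≡i₁+d : toℕ i₂ ≡ toℕ i₁ ℕ.+ d
        i₂≡i₁+d = trans toℕ-i₂ (trans (sym (ℕ.m+[n∸m]≡n m₁≤m₂)) (cong (ℕ._+ d) (sym toℕ-i₁)))
        Λ₂≤ : 1ℚ + D ≤ E
        Λ₂≤ = ≤-by D 0≤D′ (ℚ.+-assoc 1ℚ D D)
        -- Doubling `D` separates loss and gain into a product. This uses that the rate is at most
        -- 1/2.
        Λ₁≤ : 1ℚ - rate s + D ≤ (1ℚ - rate s) * E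
        Λ₁≤ = ≤-by (ι 2 * D * (ℚ.½ - rate s)) (0≤* (0≤* (0≤ι 2) 0≤D′) (a≤b⇒0≤b-a (rate≤½ s 23s≤n))) (lem (rate s) D)
          where
          lem : ∀ a d → 1ℚ - a + d + (1ℚ + (1ℚ + 0ℚ)) * d * (ℚ.½ - a) ≡ (1ℚ - a) * (1ℚ + (d + d))
          lem = solve-∀ ℚ-ring
        lem₁ : ∀ a e f c g → (a * e) * (f * c * g) ≡ (e * f) * (a * (c * g))
        lem₁ = solve-∀ ℚ-ring
        lem₂ : ∀ h c L s b → h * (c * (L * s * b)) ≡ s * (c * L * b * h)
        lem₂ = solve-∀ ℚ-ring

    ⟦⟧-× : ∀ {P Q : Set} (P? : Dec P) (Q? : Dec Q) → ι ⟦ P? ×-dec Q? ⟧ ≡ ι ⟦ P? ⟧ * ι ⟦ Q? ⟧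
    ⟦⟧-× (yes _) Q? = sym (ℚ.*-identityˡ (ι ⟦ Q? ⟧))
    ⟦⟧-× (no _)  Q? = sym (ℚ.*-zeroˡ (ι ⟦ Q? ⟧))

    -- The empty set is no island, yet it contributes 0^0 = 1 on the right. Charging 3 for it on the
    -- left later cancels the constant term of `∑-[sT]^s`, so that the total becomes proportional to
    -- nθ.
    island-term : ∀ W → 𝔼₀ n (isolated-island W) + 3ℚ * ι ⟦ size W ℕ.≟ 0 ⟧ ≤ 3ℚ * (ι (size W) * θ) ^ size W
    island-term W = by-cases (small? t W)
      where
      few? : ∀ ω → Dec _
      few? ω = cnt (between W (∁ W)) (lookup ω i₁) ℕ.≤? size W
      many? : ∀ ω → Dec _
      many? ω = size W ℕ.≤? cnt (between W W) (lookup ω i₂)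
      empty≤ : ∀ s → ι ⟦ s ℕ.≟ 0 ⟧ ≤ (ι s * θ) ^ s
      empty≤ zero    = ℚ.≤-refl
      empty≤ (suc s) = 0≤^ (suc s) (0≤* (0≤ι (suc s)) 0≤θ)
      by-cases : (c : Dec (Small t W)) →
        𝔼₀ n (λ ω → ι ⟦ c ×-dec (few? ω ×-dec many? ω) ⟧) + 3ℚ * ι ⟦ size W ℕ.≟ 0 ⟧ ≤ 3ℚ * (ι (size W) * θ) ^ size W
      by-cases (no _) = begin
        𝔼₀ n (λ ω → 0ℚ) + 3ℚ * ι ⟦ size W ℕ.≟ 0 ⟧    ≡⟨ cong (_+ 3ℚ * ι ⟦ size W ℕ.≟ 0 ⟧) (𝔼₀-const n 0ℚ) ⟩
        0ℚ + 3ℚ * ι ⟦ size W ℕ.≟ 0 ⟧                 ≡⟨ ℚ.+-identityˡ _ ⟩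
        3ℚ * ι ⟦ size W ℕ.≟ 0 ⟧                      ≤⟨ *-monoʳ (0≤ι 3) (empty≤ (size W)) ⟩
        3ℚ * (ι (size W) * θ) ^ size W               ∎
      by-cases (yes (1≤s , s<t)) = begin
        𝔼₀ n (λ ω → ι ⟦ few? ω ×-dec many? ω ⟧) + 3ℚ * ι ⟦ size W ℕ.≟ 0 ⟧
          ≡⟨ cong (λ k → 𝔼₀ n (λ ω → ι ⟦ few? ω ×-dec many? ω ⟧) + 3ℚ * ι k) (⟦⟧-no (size W ℕ.≟ 0) (λ s≡0 → ℕ.<⇒≢ 1≤s (sym s≡0))) ⟩
        𝔼₀ n (λ ω → ι ⟦ few? ω ×-dec many? ω ⟧) + 0ℚ
          ≡⟨ ℚ.+-identityʳ _ ⟩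
        𝔼₀ n (λ ω → ι ⟦ few? ω ×-dec many? ω ⟧)
          ≤⟨ 𝔼-mono N (emptyGraph n) (λ ω _ → ℚ.≤-reflexive (⟦⟧-× (few? ω) (many? ω))) ⟩
        𝔼₀ n (λ ω → ι ⟦ few? ω ⟧ * ι ⟦ many? ω ⟧)
          ≤⟨ island-bound W 1≤s s<t ⟩
        3ℚ * (ι (size W) * θ) ^ size W ∎

    islands-bound : ι L * ∑ℚ (subsets n) (λ W → 𝔼₀ n (isolated-island W)) ≤ 1ℚ
    islands-bound = ℚ.≤-trans (*-monoʳ (0≤ι L) (0≤b-a⇒a≤b (begin
      0ℚ
        ≤⟨ a≤b⇒0≤b-a (ℚ.≤-trans (ℚ.+-monoʳ-≤ total𝔼 (*-monoʳ (0≤ι 3) 1≤empties)) total) ⟩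
      3ℚ * (1ℚ + ι 6 * (ι n * θ)) - (total𝔼 + 3ℚ * 1ℚ)
        ≡⟨ lem total𝔼 (ι n * θ) ⟩
      ι 18 * (ι n * θ) - total𝔼 ∎))) L*18nθ≤1
      where
      total𝔼 = ∑ℚ (subsets n) (λ W → 𝔼₀ n (isolated-island W))
      lem : ∀ S y → (ℤ.+ 3 ℚ./ 1) * (1ℚ + (ℤ.+ 6 ℚ./ 1) * y) - (S + (ℤ.+ 3 ℚ./ 1) * 1ℚ) ≡ (ℤ.+ 18 ℚ./ 1) * y - S
      lem = solve-∀ ℚ-ring
      empties = ∑ℚ (subsets n) (λ W → ι ⟦ size W ℕ.≟ 0 ⟧)
      size-∅ : size (Vec.replicate n false) ≡ 0
      size-∅ = ∑-zero {n} (λ u → cong (λ b → if b then 1 else 0) (Vec.lookup-replicate u false))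
      1≤empties : 1ℚ ≤ empties
      1≤empties = ℚ.≤-trans (ℚ.≤-reflexive (cong ι (sym (⟦⟧-yes (size (Vec.replicate n false) ℕ.≟ 0) size-∅))))
        (term≤∑ℚ {f = λ W → ι ⟦ size W ℕ.≟ 0 ⟧} (λ W → 0≤ι ⟦ size W ℕ.≟ 0 ⟧) (∈-subsets (Vec.replicate n false)))
      total : total𝔼 + 3ℚ * empties ≤ 3ℚ * (1ℚ + ι 6 * (ι n * θ))
      total = begin
        total𝔼 + 3ℚ * empties
          ≡⟨ cong (total𝔼 +_) (∑ℚ-* (subsets n) 3ℚ (λ W → ι ⟦ size W ℕ.≟ 0 ⟧)) ⟨
        total𝔼 + ∑ℚ (subsets n) (λ W → 3ℚ * ι ⟦ size W ℕ.≟ 0 ⟧)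
          ≡⟨ ∑ℚ-+ (subsets n) (λ W → 𝔼₀ n (isolated-island W)) (λ W → 3ℚ * ι ⟦ size W ℕ.≟ 0 ⟧) ⟨
        ∑ℚ (subsets n) (λ W → 𝔼₀ n (isolated-island W) + 3ℚ * ι ⟦ size W ℕ.≟ 0 ⟧)
          ≤⟨ ∑ℚ-mono (subsets n) (λ W _ → island-term W) ⟩
        ∑ℚ (subsets n) (λ W → 3ℚ * (ι (size W) * θ) ^ size W)
          ≡⟨ ∑ℚ-* (subsets n) 3ℚ (λ W → (ι (size W) * θ) ^ size W) ⟩
        3ℚ * ∑ℚ (subsets n) (λ W → (ι (size W) * θ) ^ size W)
          ≤⟨ *-monoʳ (0≤ι 3) (∑-[sT]^s n θ 0≤θ 15nθ≤1) ⟩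
        3ℚ * (1ℚ + ι 6 * (ι n * θ)) ∎

-- Isolated vertices surviving until the first observation time

module _ where
  open Data.Nat using (_+_; _*_; _∸_; _/_; _≤_; _<_; z≤n; s≤s)
  open ℕ.≤-Reasoning

  module Blocks {n L K : ℕ} (regime : Regime n L K) where
    open Parameters regime

    -- Time is cut into blocks of r steps, r about 2n/17. A step hits a given isolated vertex with
    -- probability about 2/n, below 1/(4r), about 17/(8n), so a block spares it with probability at
    -- least 3/4. At most 12 * 17 * L blocks are needed up to `m₁`.
    r lo₁ : ℕ
    r   = suc (2 * n / 17)
    lo₁ = N ∸ m₁

    2n≤17r : 2 * n ≤ 17 * r
    2n≤17r = ℕ.≤-trans (ℕ.≤-reflexive (ℕ.m≡m%n+[m/n]*n (2 * n) 17))
      (ℕ.≤-trans (ℕ.+-monoˡ-≤ (2 * n / 17 * 17) (ℕ.<⇒≤ (ℕ.m%n<n (2 * n) 17))) (ℕ.≤-reflexive (lem (2 * n / 17))))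
      where
      lem : ∀ t → 17 + t * 17 ≡ 17 * suc t
      lem = ℕ-solve

    17r≤2n+17 : 17 * r ≤ 2 * n + 17
    17r≤2n+17 = ℕ.≤-trans (ℕ.≤-reflexive (lem (2 * n / 17))) (ℕ.+-monoˡ-≤ 17 (ℕ.m/n*n≤m (2 * n) 17))
      where
      lem : ∀ t → 17 * suc t ≡ t * 17 + 17
      lem = ℕ-solve

    4r[n-1]+m₁≤N : 4 * r * (n ∸ 1) + m₁ ≤ N
    4r[n-1]+m₁≤N = ℕ.*-cancelˡ-≤ 34 (ℕ.+-cancelʳ-≤ (17 * n) _ _ (begin
      34 * (4 * r * (n ∸ 1) + m₁) + 17 * n              ≤⟨ ℕ.+-monoˡ-≤ (17 * n) (ℕ.*-monoʳ-≤ 34 (ℕ.+-monoˡ-≤ m₁ (ℕ.*-monoʳ-≤ (4 * r) (ℕ.m∸n≤m n 1)))) ⟩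
      34 * (4 * r * n + 24 * (n * L)) + 17 * n          ≡⟨ ring₁ r n L ⟩
      8 * n * (17 * r) + n * (816 * L + 17)             ≤⟨ ℕ.+-monoˡ-≤ (n * (816 * L + 17)) (ℕ.*-monoʳ-≤ (8 * n) 17r≤2n+17) ⟩
      8 * n * (2 * n + 17) + n * (816 * L + 17)         ≡⟨ ring₂ n L ⟩
      16 * (n * n) + n * (816 * L + 153)                ≤⟨ ℕ.+-monoʳ-≤ (16 * (n * n)) (n*[aL+b]≤n² 816 153 (ℕ.≤ᵇ⇒≤ 969 1152 _)) ⟩
      16 * (n * n) + n * n                              ≡⟨ ring₃ (n * n) ⟩
      17 * (n * n)                                      ≡⟨ cong (17 *_) 2N+n≡n² ⟨
      17 * (2 * N + n)                                  ≡⟨ ring₄ N n ⟩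
      34 * N + 17 * n                                   ∎))
      where
      ring₁ : ∀ r n L → 34 * (4 * r * n + 24 * (n * L)) + 17 * n ≡ 8 * n * (17 * r) + n * (816 * L + 17)
      ring₁ = ℕ-solve
      ring₂ : ∀ n L → 8 * n * (2 * n + 17) + n * (816 * L + 17) ≡ 16 * (n * n) + n * (816 * L + 153)
      ring₂ = ℕ-solve
      ring₃ : ∀ a → 16 * a + a ≡ 17 * a
      ring₃ = ℕ-solve
      ring₄ : ∀ a b → 17 * (2 * a + b) ≡ 34 * a + 17 * b
      ring₄ = ℕ-solve

    4r[n-1]≤lo₁ : 4 * r * (n ∸ 1) ≤ lo₁
    4r[n-1]≤lo₁ = ℕ.≤-trans (ℕ.≤-reflexive (sym (ℕ.m+n∸n≡m (4 * r * (n ∸ 1)) m₁))) (ℕ.∸-monoˡ-≤ m₁ 4r[n-1]+m₁≤N)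

    2≤n : 2 ≤ n
    2≤n = ℕ.≤-trans (ℕ.≤-trans (ℕ.≤ᵇ⇒≤ 2 1152 _) (ℕ.m≤m*n 1152 L {{ℕ.>-nonZero 1≤L}})) 1152L≤n

    1≤n-1 : 1 ≤ n ∸ 1
    1≤n-1 = ℕ.∸-monoˡ-≤ 1 2≤n

    1≤lo₁ : 1 ≤ lo₁
    1≤lo₁ = ℕ.≤-trans (ℕ.*-mono-≤ {1} {4 * r} {1} (ℕ.≤-trans (s≤s z≤n) (ℕ.m≤n*m r 4)) 1≤n-1) 4r[n-1]≤lo₁

    m₁+lo₁≡N : m₁ + lo₁ ≡ N
    m₁+lo₁≡N = ℕ.m+[n∸m]≡n m₁≤N

    m₁≤204Lr : m₁ ≤ r * (12 * (17 * L))
    m₁≤204Lr = begin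
      24 * (n * L)         ≡⟨ ring₁ n L ⟩
      2 * n * (12 * L)     ≤⟨ ℕ.*-monoˡ-≤ (12 * L) 2n≤17r ⟩
      17 * r * (12 * L)    ≡⟨ ring₂ r L ⟩
      r * (12 * (17 * L))  ∎
      where
      ring₁ : ∀ n L → 24 * (n * L) ≡ 2 * n * (12 * L)
      ring₁ = ℕ-solve
      ring₂ : ∀ r L → 17 * r * (12 * L) ≡ r * (12 * (17 * L))
      ring₂ = ℕ-solve

module _ where
  open Data.Rational using (_+_; _*_; _-_; -_; _≤_; _<_)
  open ℚ.≤-Reasoning

  module IsolatedVertices {n L K : ℕ} (regime : Regime n L K) where
    open Parameters regime
    open Estimates regime using (h; p; p≡ιp; 0≤h; h≤1; p^k*h^k≡1)
    open Blocks regime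
    open SecondMoment n 2≤n

    1≤4r : 1 ℕ.≤ 4 ℕ.* r
    1≤4r = ℕ.≤-trans (ℕ.s≤s ℕ.z≤n) (ℕ.m≤n*m r 4)

    u : ℚ
    u = proj₁ (inverse (4 ℕ.* r) 1≤4r)

    4ru≡1 : ι (4 ℕ.* r) * u ≡ 1ℚ
    4ru≡1 = proj₁ (proj₂ (inverse (4 ℕ.* r) 1≤4r))

    0≤u : 0ℚ ≤ u
    0≤u = proj₂ (proj₂ (inverse (4 ℕ.* r) 1≤4r))

    u≤1 : u ≤ 1ℚ
    u≤1 = begin
      u                  ≡⟨ ℚ.*-identityˡ u ⟨
      1ℚ * u             ≤⟨ *-monoˡ 0≤u (1≤ι 1≤4r) ⟩
      ι (4 ℕ.* r) * u    ≡⟨ 4ru≡1 ⟩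
      1ℚ                 ∎

    κ≤ulo₁ : κ ≤ u * ι lo₁
    κ≤ulo₁ = begin
      κ                                    ≡⟨ trans (cong (_* κ) 4ru≡1) (ℚ.*-identityˡ κ) ⟨
      ι (4 ℕ.* r) * u * κ                  ≡⟨ lem (ι (4 ℕ.* r)) u κ ⟩
      u * (ι (4 ℕ.* r) * κ)                ≡⟨ cong (u *_) (ι-* (4 ℕ.* r) (n ℕ.∸ 1)) ⟨
      u * ι (4 ℕ.* r ℕ.* (n ℕ.∸ 1))        ≤⟨ *-monoʳ 0≤u (ι-mono 4r[n-1]≤lo₁) ⟩
      u * ι lo₁                            ∎
      where
      lem : ∀ a u k → a * u * k ≡ u * (a * k)
      lem = solve-∀ ℚ-ring

    ¾ : ℚ
    ¾ = ℤ.+ 3 ℚ./ 4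

    ¾≤[1-u]^r : ¾ ≤ (1ℚ - u) ^ r
    ¾≤[1-u]^r = begin
      ¾                         ≡⟨⟩
      1ℚ - (ℤ.+ 1 ℚ./ 4) * 1ℚ   ≡⟨ cong (λ o → 1ℚ - (ℤ.+ 1 ℚ./ 4) * o) (trans (sym 4ru≡1) (cong (_* u) (ι-* 4 r))) ⟩
      1ℚ - (ℤ.+ 1 ℚ./ 4) * (ι 4 * ι r * u)   ≡⟨ lem (ι r) u ⟩
      1ℚ - ι r * u              ≤⟨ bernoulli u r 0≤u u≤1 ⟩
      (1ℚ - u) ^ r              ∎
      where
      lem : ∀ r u → 1ℚ - (ℤ.+ 1 ℚ./ 4) * ((ℤ.+ 4 ℚ./ 1) * r * u) ≡ 1ℚ - r * u
      lem = solve-∀ ℚ-ring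

    0≤1-u : 0ℚ ≤ 1ℚ - u
    0≤1-u = a≤b⇒0≤b-a u≤1

    -- (3/4)¹² ≥ 2⁻⁵.
    h^85≤[1-u]^m₁ : h ^ 85 ≤ (1ℚ - u) ^ m₁
    h^85≤[1-u]^m₁ = begin
      h ^ 85                                  ≡⟨ trans (^-assocʳ ℚ.½ L 85) (trans (cong (ℚ.½ ^_) (ring L)) (sym (^-assocʳ ℚ.½ 5 (17 ℕ.* L)))) ⟩
      (ℚ.½ ^ 5) ^ (17 ℕ.* L)                  ≤⟨ ^-mono (17 ℕ.* L) (ℚ.≤ᵇ⇒≤ _) (ℚ.≤ᵇ⇒≤ _) ⟩
      (¾ ^ 12) ^ (17 ℕ.* L)                   ≡⟨ ^-assocʳ ¾ 12 (17 ℕ.* L) ⟩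
      ¾ ^ (12 ℕ.* (17 ℕ.* L))                 ≤⟨ ^-mono (12 ℕ.* (17 ℕ.* L)) (ℚ.≤ᵇ⇒≤ _) ¾≤[1-u]^r ⟩
      ((1ℚ - u) ^ r) ^ (12 ℕ.* (17 ℕ.* L))    ≡⟨ ^-assocʳ (1ℚ - u) r (12 ℕ.* (17 ℕ.* L)) ⟩
      (1ℚ - u) ^ (r ℕ.* (12 ℕ.* (17 ℕ.* L)))  ≤⟨ ^-antitone 0≤1-u (≤-by u 0≤u (lem u)) m₁≤204Lr ⟩
      (1ℚ - u) ^ m₁                           ∎
      where
      ring : ∀ L → L ℕ.* 85 ≡ 5 ℕ.* (17 ℕ.* L)
      ring = ℕ-solve
      lem : ∀ u → 1ℚ - u + u ≡ 1ℚ
      lem = solve-∀ ℚ-ring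

    -- Here 85 < 86 enters: n is at least p^86 and the survival probability at least p^-85, which
    -- leaves p ≥ L expected isolated vertices.
    L≤μ : ι L ≤ μ (toℕ i₁)
    L≤μ = begin
      ι L                          ≤⟨ ι-mono L≤p ⟩
      ι pℕ                         ≡⟨ trans p≡ιp (sym (ℚ.*-identityʳ p)) ⟩
      p * 1ℚ                       ≡⟨ trans (cong (p *_) (sym (p^k*h^k≡1 85))) (sym (ℚ.*-assoc p (p ^ 85) (h ^ 85))) ⟩
      p ^ 86 * h ^ 85              ≡⟨ cong (_* h ^ 85) (trans (ι-^ pℕ 86) (cong (_^ 86) p≡ιp)) ⟨
      ι (pℕ ℕ.^ 86) * h ^ 85       ≤⟨ *-mono (0≤ι (pℕ ℕ.^ 86)) (ℚ.≤-trans (0≤^ 85 0≤h) h^85≤survival) (ι-mono p^86≤n) h^85≤survival ⟩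
      ι n * survival (toℕ i₁) N    ∎
      where
      h^85≤survival : h ^ 85 ≤ survival (toℕ i₁) N
      h^85≤survival = ℚ.≤-trans h^85≤[1-u]^m₁ (ℚ.≤-trans (ℚ.≤-reflexive (cong ((1ℚ - u) ^_) (sym toℕ-i₁)))
        (survival-lower lo₁ 1≤lo₁ u≤1 κ≤ulo₁ (toℕ i₁) N (ℕ.≤-reflexive (trans (cong (ℕ._+ lo₁) toℕ-i₁) m₁+lo₁≡N))))

    no-isolated : Trajectories n N → ℚ
    no-isolated ω = no-iso (lookup ω i₁)

    no-isolated-bound : ι L * 𝔼₀ n no-isolated ≤ 1ℚ
    no-isolated-bound = begin
      ι L * 𝔼₀ n no-isolated
        ≤⟨ *-monoˡ (ℚ.≤-trans (ℚ.≤-reflexive (sym (𝔼₀-const n 0ℚ))) (𝔼-mono N (emptyGraph n) (λ ω _ → 0≤ι ⟦ #iso (lookup ω i₁) ℕ.≟ 0 ⟧))) L≤μ ⟩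
      μ (toℕ i₁) * 𝔼₀ n no-isolated
        ≤⟨ second-moment-bound i₁ (ℕ.≤-trans (ℕ.+-monoʳ-≤ (toℕ i₁) 1≤lo₁) (ℕ.≤-reflexive (trans (cong (ℕ._+ lo₁) toℕ-i₁) m₁+lo₁≡N)))
             (ℚ.<-≤-trans (0<ι 1≤L) L≤μ) ⟩
      1ℚ ∎

-- The good event

module _ where
  open Data.Nat using (_+_; _*_; _≤_; _<_; z≤n; s≤s)

  Increasing : ∀ {n k} → Trajectories n k → Set
  Increasing ω = ∀ i j → i Fin.≤ j → lookup ω i ⊆ᴳ lookup ω j

  increasing? : ∀ {n k} (ω : Trajectories n k) → Dec (Increasing ω)
  increasing? ω = Fin.all? (λ i → Fin.all? (λ j → (i Fin.≤? j) →-dec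
    Fin.all? (λ u → Fin.all? (λ v → SimpleGraph._~?_ (lookup ω i) u v →-dec SimpleGraph._~?_ (lookup ω j) u v))))

  trajectory-head : ∀ {n k G} {ω : Trajectories n k} → Trajectory G ω → lookup ω zero ≡ G
  trajectory-head finish        = refl
  trajectory-head (advance _ _) = refl

  trajectory-increasing : ∀ {n k G} {ω : Trajectories n k} → Trajectory G ω → Increasing ω
  trajectory-increasing _               zero    zero    _   u v e = e
  trajectory-increasing (advance _ t)   zero    (suc j) _   u v e =
    trajectory-increasing t zero j z≤n u v (subst (λ H → SimpleGraph._~_ H u v) (sym (trajectory-head t)) (inj₁ e))
  trajectory-increasing (advance _ t)   (suc i) (suc j) i≤j = trajectory-increasing t i j (ℕ.≤-pred i≤j)

  least : ∀ {n} {P : Fin n → Set} → (∀ i → Dec (P i)) → ∃ P → ∃[ i ] (P i × (∀ j → j Fin.< i → ¬ P j))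
  least {suc n} {P} P? (k , pk) = by-cases (P? zero) k pk
    where
    by-cases : Dec (P zero) → ∀ k → P k → ∃[ i ] (P i × (∀ j → j Fin.< i → ¬ P j))
    by-cases (yes p₀) _       _  = zero , p₀ , λ _ ()
    by-cases (no ¬p₀) zero    pk = contradiction pk ¬p₀
    by-cases (no ¬p₀) (suc k) pk =
      let i , pi , below = least (P? ∘ suc) (k , pk)
      in suc i , pi , λ { zero _ → ¬p₀ ; (suc j) j<i → below j (ℕ.≤-pred j<i) }

  indicator-set : ∀ {n} {P : Fin n → Set} → (∀ v → Dec (P v)) → Vec Bool n
  indicator-set P? = Vec.tabulate (does ∘ P?)

  member-indicator-set : ∀ {n} {P : Fin n → Set} (P? : ∀ v → Dec (P v)) v → member (indicator-set P?) v ≡ ⟦ P? v ⟧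
  member-indicator-set P? v = cong (λ b → if b then 1 else 0) (Vec.lookup∘tabulate (does ∘ P?) v)

  size-indicator-set : ∀ {n} {P : Fin n → Set} (P? : ∀ v → Dec (P v)) → size (indicator-set P?) ≡ ∣ P? ∣ˢ
  size-indicator-set P? = sum-cong-≗ (member-indicator-set P?)

  member-∁-indicator-set : ∀ {n} {P : Fin n → Set} (P? : ∀ v → Dec (P v)) v → member (∁ (indicator-set P?)) v ≡ ⟦ ¬? (P? v) ⟧
  member-∁-indicator-set P? v = ℕ.+-cancelˡ-≡ ⟦ P? v ⟧ _ _ (trans
    (trans (cong (_+ member (∁ (indicator-set P?)) v) (sym (member-indicator-set P? v))) (member-∁ (indicator-set P?) v))
    (trans (sym (⟦⟧-¬ (P? v))) (ℕ.+-comm ⟦ ¬? (P? v) ⟧ ⟦ P? v ⟧)))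

  δ≥2-mono : ∀ {n} {G H : Graph n} → 2 ≤ n → G ⊆ᴳ H → 2 ≤ δ G → 2 ≤ δ H
  δ≥2-mono {G = G} {H} 2≤n G⊆H 2≤δ = deg≥⇒δ≥ H 2≤n (λ v →
    ℕ.≤-trans (δ≥⇒deg≥ G 2≤δ v) (∑-mono (adj-mono {G = G} {H} G⊆H v)))

  module Whp {n L K : ℕ} (regime : Regime n L K) where
    open Parameters regime
    open Blocks regime using (2≤n)

    low-degree? : ∀ (ω : Trajectories n N) (v : Fin n) → Dec (cnt (between (single v) (∁ (single v))) (lookup ω i₂) ≤ size (single v))
    low-degree? ω v = cnt (between (single v) (∁ (single v))) (lookup ω i₂) ℕ.≤? size (single v)

    few-between? : ∀ (ω : Trajectories n N) (S T : Vec Bool n) → Dec (LargeDisjoint t S T × cnt (between S T) (lookup ω i₁) ≤ size S)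
    few-between? ω S T = largeDisjoint? t S T ×-dec (cnt (between S T) (lookup ω i₁) ℕ.≤? size S)

    isolated-island? : ∀ (ω : Trajectories n N) (W : Vec Bool n) → Dec (Small t W × cnt (between W (∁ W)) (lookup ω i₁) ≤ size W × size W ≤ cnt (between W W) (lookup ω i₂))
    isolated-island? ω W = small? t W ×-dec ((cnt (between W (∁ W)) (lookup ω i₁) ℕ.≤? size W)
      ×-dec (size W ℕ.≤? cnt (between W W) (lookup ω i₂)))

    -- A Boolean event must imply rigidity on every vector of graphs, including those the process
    -- never produces; monotonicity is therefore part of the event. It costs no probability, by
    -- `trajectory-increasing`.
    Good : Trajectories n N → Set
    Good ω = Increasing ω
      × #iso (lookup ω i₁) ≢ 0
      × All (λ v → ¬ (cnt (between (single v) (∁ (single v))) (lookup ω i₂) ≤ size (single v))) (List.allFin n)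
      × All (λ S → All (λ T → ¬ (LargeDisjoint t S T × cnt (between S T) (lookup ω i₁) ≤ size S)) (subsets n)) (subsets n)
      × All (λ W → ¬ (Small t W × cnt (between W (∁ W)) (lookup ω i₁) ≤ size W × size W ≤ cnt (between W W) (lookup ω i₂))) (subsets n)

    good? : ∀ ω → Dec (Good ω)
    good? ω = increasing? ω
      ×-dec ¬? (#iso (lookup ω i₁) ℕ.≟ 0)
      ×-dec All.all? (λ v → ¬? (low-degree? ω v)) (List.allFin n)
      ×-dec All.all? (λ S → All.all? (λ T → ¬? (few-between? ω S T)) (subsets n)) (subsets n)
      ×-dec All.all? (λ W → ¬? (isolated-island? ω W)) (subsets n)

    module _ (ω : Trajectories n N) (good : Good ω) where

      private
        G₁ = lookup ω i₁
        G₂ = lookup ω i₂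
        increasing = proj₁ good
        some-isolated = proj₁ (proj₂ good)
        no-low-degree = proj₁ (proj₂ (proj₂ good))
        no-few-between = proj₁ (proj₂ (proj₂ (proj₂ good)))
        no-island = proj₂ (proj₂ (proj₂ (proj₂ good)))

      δG₁<2 : ¬ (2 ≤ δ G₁)
      δG₁<2 2≤δ = some-isolated (∑-zero (λ v → ⟦⟧-no (deg G₁ v ℕ.≟ 0) (λ deg≡0 →
        contradiction (ℕ.≤-trans (δ≥⇒deg≥ G₁ 2≤δ v) (ℕ.≤-reflexive deg≡0)) λ ())))

      -- The cut of a singleton counts the neighbours of its vertex, and a good trajectory has
      -- strictly more than one of them at time `m₂`.
      deg-G₂ : ∀ v → 2 ≤ deg G₂ v
      deg-G₂ v = ℕ.≤-trans
        (subst (_< cnt (between (single v) (∁ (single v))) G₂) (size-single v)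
          (ℕ.≰⇒> (All.lookup no-low-degree (∈.∈-allFin v))))
        (ℕ.≤-trans (ℕ.≤-reflexive factor) (ℕ.≤-trans (∑-mono (λ u → ℕ.*-monoʳ-≤ ⟦ u Fin.≟ v ⟧ (∑-mono (bound u))))
          (ℕ.≤-reflexive (∑-δ v (deg G₂)))))
        where
        bound : ∀ u w → member (∁ (single v)) w * adj G₂ u w ≤ adj G₂ u w
        bound u w = ℕ.≤-trans (ℕ.*-monoˡ-≤ (adj G₂ u w) (member≤1 (∁ (single v)) w)) (ℕ.≤-reflexive (ℕ.*-identityˡ (adj G₂ u w)))
        factor : cnt (between (single v) (∁ (single v))) G₂ ≡ ∑[ u < n ] (⟦ u Fin.≟ v ⟧ * ∑[ w < n ] (member (∁ (single v)) w * adj G₂ u w))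
        factor = sum-cong-≗ (λ u → trans
          (sum-cong-≗ (λ w → trans (cong (λ m → m * member (∁ (single v)) w * adj G₂ u w) (member-single v u))
            (ℕ.*-assoc ⟦ u Fin.≟ v ⟧ (member (∁ (single v)) w) (adj G₂ u w))))
          (sym (*-distribˡ-sum ⟦ u Fin.≟ v ⟧ (λ w → member (∁ (single v)) w * adj G₂ u w))))

      expanding : Expanding t G₁ G₂
      expanding = record
        { many-between = λ {P} {Q} P? Q? disjoint t≤P t≤Q →
            let S = indicator-set P? ; U = indicator-set Q? in
            subst₂ _<_ (size-indicator-set P?)
              (∑²-cong (λ u v → cong₂ (λ a b → a * b * adj G₁ u v) (member-indicator-set P? u) (member-indicator-set Q? v)))
              (ℕ.≰⇒> (λ few → All.lookup (All.lookup no-few-between (∈-subsets S)) (∈-subsets U)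
                ( ( (λ u → trans (cong₂ _*_ (member-indicator-set P? u) (member-indicator-set Q? u)) (product (P? u) (Q? u) (disjoint u)))
                  , subst (t ≤_) (sym (size-indicator-set P?)) t≤P
                  , subst (t ≤_) (sym (size-indicator-set Q?)) t≤Q)
                , few)))
        ; no-sparse-set = λ {P} P? 1≤P P<t few many →
            let W = indicator-set P? in
            All.lookup no-island (∈-subsets W)
              ( (subst (1 ≤_) (sym (size-indicator-set P?)) 1≤P , subst (_< t) (sym (size-indicator-set P?)) P<t)
              , subst₂ _≤_ (sym (∑²-cong (λ u v → cong₂ (λ a b → a * b * adj G₁ u v) (member-indicator-set P? u) (member-∁-indicator-set P? v))))
                  (sym (size-indicator-set P?)) few
              , subst₂ _≤_ (sym (size-indicator-set P?))
                  (sym (∑²-cong (λ u v → cong₂ (λ a b → a * b * adj G₂ u v) (member-indicator-set P? u) (member-indicator-set P? v)))) many )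
        }
        where
        product : ∀ {P Q : Set} (P? : Dec P) (Q? : Dec Q) → (P → ¬ Q) → ⟦ P? ⟧ * ⟦ Q? ⟧ ≡ 0
        product (no _)  _       _        = refl
        product (yes _) (no _)  _        = refl
        product (yes p) (yes q) disjoint = contradiction q (disjoint p)

      1≤t : 1 ≤ t
      1≤t = ℕ.≮⇒≥ (λ t<1 → ℕ.<⇒≱ (ℕ.≤-<-trans (ℕ.≤-trans n≤24[1+t] (ℕ.*-monoʳ-≤ 24 t<1)) (ℕ.≤ᵇ⇒≤ 25 1152 _))
        (ℕ.≤-trans (ℕ.m≤m*n 1152 L {{ℕ.>-nonZero 1≤L}}) 1152L≤n))

      9t≤n : 9 * t ≤ n
      9t≤n = ℕ.≤-trans (ℕ.*-monoˡ-≤ t (ℕ.≤ᵇ⇒≤ 9 24 _)) 24t≤n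

      rigid-at-τ : ∃[ τ ] (IsHittingTime 2 ω τ × GloballyRigid (lookup ω τ))
      rigid-at-τ =
        let τ , 2≤δ , before = least (λ i → 2 ℕ.≤? δ (lookup ω i)) (i₂ , deg≥⇒δ≥ G₂ 2≤n deg-G₂)
            τ≤i₂ : τ Fin.≤ i₂
            τ≤i₂ = ℕ.≮⇒≥ (λ i₂<τ → before i₂ i₂<τ (deg≥⇒δ≥ G₂ 2≤n deg-G₂))
            i₁≤τ : i₁ Fin.≤ τ
            -- Minimum degree 2 persists under adding edges, whereas the graph at `i₁` still has an
            -- isolated vertex.
            i₁≤τ = ℕ.≮⇒≥ (λ τ<i₁ → δG₁<2 (δ≥2-mono {G = lookup ω τ} {G₁} 2≤n (increasing τ i₁ (ℕ.<⇒≤ τ<i₁)) 2≤δ))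
        in τ , (2≤δ , before) , rigid-if-one-class (lookup ω τ)
             (one-class {G₁ = G₁} {lookup ω τ} {G₂} 1≤t 9t≤n (increasing i₁ τ i₁≤τ) (increasing τ i₂ τ≤i₂) (δ≥⇒deg≥ (lookup ω τ) 2≤δ) expanding)

-- Probability of the good event

module _ where
  open Data.Rational using (_+_; _*_; _-_; -_; _≤_; _<_)
  open ℚ.≤-Reasoning

  all-or-1≤∑ : ∀ {a p} {A : Set a} {P : A → Set p} (xs : List A) (f : A → ℚ) → (∀ x → 0ℚ ≤ f x) →
    (∀ x → P x ⊎ 1ℚ ≤ f x) → All P xs ⊎ 1ℚ ≤ ∑ℚ xs f
  all-or-1≤∑ []       f 0≤f dec = inj₁ All.[]
  all-or-1≤∑ {P = P} (x ∷ xs) f 0≤f dec = combine (dec x) (all-or-1≤∑ xs f 0≤f dec)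
    where
    combine : P x ⊎ 1ℚ ≤ f x → All P xs ⊎ 1ℚ ≤ ∑ℚ xs f → All P (x ∷ xs) ⊎ 1ℚ ≤ f x + ∑ℚ xs f
    combine (inj₂ 1≤f) _          = inj₂ (ℚ.≤-trans 1≤f (≤-by (∑ℚ xs f) (∑ℚ-nonneg xs 0≤f) refl))
    combine (inj₁ px)  (inj₁ pxs) = inj₁ (px All.∷ pxs)
    combine (inj₁ _)   (inj₂ 1≤∑) = inj₂ (ℚ.≤-trans 1≤∑ (≤-by (f x) (0≤f x) (ℚ.+-comm (∑ℚ xs f) (f x))))

  ¬-or-1≤ : ∀ {p} {P : Set p} (P? : Dec P) → ¬ P ⊎ 1ℚ ≤ ι ⟦ P? ⟧
  ¬-or-1≤ (yes _) = inj₂ ℚ.≤-refl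
  ¬-or-1≤ (no ¬p) = inj₁ ¬p

  indicator-yes : ∀ {p} {P : Set p} (P? : Dec P) → P → indicator (does P?) ≡ 1ℚ
  indicator-yes (yes _) _ = refl
  indicator-yes (no ¬p) p = contradiction p ¬p

  T-does⇒ : ∀ {p} {P : Set p} (P? : Dec P) → T (does P?) → P
  T-does⇒ (yes p) _ = p

  0≤indicator : ∀ b → 0ℚ ≤ indicator b
  0≤indicator true  = 0≤1
  0≤indicator false = ℚ.≤-refl

  module WhpBound {n L K : ℕ} (regime : Regime n L K) where
    open Parameters regime
    open Bounds regime
    open IsolatedVertices regime using (no-isolated; no-isolated-bound)
    open Estimates regime using (l; Ll≡1; 0≤l)
    open Whp regime

    X₁ X₂ X₃ X₄ : Trajectories n N → ℚ
    X₁ = no-isolated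
    X₂ ω = ∑ℚ (List.allFin n) (λ v → low-degree v ω)
    X₃ ω = ∑ℚ (subsets n) (λ S → ∑ℚ (subsets n) (λ T → few-between S T ω))
    X₄ ω = ∑ℚ (subsets n) (λ W → isolated-island W ω)

    -- Markov's inequality in pointwise form: each way of failing makes one of the four counts at
    -- least 1. Taking expectations then bounds the failure probability by 4/L.
    good-or-bad : ∀ ω → Trajectory (emptyGraph n) ω → 1ℚ ≤ indicator (does (good? ω)) + (X₁ ω + (X₂ ω + (X₃ ω + X₄ ω)))
    good-or-bad ω trajectory = combine
      (¬-or-1≤ (#iso (lookup ω i₁) ℕ.≟ 0))
      (all-or-1≤∑ (List.allFin n) (λ v → low-degree v ω) (λ v → 0≤ι ⟦ low-degree? ω v ⟧) (λ v → ¬-or-1≤ (low-degree? ω v)))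
      (all-or-1≤∑ (subsets n) (λ S → ∑ℚ (subsets n) (λ T → few-between S T ω))
        (λ S → ∑ℚ-nonneg (subsets n) (λ T → 0≤ι ⟦ few-between? ω S T ⟧))
        (λ S → all-or-1≤∑ (subsets n) (λ T → few-between S T ω) (λ T → 0≤ι ⟦ few-between? ω S T ⟧) (λ T → ¬-or-1≤ (few-between? ω S T))))
      (all-or-1≤∑ (subsets n) (λ W → isolated-island W ω) (λ W → 0≤ι ⟦ isolated-island? ω W ⟧) (λ W → ¬-or-1≤ (isolated-island? ω W)))
      where
      0≤B = 0≤indicator (does (good? ω))
      0≤X₁ : 0ℚ ≤ X₁ ω
      0≤X₁ = 0≤ι ⟦ #iso (lookup ω i₁) ℕ.≟ 0 ⟧
      0≤X₂ : 0ℚ ≤ X₂ ω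
      0≤X₂ = ∑ℚ-nonneg (List.allFin n) (λ v → 0≤ι ⟦ low-degree? ω v ⟧)
      0≤X₃ : 0ℚ ≤ X₃ ω
      0≤X₃ = ∑ℚ-nonneg (subsets n) (λ S → ∑ℚ-nonneg (subsets n) (λ T → 0≤ι ⟦ few-between? ω S T ⟧))
      0≤X₄ : 0ℚ ≤ X₄ ω
      0≤X₄ = ∑ℚ-nonneg (subsets n) (λ W → 0≤ι ⟦ isolated-island? ω W ⟧)
      left : ∀ {a b} → 0ℚ ≤ b → 1ℚ ≤ a → 1ℚ ≤ a + b
      left {a} {b} 0≤b 1≤a = ℚ.≤-trans 1≤a (≤-by b 0≤b refl)
      right : ∀ {a b} → 0ℚ ≤ a → 1ℚ ≤ b → 1ℚ ≤ a + b
      right {a} {b} 0≤a 1≤b = ℚ.≤-trans 1≤b (≤-by a 0≤a (ℚ.+-comm b a))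
      combine : _ ⊎ 1ℚ ≤ X₁ ω → _ ⊎ 1ℚ ≤ X₂ ω → _ ⊎ 1ℚ ≤ X₃ ω → _ ⊎ 1ℚ ≤ X₄ ω →
        1ℚ ≤ indicator (does (good? ω)) + (X₁ ω + (X₂ ω + (X₃ ω + X₄ ω)))
      combine (inj₂ 1≤) _ _ _ = right 0≤B (left (0≤+ 0≤X₂ (0≤+ 0≤X₃ 0≤X₄)) 1≤)
      combine _ (inj₂ 1≤) _ _ = right 0≤B (right 0≤X₁ (left (0≤+ 0≤X₃ 0≤X₄) 1≤))
      combine _ _ (inj₂ 1≤) _ = right 0≤B (right 0≤X₁ (right 0≤X₂ (left 0≤X₄ 1≤)))
      combine _ _ _ (inj₂ 1≤) = right 0≤B (right 0≤X₁ (right 0≤X₂ (right 0≤X₃ 1≤)))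
      combine (inj₁ g₁) (inj₁ g₂) (inj₁ g₃) (inj₁ g₄) = left (0≤+ 0≤X₁ (0≤+ 0≤X₂ (0≤+ 0≤X₃ 0≤X₄)))
        (ℚ.≤-reflexive (sym (indicator-yes (good? ω) (trajectory-increasing trajectory , g₁ , g₂ , g₃ , g₄))))

    L*x≤1⇒x≤l : ∀ {x} → ι L * x ≤ 1ℚ → x ≤ l
    L*x≤1⇒x≤l Lx≤1 = *-cancel-≤ (ι L) (0<ι 1≤L) (ℚ.≤-trans Lx≤1 (ℚ.≤-reflexive (sym Ll≡1)))

    N≤M : N ℕ.≤ #nonEdges (emptyGraph n)
    N≤M = ℕ.≤-reflexive (sym (#nonEdges-empty n))

    good-probability : 1ℚ - ι 4 * l ≤ 𝔼₀ n (indicator ∘ does ∘ good?)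
    good-probability = 0≤b-a⇒a≤b (begin
      0ℚ
        ≤⟨ a≤b⇒0≤b-a (begin
            1ℚ                                                              ≡⟨ 𝔼₀-const n 1ℚ ⟨
            𝔼₀ n (λ _ → 1ℚ)                                                 ≤⟨ 𝔼-mono N (emptyGraph n) good-or-bad ⟩
            𝔼₀ n (λ ω → B ω + (X₁ ω + (X₂ ω + (X₃ ω + X₄ ω))))              ≡⟨ split ⟩
            𝔼₀ n B + (𝔼₀ n X₁ + (𝔼₀ n X₂ + (𝔼₀ n X₃ + 𝔼₀ n X₄)))            ≤⟨ ℚ.+-monoʳ-≤ (𝔼₀ n B) (ℚ.+-mono-≤ (L*x≤1⇒x≤l no-isolated-bound)
                                                                                 (ℚ.+-mono-≤ X₂≤ (ℚ.+-mono-≤ X₃≤ X₄≤))) ⟩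
            𝔼₀ n B + (l + (l + (l + l)))                                    ∎) ⟩
      𝔼₀ n B + (l + (l + (l + l))) - 1ℚ
        ≡⟨ lem (𝔼₀ n B) l ⟩
      𝔼₀ n B - (1ℚ - ι 4 * l) ∎)
      where
      B : Trajectories n N → ℚ
      B = indicator ∘ does ∘ good?
      split : 𝔼₀ n (λ ω → B ω + (X₁ ω + (X₂ ω + (X₃ ω + X₄ ω)))) ≡ 𝔼₀ n B + (𝔼₀ n X₁ + (𝔼₀ n X₂ + (𝔼₀ n X₃ + 𝔼₀ n X₄)))
      split = trans (𝔼-+ N (emptyGraph n) B _) (cong (λ y → 𝔼₀ n B + y)
        (trans (𝔼-+ N (emptyGraph n) X₁ _) (cong (λ y → 𝔼₀ n X₁ + y)
          (trans (𝔼-+ N (emptyGraph n) X₂ _) (cong (λ y → 𝔼₀ n X₂ + y) (𝔼-+ N (emptyGraph n) X₃ X₄))))))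
      X₂≤ : 𝔼₀ n X₂ ≤ l
      X₂≤ = L*x≤1⇒x≤l (subst (λ y → ι L * y ≤ 1ℚ) (sym (𝔼-∑ N (emptyGraph n) (List.allFin n) low-degree N≤M)) low-degrees-bound)
      X₃≤ : 𝔼₀ n X₃ ≤ l
      X₃≤ = L*x≤1⇒x≤l (subst (λ y → ι L * y ≤ 1ℚ) (sym (trans (𝔼-∑ N (emptyGraph n) (subsets n) (λ S ω → ∑ℚ (subsets n) (λ T → few-between S T ω)) N≤M)
        (∑ℚ-cong (subsets n) (λ S _ → 𝔼-∑ N (emptyGraph n) (subsets n) (few-between S) N≤M)))) few-betweens-bound)
      X₄≤ : 𝔼₀ n X₄ ≤ l
      X₄≤ = L*x≤1⇒x≤l (subst (λ y → ι L * y ≤ 1ℚ) (sym (𝔼-∑ N (emptyGraph n) (subsets n) isolated-island N≤M)) islands-bound)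
      lem : ∀ e l → e + (l + (l + (l + l))) - 1ℚ ≡ e - (1ℚ - (1ℚ + (1ℚ + (1ℚ + (1ℚ + 0ℚ)))) * l)
      lem = solve-∀ ℚ-ring

    rigid-whp : Pr[ randomGraphProcess n ∣ (λ ω → ∃[ τ ] (IsHittingTime 2 ω τ × GloballyRigid (lookup ω τ))) ]≥ (1ℚ - ι 4 * l)
    rigid-whp = does ∘ good? , (λ ω b → rigid-at-τ ω (T-does⇒ (good? ω) b)) , (begin
      1ℚ - ι 4 * l
        ≤⟨ good-probability ⟩
      𝔼₀ n (indicator ∘ does ∘ good?)
        ≡⟨ trans (Pr≡EX (randomGraphProcess n) (does ∘ good?)) (EX-processFrom N (emptyGraph n) (indicator ∘ does ∘ good?)) ⟨
      Pr (randomGraphProcess n) (does ∘ good?) ∎)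

    4l≤recip : ∀ {d} → 4 ℕ.* suc d ℕ.≤ L → ι 4 * l ≤ recip d
    4l≤recip {d} 4d≤L = *-cancel-≤ (ι (suc d)) (0<ι {suc d} (ℕ.s≤s ℕ.z≤n)) (begin
      ι (suc d) * (ι 4 * l)      ≡⟨ lem (ι (suc d)) (ι 4) l ⟩
      ι 4 * ι (suc d) * l        ≡⟨ cong (_* l) (ι-* 4 (suc d)) ⟨
      ι (4 ℕ.* suc d) * l        ≤⟨ *-monoˡ 0≤l (ι-mono 4d≤L) ⟩
      ι L * l                    ≡⟨ trans Ll≡1 (sym (ι-recip d)) ⟩
      ι (suc d) * recip d        ∎)
      where
      lem : ∀ a b l → a * (b * l) ≡ b * a * l
      lem = solve-∀ ℚ-ring

  Pr≥-antitone : ∀ {a} {A : Set a} (d : Dist A) {E : A → Set} {x y} → x ≤ y → Pr[ d ∣ E ]≥ y → Pr[ d ∣ E ]≥ x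
  Pr≥-antitone d x≤y (b , b⇒E , y≤) = b , b⇒E , ℚ.≤-trans x≤y y≤

  -- A positive rational has numerator at least 1.
  recip≤ : ∀ ε → 0ℚ < ε → recip (ℚ.denominator-1 ε) ≤ ε
  recip≤ (ℚ.mkℚ (ℤ.+ suc m) d c) _ = ℚ.toℚᵘ-cancel-≤ (ℚᵘ.≤-trans (ℚᵘ.≤-reflexive (ℚ.toℚᵘ-fromℚᵘ (ℚᵘ.mkℚᵘ (ℤ.+ 1) d)))
    (ℚᵘ.*≤* (ℤ.+≤+ (ℕ.*-monoˡ-≤ (suc d) (ℕ.s≤s (ℕ.z≤n {m}))))))
  recip≤ (ℚ.mkℚ (ℤ.+ zero) d c) (ℚ.*<* (ℤ.+<+ ()))
  recip≤ (ℚ.mkℚ ℤ.-[1+ m ] d c) (ℚ.*<* ())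

-- The scale L as a function of n

module _ where
  open Data.Nat using (_+_; _*_; _≤_; _<_; z≤n; s≤s)
  open ℕ.≤-Reasoning

  -- Passing from x to x + 1 doubles the right side and at most doubles the left, since (x + 1)² ≤
  -- 2x² for x ≥ 3.
  exponential-dominates : ∀ c {a} → 3 ≤ a → c * (a * a) ≤ 2 ℕ.^ a → ∀ {x} → a ℕ.≤′ x → c * (x * x) ≤ 2 ℕ.^ x
  exponential-dominates c 3≤a base ℕ.≤′-refl = base
  exponential-dominates c 3≤a base (ℕ.≤′-step {x} a≤x) = begin
    c * (suc x * suc x)      ≤⟨ ℕ.*-monoʳ-≤ c (square x (ℕ.≤-trans 3≤a (ℕ.≤′⇒≤ a≤x))) ⟩
    c * (2 * (x * x))        ≡⟨ ring c (x * x) ⟩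
    2 * (c * (x * x))        ≤⟨ ℕ.*-monoʳ-≤ 2 (exponential-dominates c 3≤a base a≤x) ⟩
    2 * 2 ℕ.^ x              ∎
    where
    ring : ∀ c a → c * (2 * a) ≡ 2 * (c * a)
    ring = ℕ-solve
    square : ∀ x → 3 ≤ x → suc x * suc x ≤ 2 * (x * x)
    square (suc (suc (suc y))) (s≤s (s≤s (s≤s _))) =
      ℕ.≤-trans (ℕ.m≤m+n ((4 + y) * (4 + y)) (y * y + 4 * y + 2)) (ℕ.≤-reflexive (ring′ y))
      where
      ring′ : ∀ y → (4 + y) * (4 + y) + (y * y + 4 * y + 2) ≡ 2 * ((3 + y) * (3 + y))
      ring′ = ℕ-solve

  n<2^n : ∀ n → n < 2 ℕ.^ n
  n<2^n zero    = s≤s z≤n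
  n<2^n (suc n) = ℕ.≤-trans (s≤s (n<2^n n)) (ℕ.≤-trans (ℕ.+-monoˡ-≤ (2 ℕ.^ n) (ℕ.m^n>0 2 n))
    (ℕ.≤-reflexive (cong (λ k → 2 ℕ.^ n + k) (sym (ℕ.+-identityʳ (2 ℕ.^ n))))))

  -- Choose the last scale whose 86th power does not exceed n. The next scale is larger by the
  -- factor 2^86 and exceeds n, which is where the constant `K` comes from.
  scale-of : ∀ L₀ n → (2 ℕ.^ L₀) ℕ.^ 86 ≤ n →
    ∃[ d ] ((2 ℕ.^ (L₀ + d)) ℕ.^ 86 ≤ n × n ≤ 2 ℕ.^ 86 * (2 ℕ.^ (L₀ + d)) ℕ.^ 86)
  scale-of L₀ n small =
    let d , _ , below , above = intermediate f (suc n) n (s≤s (subst (λ k → (2 ℕ.^ k) ℕ.^ 86 ≤ n) (sym (ℕ.+-identityʳ L₀)) small)) n<f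
    in d , ℕ.≤-pred below , ℕ.≤-trans (ℕ.n≤1+n n) (ℕ.≤-trans above (ℕ.≤-reflexive (step-factor d)))
    where
    f : ℕ → ℕ
    f d = (2 ℕ.^ (L₀ + d)) ℕ.^ 86
    n<f : n < f n
    n<f = ℕ.<-≤-trans (n<2^n n) (ℕ.≤-trans (ℕ.^-monoʳ-≤ 2 (ℕ.≤-trans (ℕ.m≤n+m n L₀) (ℕ.m≤m*n (L₀ + n) 86)))
      (ℕ.≤-reflexive (sym (ℕ.^-*-assoc 2 (L₀ + n) 86))))
    step-factor : ∀ d → f (suc d) ≡ 2 ℕ.^ 86 * f d
    step-factor d = trans (cong (λ k → (2 ℕ.^ k) ℕ.^ 86) (ℕ.+-suc L₀ d)) (distribute 2 (2 ℕ.^ (L₀ + d)) 86)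
      where
      distribute : ∀ a b k → (a * b) ℕ.^ k ≡ a ℕ.^ k * b ℕ.^ k
      distribute a b zero    = refl
      distribute a b (suc k) = trans (cong (a * b *_) (distribute a b k)) (ring a b (a ℕ.^ k) (b ℕ.^ k))
        where
        ring : ∀ a b p q → a * b * (p * q) ≡ a * p * (b * q)
        ring = ℕ-solve

theorem1p2 : ∀ (ε : ℚ) → 0ℚ ℚ.< ε →
    ∃[ N ] (∀ n → n ≥ 3 → n ≥ N →
    Pr[ randomGraphProcess n ∣ (λ ω → ∃[ τ ] (IsHittingTime 2 ω τ × GloballyRigid (lookup ω τ))) ]≥ (1ℚ ℚ.- ε))
theorem1p2 ε 0<ε = (2 ℕ.^ L₀) ℕ.^ 86 , λ n _ n≥N → go n (scale-of L₀ n n≥N)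
  where
  D = ℚ.denominator-1 ε
  -- The first summand ensures 4/L ≤ 1/denominator(ε) ≤ ε for the failure probability; the second is
  -- the lower bound on L in `Regime`.
  L₀ = 4 ℕ.* suc D ℕ.+ 1152
  go : ∀ n → ∃[ d ] ((2 ℕ.^ (L₀ ℕ.+ d)) ℕ.^ 86 ℕ.≤ n × n ℕ.≤ 2 ℕ.^ 86 ℕ.* (2 ℕ.^ (L₀ ℕ.+ d)) ℕ.^ 86) →
    Pr[ randomGraphProcess n ∣ (λ ω → ∃[ τ ] (IsHittingTime 2 ω τ × GloballyRigid (lookup ω τ))) ]≥ (1ℚ ℚ.- ε)
  go n (d , lower , upper) = Pr≥-antitone (randomGraphProcess n)
    (ℚ.+-monoʳ-≤ 1ℚ (ℚ.neg-antimono-≤ (ℚ.≤-trans (4l≤recip 4D≤L) (recip≤ ε 0<ε)))) rigid-whp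
    where
    L = L₀ ℕ.+ d
    4D≤L : 4 ℕ.* suc D ℕ.≤ L
    4D≤L = ℕ.≤-trans (ℕ.m≤m+n (4 ℕ.* suc D) 1152) (ℕ.m≤m+n L₀ d)
    1152≤L : 1152 ℕ.≤ L
    1152≤L = ℕ.≤-trans (ℕ.m≤n+m 1152 (4 ℕ.* suc D)) (ℕ.m≤m+n L₀ d)
    432KL²≤p : 432 ℕ.* (2 ℕ.^ 86 ℕ.* (L ℕ.* L)) ℕ.≤ 2 ℕ.^ L
    432KL²≤p = ℕ.≤-trans (ℕ.≤-reflexive (sym (ℕ.*-assoc 432 (2 ℕ.^ 86) (L ℕ.* L))))
      -- The base case 432 * 2^86 * 1152² ≤ 2^1152 is checked by evaluation.
      (exponential-dominates (432 ℕ.* 2 ℕ.^ 86) {1152} (ℕ.≤ᵇ⇒≤ 3 1152 _) (ℕ.≤ᵇ⇒≤ _ _ _) (ℕ.≤⇒≤′ 1152≤L))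
    regime : Regime n L (2 ℕ.^ 86)
    regime = record { 1≤K = ℕ.m^n>0 2 86 ; 1152≤L = 1152≤L ; p^86≤n = lower ; n≤Kp^86 = upper ; 432KL²≤p = 432KL²≤p }
    open WhpBound regime using (rigid-whp; 4l≤recip)
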